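{- Let $m\ge 2$ be an integer. The automorphism group of the group $\mathrm{Aut}(R_m)$ is $\mathrm{Aut}^*(R_m)$, in the sense that the action of $\mathrm{Aut}^*(R_m)$ on $\mathrm{Aut}(R_m)$ by conjugation induces an isomorphism from $\mathrm{Aut}^*(R_m)$ onto the full automorphism group of $\mathrm{Aut}(R_m)$.
   Context: Fix an integer $m\ge 2$. An $m$-edge-coloured complete graph is a complete graph each of whose edges is assigned one of the colours $1,\dots,m$. $R_m$ denotes the unique (up to isomorphism) countable $m$-edge-coloured complete graph which is universal (every finite or countable $m$-edge-coloured complete graph embeds in it, colour-preservingly) and homogeneous (every colour-preserving isomorphism between finite induced subgraphs extends to a colour-preserving automorphism of $R_m$). $\mathrm{Aut}(R_m)$ is the group of permutations of the vertex set of $R_m$ preserving the colour of every edge. $\mathrm{Aut}^*(R_m)$ is the group of permutations $g$ of the vertex set of $R_m$ which induce a permutation of the colours, i.e. for which there is a permutation $\pi$ of $\{1,\dots,m\}$ such that for all edges $\{u,v\}$, the colour of $\{u^g,v^g\}$ is $\pi$ applied to the colour of $\{u,v\}$. $\mathrm{Aut}(R_m)$ is a normal subgroup of $\mathrm{Aut}^*(R_m)$. -}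

module Defs where

open import Level using (0ℓ)
open import Data.Nat using (ℕ)
open import Data.Fin using (Fin)
open import Data.Product using (Σ; _×_; _,_; proj₁; proj₂)
open import Relation.Binary.PropositionalEquality using (_≡_; refl; trans; cong)
open import Relation.Nullary using (¬_)
open import Function.Bundles using (_↔_; Inverse; Injection)
open import Function.Definitions using (Injective)
open import Function.Construct.Composition using (_↔-∘_)
open import Function.Properties.Inverse using (↔⇒↣)

-- m-edge-coloured complete graphs on a vertex type V.
-- col u v is the colour of the edge {u,v}; its value for u ≡ v is
-- irrelevant (only used for u ≢ v).

record Colouring (m : ℕ) (V : Set) : Set where
  field
    col : V → V → Fin m
    sym : ∀ u v → col u v ≡ col v u

open Colouring public

Countable : Set → Set
Countable V = Σ (V → ℕ) (Injective _≡_ _≡_)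

Embedding : ∀ {m} {V W : Set} → Colouring m V → Colouring m W → Set
Embedding {m} {V} {W} d c =
  Σ (V → W) λ f → Injective _≡_ _≡_ f ×
    (∀ u v → ¬ u ≡ v → col c (f u) (f v) ≡ col d u v)

Perm : Set
Perm = ℕ ↔ ℕ

PreservesCol : ∀ {m} → Colouring m ℕ → (ℕ → ℕ) → Set
PreservesCol c f = ∀ u v → ¬ u ≡ v → col c (f u) (f v) ≡ col c u v

IsAut : ∀ {m} → Colouring m ℕ → Perm → Set
IsAut c σ = PreservesCol c (Inverse.to σ)

IsAut* : ∀ {m} → Colouring m ℕ → Perm → Set
IsAut* {m} c σ =
  Σ (Fin m ↔ Fin m) λ π →
    ∀ u v → ¬ u ≡ v → col c (Inverse.to σ u) (Inverse.to σ v) ≡ Inverse.to π (col c u v)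

Universal : ∀ {m} → Colouring m ℕ → Set₁
Universal {m} c = (V : Set) → Countable V → (d : Colouring m V) → Embedding d c

-- every colour-preserving isomorphism a i ↦ b i between finite induced
-- subgraphs (on vertices a 0..a (n-1) and b 0..b (n-1)) extends to an automorphism
Homogeneous : ∀ {m} → Colouring m ℕ → Set
Homogeneous c =
  (n : ℕ) (a b : Fin n → ℕ) →
  Injective _≡_ _≡_ a → Injective _≡_ _≡_ b →
  (∀ i j → ¬ i ≡ j → col c (a i) (a j) ≡ col c (b i) (b j)) →
  Σ Perm λ σ → IsAut c σ × (∀ i → Inverse.to σ (a i) ≡ b i)

Aut : ∀ {m} → Colouring m ℕ → Set
Aut c = Σ Perm (IsAut c)

_≈A_ : ∀ {m} {c : Colouring m ℕ} → Aut c → Aut c → Set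
g ≈A h = ∀ u → Inverse.to (proj₁ g) u ≡ Inverse.to (proj₁ h) u

-- product g · h : first apply g, then h  (u^(gh) = (u^g)^h)
_·_ : ∀ {m} {c : Colouring m ℕ} → Aut c → Aut c → Aut c
_·_ {c = c} (g , pg) (h , ph) = (h ↔-∘ g) , pr
  where
  pr : IsAut c (h ↔-∘ g)
  pr u v u≢v = trans (ph _ _ (λ e → u≢v (Injection.injective (↔⇒↣ g) e))) (pg u v u≢v)

record GroupAut {m} (c : Colouring m ℕ) : Set where
  field
    φ     : Aut c → Aut c
    φ-inv : Aut c → Aut c
    φ-cong : ∀ g h → _≈A_ {c = c} g h → _≈A_ {c = c} (φ g) (φ h)
    φ-inv-cong : ∀ g h → _≈A_ {c = c} g h → _≈A_ {c = c} (φ-inv g) (φ-inv h)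
    φ-hom : ∀ g h → _≈A_ {c = c} (φ (_·_ {c = c} g h)) (_·_ {c = c} (φ g) (φ h))
    φ-inv-φ : ∀ g → _≈A_ {c = c} (φ-inv (φ g)) g
    φ-φ-inv : ∀ g → _≈A_ {c = c} (φ (φ-inv g)) g

-- conjugation: (g⁻¹ h g) in right-action notation, i.e. u ↦ g(h(g⁻¹ u))

conj : Perm → Perm → ℕ → ℕ
conj g h u = Inverse.to g (Inverse.to h (Inverse.from g u))

{-# OPTIONS --safe #-}

-- Only one property of R_m is used: every colouring of the edges from a new vertex to a finite set is
-- realised.  Let G = Aut(R_m) act on the vertices through Φ; the point is that this action is
-- continuous.  Call a tuple in G generic if its orbits are finite and every finite extension of a
-- finite invariant subgraph is realised.  Since finite coloured graphs have the extension property for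
-- partial automorphisms, a generic tuple can be prolonged by an f such that σ f is generic over it for
-- each of countably many σ.  Let H be the stabiliser of w and τ j a transversal of G/H; with σ = τ j ⁻¹
-- such an f gives a generic element of H.  If elements e n fixing 0, …, n - 1 all moved w, then there
-- would be generic sequences with d n in H and b n moving n, chosen so that back and forth yields f in G
-- with f (d n) = (b n) f for all n; but for n the image of w under f, b n fixes n.
--
-- The pointwise stabiliser of 0, …, n - 1 is topologically generated by an element t together with a
-- sequence converging to 1, so for some n all of it fixes w.  Comparing minimal finite supports for Φ
-- and Φ⁻¹ shows that the stabiliser of a vertex v fixes a vertex γ v in the action through Φ, and then
-- Φ is conjugation by γ.
--
-- Everything is constructive: existence under ¬¬ is turned into existence by evaluating Φ⁻¹ at an
-- automorphism that bounds the search.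
module Submission where

open import Defs hiding (sym) renaming (col to edge)
open import Algebra.Bundles using (CommutativeSemigroup)
import Algebra.Properties.CommutativeSemigroup as CommutativeSemigroupProperties
open import Data.Empty using (⊥; ⊥-elim)
open import Data.Fin using (Fin; toℕ; zero; suc; fromℕ<; combine; remQuot; finToFun; funToFin)
import Data.Fin.Properties as Fin
open import Data.Integer using (ℤ; +_; -[1+_]; ∣_∣) renaming (_+_ to _+ℤ_; _-_ to _-ℤ_; -_ to -ℤ_)
import Data.Integer.Properties as ℤ
open import Data.List using (List; []; _∷_; map; tabulate; allFin; upTo; _++_; filter; length)
import Data.List as List
open import Data.List.Properties using (filter-notAll; length-upTo)
open import Data.List.Membership.Propositional using (_∈_; _∉_; lose)
open import Data.List.Membership.Propositional.Properties
  using (∈-map⁺; ∈-map⁻; ∈-tabulate⁺; ∈-tabulate⁻; ∈-allFin; ∈-upTo⁺; ∈-upTo⁻; ∈-++⁺ˡ; ∈-++⁺ʳ; ∈-++⁻; ∈-filter⁺)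
open import Data.List.Relation.Unary.All using (all?)
import Data.List.Relation.Unary.All as All
open import Data.List.Relation.Unary.Any using (here; there)
import Data.List.Relation.Unary.Any as Any
open import Data.List.Relation.Unary.Any.Properties using (lookup-index)
open import Data.Maybe using (Maybe; just; nothing; maybe; _>>=_)
import Data.Maybe as Maybe
open import Data.Maybe.Properties using (≡-dec; just-injective)
open import Data.Nat hiding (_≟_)
open import Data.Nat.DivMod using (_mod_; _%_; %-distribˡ-+; m%n%n≡m%n; m%n<n; m<n⇒m%n≡m; n%n≡0)
open import Data.Nat.Properties
open import Data.List.Membership.DecPropositional _≟_ using (_∈?_)
open import Data.Product using (Σ; ∃; _×_; _,_; proj₁; proj₂; uncurry; swap)
open import Data.Product.Function.NonDependent.Propositional using (_×-↔_)
open import Data.Product.Properties using () renaming (≡-dec to ×-≡-dec)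
open import Data.Sum using (_⊎_; inj₁; inj₂)
import Data.Sum as Sum
open import Data.Sum.Function.Propositional using (_⊎-↔_)
open import Data.Sum.Properties using (inj₁-injective; inj₂-injective) renaming (≡-dec to ⊎-≡-dec)
open import Data.Unit using (⊤; tt)
open import Function using (_∘_; id)
open import Function.Bundles using (_↔_; Inverse; mk↔ₛ′)
open import Function.Construct.Composition using (_↔-∘_)
open import Function.Construct.Identity using (↔-id)
open import Function.Construct.Symmetry using (↔-sym)
open import Function.Definitions using (Injective)
open import Relation.Binary using (DecidableEquality)
open import Relation.Binary.Definitions using (tri<; tri≈; tri>)
open import Relation.Binary.PropositionalEquality hiding (J)
open import Relation.Nullary using (¬_; Dec; yes; no; contradiction; ¬?)
open import Relation.Nullary.Decidable using (_×-dec_; _→-dec_; map′; decidable-stable)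

-- The obstacle is that Φ is an abstract automorphism and says nothing about convergence; continuity
-- has to be extracted from conjugacy. The image of w under f is unknown while f is being built, so
-- b n is made to move n for every n in advance. This is possible because a generic f and its
-- product z f with a small z moving n agree on any prescribed finite part, are both generic, and
-- cannot both fix n.
--
-- Refuting sequences of small elements yields no n by itself, which is why topological generators
-- appear. Whether the stabiliser of 0, ..., n - 1 fixes w is decided by evaluating the action at
-- two elements: `t`, and one that copies the first member of the sequence that moves w. If the
-- answer were negative for every n, the witnesses would form a refuted sequence. Words in the
-- generators suffice because an element and its approximations differ by small elements.
--
-- On supports: if w lies in the minimal support of v for Φ⁻¹, the stabiliser of v gives w only
-- finitely many images, and this forces the support of w for Φ into {v}.

bound : {A : Set} → (A → ℕ) → List A → ℕ
bound f []       = 0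
bound f (x ∷ xs) = suc (f x) ⊔ bound f xs

bound-∈ : ∀ {A : Set} (f : A → ℕ) {x xs} → x ∈ xs → f x < bound f xs
bound-∈ f {xs = y ∷ xs} (here refl) = m≤m⊔n (suc (f y)) (bound f xs)
bound-∈ f {xs = y ∷ xs} (there p)   = ≤-trans (bound-∈ f p) (m≤n⊔m (suc (f y)) _)

-- Codes for pairs and finite sequences

step : ℕ × ℕ → ℕ × ℕ
step (zero  , b) = suc b , zero
step (suc a , b) = a , suc b

unpair : ℕ → ℕ × ℕ
unpair zero    = 0 , 0
unpair (suc n) = step (unpair n)

-- The walk `step` descends each antidiagonal: (a , b + 1) comes right after (a + 1 , b), and (a + 1
-- , 0) right after (0 , a), the last point of the previous antidiagonal.
pairing : ∀ s b a → a + b ≡ s → Σ ℕ λ n → unpair n ≡ (a , b)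
pairing zero zero zero _ = 0 , refl
pairing s (suc b) a e with pairing s b (suc a) (trans (sym (+-suc a b)) e)
... | n , q = suc n , cong step q
pairing (suc s) zero (suc a) e with pairing s a zero (trans (sym (+-identityʳ a)) (suc-injective e))
... | n , q = suc n , cong step q

abstract
  pair : ℕ → ℕ → ℕ
  pair a b = proj₁ (pairing (a + b) b a refl)

  unpair-pair : ∀ a b → unpair (pair a b) ≡ (a , b)
  unpair-pair a b = proj₂ (pairing (a + b) b a refl)

-- Codes dominate their components. Later this puts a new row number above the rows it refers to,
-- and the key of a distant point above the width of a row.
unpair-≤ : ∀ n → proj₁ (unpair n) + proj₂ (unpair n) ≤ n
unpair-≤ zero = z≤n
unpair-≤ (suc n) with unpair n | unpair-≤ n
... | zero  , b | le = s≤s (≤-trans (≤-reflexive (+-identityʳ b)) le)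
... | suc a , b | le = ≤-trans (≤-reflexive (+-suc a b)) (m≤n⇒m≤1+n le)

+≤pair : ∀ a b → a + b ≤ pair a b
+≤pair a b = subst (λ p → proj₁ p + proj₂ p ≤ pair a b) (unpair-pair a b) (unpair-≤ (pair a b))

-- Every number is read as an infinite sequence, so decoding is total and any number may serve as a
-- task.
decode : ℕ → ℕ → ℕ
decode t zero    = proj₁ (unpair t)
decode t (suc i) = decode (proj₂ (unpair t)) i

encode : (n : ℕ) → (ℕ → ℕ) → ℕ
encode zero    f = 0
encode (suc n) f = pair (f 0) (encode n (f ∘ suc))

decode-encode : ∀ n f i → i < n → decode (encode n f) i ≡ f i
decode-encode (suc n) f zero    _       = cong proj₁ (unpair-pair (f 0) (encode n (f ∘ suc)))
decode-encode (suc n) f (suc i) (s≤s p) = trans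
  (cong (λ p → decode (proj₂ p) i) (unpair-pair (f 0) (encode n (f ∘ suc))))
  (decode-encode n (f ∘ suc) i p)

atFin : (n : ℕ) → (Fin n → ℕ) → ℕ → ℕ
atFin n f i with i <? n
... | yes p = f (fromℕ< p)
... | no  _ = 0

abstract
  encodeFin : (n : ℕ) → (Fin n → ℕ) → ℕ
  encodeFin n f = encode n (atFin n f)

  decode-encodeFin : ∀ n f (x : Fin n) → decode (encodeFin n f) (toℕ x) ≡ f x
  decode-encodeFin n f x = trans (decode-encode n _ _ (Fin.toℕ<n x)) (lem (toℕ x) refl)
    where
    lem : ∀ i → i ≡ toℕ x → atFin n f i ≡ f x
    lem i e with i <? n
    ... | yes p = cong f (Fin.toℕ-injective (trans (Fin.toℕ-fromℕ< p) e))
    ... | no ¬p = contradiction (subst (_< n) (sym e) (Fin.toℕ<n x)) ¬p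

-- Finite sets and finite partial maps

record Finite (C : Set) : Set where
  field
    size  : ℕ
    index : C ↔ Fin size

  open Inverse index public using () renaming (to to rank; from to unrank
    ; strictlyInverseˡ to rank-unrank; strictlyInverseʳ to unrank-rank)

  rank-injective : ∀ {x y} → rank x ≡ rank y → x ≡ y
  rank-injective {x} {y} e = trans (sym (unrank-rank x)) (trans (cong unrank e) (unrank-rank y))

  infix 4 _≟C_
  _≟C_ : DecidableEquality C
  x ≟C y = map′ rank-injective (cong rank) (rank x Fin.≟ rank y)

  elements : List C
  elements = tabulate unrank

  ∈-elements : ∀ x → x ∈ elements
  ∈-elements x = subst (_∈ elements) (unrank-rank x) (∈-tabulate⁺ {f = unrank} (rank x))

finFinite : ∀ n → Finite (Fin n)
finFinite n = record { size = n ; index = ↔-id (Fin n) }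

infixr 2 _×-finite_
infixr 1 _⊎-finite_

_⊎-finite_ : {A B : Set} → Finite A → Finite B → Finite (A ⊎ B)
F ⊎-finite H = record { size = _ ; index = ↔-sym Fin.+↔⊎ ↔-∘ (Finite.index F ⊎-↔ Finite.index H) }

_×-finite_ : {A B : Set} → Finite A → Finite B → Finite (A × B)
F ×-finite H = record { size = _ ; index = ↔-sym Fin.*↔× ↔-∘ (Finite.index F ×-↔ Finite.index H) }

Functional : {A B : Set} → List (A × B) → Set
Functional L = ∀ {x y y′} → (x , y) ∈ L → (x , y′) ∈ L → y ≡ y′

module Lookup {A B : Set} (_≟_ : DecidableEquality A) where

  lookup : List (A × B) → A → Maybe B
  lookup []             a = nothing
  lookup ((x , y) ∷ L) a with a ≟ x
  ... | yes _ = just y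
  ... | no  _ = lookup L a

  lookup-just : ∀ L {a b} → lookup L a ≡ just b → (a , b) ∈ L
  lookup-just ((x , y) ∷ L) {a} e with a ≟ x
  lookup-just ((x , y) ∷ L) refl | yes refl = here refl
  ... | no _ = there (lookup-just L e)

  lookup-nothing : ∀ L {a b} → lookup L a ≡ nothing → (a , b) ∉ L
  lookup-nothing ((x , y) ∷ L) {a} e p with a ≟ x
  lookup-nothing ((x , y) ∷ L) () p | yes _
  lookup-nothing ((x , y) ∷ L) e (here refl) | no a≢x = a≢x refl
  lookup-nothing ((x , y) ∷ L) e (there p)   | no _   = lookup-nothing L e p

  lookup-∈ : ∀ L → Functional L → ∀ {a b} → (a , b) ∈ L → lookup L a ≡ just b
  lookup-∈ L fun {a} p with lookup L a in e
  ... | just _  = cong just (fun (lookup-just L e) p)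
  ... | nothing = contradiction p (lookup-nothing L e)

module Preimage {A C : Set} (_≟_ : DecidableEquality A) (F : Finite C) (j : C → A)
                (j-inj : Injective _≡_ _≡_ j) where
  open Lookup {A} {C} _≟_
  open Finite F

  graph : List (A × C)
  graph = map (λ z → j z , z) elements

  graph⁻ : ∀ {a z} → (a , z) ∈ graph → a ≡ j z
  graph⁻ p with ∈-map⁻ (λ z → j z , z) p
  ... | _ , _ , refl = refl

  preimage : A → Maybe C
  preimage = lookup graph

  preimage-just : ∀ {a z} → preimage a ≡ just z → a ≡ j z
  preimage-just e = graph⁻ (lookup-just graph e)

  preimage-nothing : ∀ {a} → preimage a ≡ nothing → ∀ z → a ≢ j z
  preimage-nothing e z refl = lookup-nothing graph e (∈-map⁺ (λ z → j z , z) (∈-elements z))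

  preimage-j : ∀ z → preimage (j z) ≡ just z
  preimage-j z = lookup-∈ graph
    (λ p q → j-inj (trans (sym (graph⁻ p)) (graph⁻ q))) (∈-map⁺ (λ z → j z , z) (∈-elements z))

  -- The inverses settle the undefined case: if `p a` lay in the image of `j`, pulling back along
  -- `p⁻` and `q⁻` would put `a` there as well.
  preimage-equivariant : (p : A → A) (p⁻ : A → A) (q q⁻ : C → C) →
    (∀ a → p⁻ (p a) ≡ a) → (∀ z → q (q⁻ z) ≡ z) → (∀ z → p (j z) ≡ j (q z)) →
    ∀ a → preimage (p a) ≡ Maybe.map q (preimage a)
  preimage-equivariant p p⁻ q q⁻ p⁻p qq⁻ eqv a with preimage a in e
  ... | just z = trans (cong (preimage ∘ p) (preimage-just e))
                       (trans (cong preimage (eqv z)) (preimage-j (q z)))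
  ... | nothing with preimage (p a) in e′
  ...   | nothing = refl
  ...   | just z  = contradiction a≡ (preimage-nothing e (q⁻ z))
    where
    a≡ : a ≡ j (q⁻ z)
    a≡ = trans (sym (p⁻p a)) (trans (cong p⁻ (trans (preimage-just e′)
           (trans (cong j (sym (qq⁻ z))) (sym (eqv (q⁻ z)))))) (p⁻p _))

-- Partial isomorphisms and back and forth

-- Being a partial isomorphism is a condition on two pairs at a time. It is therefore decidable for
-- finite relations, and passes to the union of a chain, where two pairs always share a stage.
record Match {K A B : Set} (cA : A → A → K) (cB : B → B → K) (x x′ : A) (y y′ : B) : Set where
  field
    fun : x ≡ x′ → y ≡ y′
    inj : y ≡ y′ → x ≡ x′
    col : x ≢ x′ → cB y y′ ≡ cA x x′
IsPI : {K A B : Set} → (A → A → K) → (B → B → K) → List (A × B) → Set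
IsPI cA cB L = ∀ {x y x′ y′} → (x , y) ∈ L → (x′ , y′) ∈ L → Match cA cB x x′ y y′

module Limit {K A B : Set} (cA : A → A → K) (cB : B → B → K)
  (L : ℕ → List (A × B)) (pi : ∀ s → IsPI cA cB (L s))
  (mono : ∀ s {p} → p ∈ L s → p ∈ L (suc s))
  (dom : ∀ a → Σ ℕ λ s → Σ B λ b → (a , b) ∈ L s)
  (ran : ∀ b → Σ ℕ λ s → Σ A λ a → (a , b) ∈ L s) where

  mono* : ∀ {s t} → s ≤′ t → ∀ {p} → p ∈ L s → p ∈ L t
  mono* (≤′-reflexive refl) p∈ = p∈
  mono* (≤′-step s≤t)       p∈ = mono _ (mono* s≤t p∈)

  match : ∀ {s t x y x′ y′} → (x , y) ∈ L s → (x′ , y′) ∈ L t → Match cA cB x x′ y y′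
  match {s} {t} p q = pi (s ⊔ t) (mono* (≤⇒≤′ (m≤m⊔n s t)) p) (mono* (≤⇒≤′ (m≤n⊔m s t)) q)

  to : A → B
  to a = proj₁ (proj₂ (dom a))

  from : B → A
  from b = proj₁ (proj₂ (ran b))

  to-∈ : ∀ {s a b} → (a , b) ∈ L s → to a ≡ b
  to-∈ {a = a} p = Match.fun (match (proj₂ (proj₂ (dom a))) p) refl

  to-from : ∀ b → to (from b) ≡ b
  to-from b = to-∈ (proj₂ (proj₂ (ran b)))

  from-to : ∀ a → from (to a) ≡ a
  from-to a = Match.inj (match (proj₂ (proj₂ (ran (to a)))) (proj₂ (proj₂ (dom a)))) refl

  iso : A ↔ B
  iso = mk↔ₛ′ to from to-from from-to

  to-col : ∀ x x′ → x ≢ x′ → cB (to x) (to x′) ≡ cA x x′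
  to-col x x′ = Match.col (match (proj₂ (proj₂ (dom x))) (proj₂ (proj₂ (dom x′))))

Extension : {K A : Set} → (A → A → K) → Set
Extension {K} {A} c = (l : List A) (t : A → K) → Σ A λ v → v ∉ l × (∀ {u} → u ∈ l → c v u ≡ t u)

module Extend {K A B : Set} (_≟A_ : DecidableEquality A) (_≟B_ : DecidableEquality B)
  (cA : A → A → K) (cB : B → B → K)
  (symA : ∀ x y → cA x y ≡ cA y x) (symB : ∀ x y → cB x y ≡ cB y x)
  (extB : Extension cB) where
  open Lookup {B} {A} _≟B_ using () renaming (lookup to lookup⁻; lookup-∈ to lookup⁻-∈)
  open Lookup {A} {B} _≟A_

  transpose : List (A × B) → List (B × A)
  transpose = map (λ p → proj₂ p , proj₁ p)

  transpose-functional : ∀ {L} → IsPI cA cB L → Functional (transpose L)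
  transpose-functional pi q r
    with ∈-map⁻ (λ p → proj₂ p , proj₁ p) q | ∈-map⁻ (λ p → proj₂ p , proj₁ p) r
  ... | _ , q′ , refl | _ , r′ , refl = Match.inj (pi q′ r′) refl

  type-along : List (A × B) → A → (B → K) → B → K
  type-along L a t y with lookup⁻ (transpose L) y
  ... | just x  = cA a x
  ... | nothing = t y

  type-along-∈ : ∀ L a t → IsPI cA cB L → ∀ {x y} → (x , y) ∈ L → type-along L a t y ≡ cA a x
  type-along-∈ L a t pi {x} {y} p
    rewrite lookup⁻-∈ (transpose L) (transpose-functional pi) (∈-map⁺ (λ p → proj₂ p , proj₁ p) p) = refl

  type-along-∉ : ∀ L a t {y} → (∀ {x} → (x , y) ∉ L) → type-along L a t y ≡ t y
  type-along-∉ L a t {y} ∉L with lookup⁻ (transpose L) y in e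
  ... | nothing = refl
  ... | just x with ∈-map⁻ (λ p → proj₂ p , proj₁ p)
                      (Lookup.lookup-just _≟B_ (transpose L) e)
  ...   | _ , p , refl = contradiction p ∉L

  -- The list `l` lets the new image keep away from given points. Colours to the range of `L` are
  -- forced by `a`, so `t` can be obeyed only outside that range.
  record Fresh (L : List (A × B)) (a : A) (l : List B) (t : B → K) : Set where
    field
      image  : B
      fresh  : ∀ {y} → y ∈ l → image ≢ y
      isPI   : IsPI cA cB ((a , image) ∷ L)
      colour : ∀ {y} → y ∈ l → (∀ {x} → (x , y) ∉ L) → cB image y ≡ t y

  extend-fresh : ∀ L → IsPI cA cB L → ∀ a → (∀ {b} → (a , b) ∉ L) → ∀ l t → Fresh L a l t
  extend-fresh L pi a a∉ l t = record
    { image = v ; fresh = λ p e → v∉ (∈-++ʳ p e) ; isPI = pi′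
    ; colour = λ p ∉L → trans (v-col (∈-++⁺ʳ (map proj₂ L) p)) (type-along-∉ L a t ∉L) }
    where
    ex = extB (map proj₂ L ++ l) (type-along L a t)
    v = proj₁ ex
    v∉ = proj₁ (proj₂ ex)
    v-col : ∀ {u} → u ∈ map proj₂ L ++ l → cB v u ≡ type-along L a t u
    v-col = proj₂ (proj₂ ex)
    ∈-++ʳ : ∀ {y} → y ∈ l → v ≡ y → v ∈ map proj₂ L ++ l
    ∈-++ʳ p refl = ∈-++⁺ʳ (map proj₂ L) p
    in-L : ∀ {x y} → (x , y) ∈ L → y ∈ map proj₂ L ++ l
    in-L p = ∈-++⁺ˡ (∈-map⁺ proj₂ p)
    pi′ : IsPI cA cB ((a , v) ∷ L)
    pi′ (here refl) (here refl) = record { fun = λ _ → refl ; inj = λ _ → refl ; col = λ n → contradiction refl n }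
    pi′ (here refl) (there q)   = record
      { fun = λ { refl → contradiction q a∉ } ; inj = λ { refl → contradiction (in-L q) v∉ }
      ; col = λ _ → trans (v-col (in-L q)) (type-along-∈ L a t pi q) }
    pi′ (there p) (here refl)   = record
      { fun = λ { refl → contradiction p a∉ } ; inj = λ { refl → contradiction (in-L p) v∉ }
      ; col = λ _ → trans (symB _ _) (trans (trans (v-col (in-L p)) (type-along-∈ L a t pi p)) (symA _ _)) }
    pi′ (there p) (there q) = pi p q

  record Forth (L : List (A × B)) (a : A) : Set where
    field
      list    : List (A × B)
      isPI    : IsPI cA cB list
      ⊇       : ∀ {p} → p ∈ L → p ∈ list
      image   : B
      image-∈ : (a , image) ∈ list

  forth : ∀ L → IsPI cA cB L → ∀ a → Forth L a
  forth L pi a with lookup L a in e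
  ... | just b  = record { list = L ; isPI = pi ; ⊇ = id ; image = b ; image-∈ = lookup-just L e }
  ... | nothing = record { list = (a , F.image) ∷ L ; isPI = F.isPI ; ⊇ = there
                         ; image = F.image ; image-∈ = here refl }
    where
    module F = Fresh (extend-fresh L pi a (lookup-nothing L e) [] (λ _ → cA a a))

IsPI-swap : {K A B : Set} {cA : A → A → K} {cB : B → B → K} → ∀ {L} → IsPI cA cB L →
  IsPI cB cA (map (λ p → proj₂ p , proj₁ p) L)
IsPI-swap pi p q with ∈-map⁻ (λ p → proj₂ p , proj₁ p) p | ∈-map⁻ (λ p → proj₂ p , proj₁ p) q
... | _ , p′ , refl | _ , q′ , refl = record
  { fun = Match.inj (pi p′ q′) ; inj = Match.fun (pi p′ q′)
  ; col = λ y≢y′ → sym (Match.col (pi p′ q′) (y≢y′ ∘ Match.fun (pi p′ q′))) }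

module BackAndForth {K A B : Set} (_≟A_ : DecidableEquality A) (_≟B_ : DecidableEquality B)
  (cA : A → A → K) (cB : B → B → K)
  (symA : ∀ x y → cA x y ≡ cA y x) (symB : ∀ x y → cB x y ≡ cB y x)
  (extA : Extension cA) (extB : Extension cB)
  (eA : ℕ → A) (iA : A → ℕ) (eA-iA : ∀ a → eA (iA a) ≡ a)
  (eB : ℕ → B) (iB : B → ℕ) (eB-iB : ∀ b → eB (iB b) ≡ b)
  (L₀ : List (A × B)) (pi₀ : IsPI cA cB L₀) where

  module F = Extend _≟A_ _≟B_ cA cB symA symB extB
  module R = Extend _≟B_ _≟A_ cB cA symB symA extA

  swap-∈ : ∀ {C D : Set} {L : List (C × D)} {x y} → (x , y) ∈ L → (y , x) ∈ map (λ p → proj₂ p , proj₁ p) L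
  swap-∈ = ∈-map⁺ (λ p → proj₂ p , proj₁ p)

  module Step (s : ℕ) (L : List (A × B)) (pi : IsPI cA cB L) where
    module f = F.Forth (F.forth L pi (eA s))
    module r = R.Forth (R.forth (map (λ p → proj₂ p , proj₁ p) f.list) (IsPI-swap f.isPI) (eB s))
    next : List (A × B)
    next = map (λ p → proj₂ p , proj₁ p) r.list
    next-pi : IsPI cA cB next
    next-pi = IsPI-swap r.isPI
    next-⊇ : ∀ {p} → p ∈ L → p ∈ next
    next-⊇ p = swap-∈ (r.⊇ (swap-∈ (f.⊇ p)))
    next-dom : (eA s , f.image) ∈ next
    next-dom = swap-∈ (r.⊇ (swap-∈ f.image-∈))
    next-ran : (r.image , eB s) ∈ next
    next-ran = swap-∈ r.image-∈

  chain : ℕ → Σ (List (A × B)) (IsPI cA cB)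
  chain zero    = L₀ , pi₀
  chain (suc s) = Step.next s (proj₁ (chain s)) (proj₂ (chain s)) ,
                  Step.next-pi s (proj₁ (chain s)) (proj₂ (chain s))

  abstract
    result : Σ (A ↔ B) λ f → (∀ x x′ → x ≢ x′ → cB (Inverse.to f x) (Inverse.to f x′) ≡ cA x x′) ×
                            (∀ {a b} → (a , b) ∈ L₀ → Inverse.to f a ≡ b)
    result = Lim.iso , Lim.to-col , λ p → Lim.to-∈ {0} p
      where
      module Lim = Limit cA cB (proj₁ ∘ chain) (λ s → proj₂ (chain s))
        (λ s → Step.next-⊇ s _ (proj₂ (chain s)))
        (λ a → suc (iA a) , _ , subst (λ x → (x , Step.f.image (iA a) _ (proj₂ (chain (iA a)))) ∈ proj₁ (chain (suc (iA a))))
                 (eA-iA a) (Step.next-dom (iA a) _ (proj₂ (chain (iA a)))))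
        (λ b → suc (iB b) , _ , subst (λ x → (Step.r.image (iB b) _ (proj₂ (chain (iB b))) , x) ∈ proj₁ (chain (suc (iB b))))
                 (eB-iB b) (Step.next-ran (iB b) _ (proj₂ (chain (iB b)))))

-- The colours as a cyclic group

module Cyclic (k : ℕ) where
  open ≡-Reasoning

  Z : Set
  Z = Fin (suc k)

  infixl 6 _⊕_
  infix  8 ⊖_

  abstract
    _⊕_ : Z → Z → Z
    a ⊕ b = (toℕ a + toℕ b) mod suc k

    ⊖_ : Z → Z
    ⊖ a = (suc k ∸ toℕ a) mod suc k

    toℕ-mod : ∀ n → toℕ (n mod suc k) ≡ n % suc k
    toℕ-mod n = Fin.toℕ-fromℕ< (m%n<n n (suc k))

    ⊕-comm : ∀ a b → a ⊕ b ≡ b ⊕ a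
    ⊕-comm a b = cong (_mod suc k) (+-comm (toℕ a) (toℕ b))

    %-addˡ : ∀ a b → (a % suc k + b) % suc k ≡ (a + b) % suc k
    %-addˡ a b = begin
      (a % suc k + b) % suc k                   ≡⟨ %-distribˡ-+ (a % suc k) b (suc k) ⟩
      (a % suc k % suc k + b % suc k) % suc k   ≡⟨ cong (λ z → (z + b % suc k) % suc k) (m%n%n≡m%n a (suc k)) ⟩
      (a % suc k + b % suc k) % suc k           ≡⟨ %-distribˡ-+ a b (suc k) ⟨
      (a + b) % suc k ∎

    toℕ-⊕ˡ : ∀ a n → ((a mod suc k) ⊕ n) ≡ (a + toℕ n) mod suc k
    toℕ-⊕ˡ a n = Fin.toℕ-injective (begin
      toℕ ((a mod suc k) ⊕ n)              ≡⟨ toℕ-mod (toℕ (a mod suc k) + toℕ n) ⟩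
      (toℕ (a mod suc k) + toℕ n) % suc k  ≡⟨ cong (λ z → (z + toℕ n) % suc k) (toℕ-mod a) ⟩
      (a % suc k + toℕ n) % suc k          ≡⟨ %-addˡ a (toℕ n) ⟩
      (a + toℕ n) % suc k                  ≡⟨ toℕ-mod (a + toℕ n) ⟨
      toℕ ((a + toℕ n) mod suc k) ∎)

    ⊕-assoc : ∀ a b c → (a ⊕ b) ⊕ c ≡ a ⊕ (b ⊕ c)
    ⊕-assoc a b c = begin
      (a ⊕ b) ⊕ c                          ≡⟨ toℕ-⊕ˡ (toℕ a + toℕ b) c ⟩
      (toℕ a + toℕ b + toℕ c) mod suc k    ≡⟨ cong (_mod suc k) (trans (+-assoc (toℕ a) _ _) (+-comm (toℕ a) _)) ⟩
      (toℕ b + toℕ c + toℕ a) mod suc k    ≡⟨ toℕ-⊕ˡ (toℕ b + toℕ c) a ⟨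
      (b ⊕ c) ⊕ a                          ≡⟨ ⊕-comm (b ⊕ c) a ⟩
      a ⊕ (b ⊕ c) ∎

    ⊕-identityʳ : ∀ a → a ⊕ zero ≡ a
    ⊕-identityʳ a = Fin.toℕ-injective (begin
      toℕ ((toℕ a + 0) mod suc k)  ≡⟨ toℕ-mod (toℕ a + 0) ⟩
      (toℕ a + 0) % suc k          ≡⟨ cong (_% suc k) (+-identityʳ (toℕ a)) ⟩
      toℕ a % suc k                ≡⟨ m<n⇒m%n≡m (Fin.toℕ<n a) ⟩
      toℕ a ∎)

    ⊕-identityˡ : ∀ a → zero ⊕ a ≡ a
    ⊕-identityˡ a = trans (⊕-comm zero a) (⊕-identityʳ a)

    ⊕-inverseˡ : ∀ a → ⊖ a ⊕ a ≡ zero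
    ⊕-inverseˡ a = begin
      ⊖ a ⊕ a                               ≡⟨ toℕ-⊕ˡ (suc k ∸ toℕ a) a ⟩
      (suc k ∸ toℕ a + toℕ a) mod suc k     ≡⟨ cong (_mod suc k) (m∸n+n≡m (<⇒≤ (Fin.toℕ<n a))) ⟩
      suc k mod suc k                       ≡⟨ Fin.toℕ-injective (trans (toℕ-mod (suc k)) (n%n≡0 (suc k))) ⟩
      zero ∎

    ⊕-inverseʳ : ∀ a → a ⊕ ⊖ a ≡ zero
    ⊕-inverseʳ a = trans (⊕-comm a (⊖ a)) (⊕-inverseˡ a)

  ⊕-commutativeSemigroup : CommutativeSemigroup _ _
  ⊕-commutativeSemigroup = record
    { Carrier = Z ; _≈_ = _≡_ ; _∙_ = _⊕_
    ; isCommutativeSemigroup = record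
      { isSemigroup = record
        { isMagma = record { isEquivalence = isEquivalence ; ∙-cong = cong₂ _⊕_ }
        ; assoc = ⊕-assoc }
      ; comm = ⊕-comm } }

  open CommutativeSemigroupProperties ⊕-commutativeSemigroup using (interchange)

  ⊕-cancel : ∀ a b e f → e ⊕ f ≡ zero → (a ⊕ e) ⊕ (b ⊕ f) ≡ a ⊕ b
  ⊕-cancel a b e f ef = begin
    (a ⊕ e) ⊕ (b ⊕ f) ≡⟨ interchange a e b f ⟩
    (a ⊕ b) ⊕ (e ⊕ f) ≡⟨ cong (a ⊕ b ⊕_) ef ⟩
    (a ⊕ b) ⊕ zero    ≡⟨ ⊕-identityʳ _ ⟩
    a ⊕ b ∎

  ⊕-difference : ∀ a b a′ b′ → a ⊕ b ≡ a′ ⊕ b′ → (a′ ⊕ ⊖ a) ⊕ (b′ ⊕ ⊖ b) ≡ zero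
  ⊕-difference a b a′ b′ e = begin
    (a′ ⊕ ⊖ a) ⊕ (b′ ⊕ ⊖ b) ≡⟨ interchange a′ (⊖ a) b′ (⊖ b) ⟩
    (a′ ⊕ b′) ⊕ (⊖ a ⊕ ⊖ b) ≡⟨ cong (_⊕ (⊖ a ⊕ ⊖ b)) e ⟨
    (a ⊕ b) ⊕ (⊖ a ⊕ ⊖ b)   ≡⟨ interchange a b (⊖ a) (⊖ b) ⟩
    (a ⊕ ⊖ a) ⊕ (b ⊕ ⊖ b)   ≡⟨ cong₂ _⊕_ (⊕-inverseʳ a) (⊕-inverseʳ b) ⟩
    zero ⊕ zero             ≡⟨ ⊕-identityʳ zero ⟩
    zero ∎

  ⊕-restore : ∀ a b → a ⊕ (b ⊕ ⊖ a) ≡ b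
  ⊕-restore a b = begin
    a ⊕ (b ⊕ ⊖ a) ≡⟨ ⊕-comm a _ ⟩
    b ⊕ ⊖ a ⊕ a   ≡⟨ ⊕-assoc b (⊖ a) a ⟩
    b ⊕ (⊖ a ⊕ a) ≡⟨ cong (b ⊕_) (⊕-inverseˡ a) ⟩
    b ⊕ zero      ≡⟨ ⊕-identityʳ b ⟩
    b ∎

  ⊕-undoʳ : ∀ a e → (a ⊕ e) ⊕ ⊖ e ≡ a
  ⊕-undoʳ a e = trans (⊕-assoc a e (⊖ e)) (trans (cong (a ⊕_) (⊕-inverseʳ e)) (⊕-identityʳ a))

  ⊕-undoˡ : ∀ a e → (a ⊕ ⊖ e) ⊕ e ≡ a
  ⊕-undoˡ a e = trans (⊕-assoc a (⊖ e) e) (trans (cong (a ⊕_) (⊕-inverseˡ e)) (⊕-identityʳ a))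

-- The extension property for partial automorphisms

module Structures (k : ℕ) where

  Colour : Set
  Colour = Fin (suc k)

  red : Colour
  red = zero

  record Str (n : ℕ) (C : Set) : Set where
    field
      colour   : C → C → Colour
      symm     : ∀ x y → colour x y ≡ colour y x
      π π⁻     : Fin n → C → C
      π-π⁻     : ∀ i x → π i (π⁻ i x) ≡ x
      π⁻-π     : ∀ i x → π⁻ i (π i x) ≡ x
      preserve : ∀ i x y → x ≢ y → colour (π i x) (π i y) ≡ colour x y

    π-injective : ∀ i {x y} → π i x ≡ π i y → x ≡ y
    π-injective i {x} {y} e = trans (sym (π⁻-π i x)) (trans (cong (π⁻ i) e) (π⁻-π i y))

  reduct : ∀ {n C} → Str (suc n) C → Str n C
  reduct S = record { colour = S.colour ; symm = S.symm ; π = S.π ∘ suc ; π⁻ = S.π⁻ ∘ suc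
                    ; π-π⁻ = S.π-π⁻ ∘ suc ; π⁻-π = S.π⁻-π ∘ suc ; preserve = S.preserve ∘ suc }
    where module S = Str S

  -- The property established by Hrushovski for graphs: finitely many partial automorphisms of a
  -- finite graph become total in a larger finite one.
  record EPPA (n N : ℕ) (c : Fin N → Fin N → Colour) (g : Fin n → Fin N → Maybe (Fin N)) : Set₁ where
    field
      C        : Set
      finite   : Finite C
      str      : Str n C
      e        : Fin N → C
      e-inj    : ∀ {x y} → e x ≡ e y → x ≡ y
      e-colour : ∀ x y → x ≢ y → Str.colour str (e x) (e y) ≡ c x y
      extends  : ∀ i {x y} → g i x ≡ just y → Str.π str i (e x) ≡ e y

  module _ (n N : ℕ) (c : Fin N → Fin N → Colour) (c-sym : ∀ x y → c x y ≡ c y x)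
    (g : Fin n → Fin N → Maybe (Fin N))
    (g-partial : ∀ i {x y x′ y′} → g i x ≡ just y → g i x′ ≡ just y′ → Match c c x x′ y y′) where

    open Cyclic k

    private
      U : Set
      U = Fin N ⊎ Fin N

      finU : Finite U
      finU = finFinite N ⊎-finite finFinite N

      open Finite finU

      cU : U → U → Colour
      cU (inj₁ x) (inj₁ y) = c x y
      cU (inj₁ x) (inj₂ y) = red
      cU (inj₂ x) _        = red

      cU-sym : ∀ x y → cU x y ≡ cU y x
      cU-sym (inj₁ x) (inj₁ y) = c-sym x y
      cU-sym (inj₁ x) (inj₂ y) = refl
      cU-sym (inj₂ x) (inj₁ y) = refl
      cU-sym (inj₂ x) (inj₂ y) = refl

      -- A partial injection becomes a permutation of two copies of its carrier.
      module Perm (i : Fin n) where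
        graph⁻ : Fin N → Maybe (Fin N)
        graph⁻ y with Fin.any? (λ x → ≡-dec Fin._≟_ (g i x) (just y))
        ... | yes (x , _) = just x
        ... | no _        = nothing

        graph⁻-just : ∀ {x y} → graph⁻ y ≡ just x → g i x ≡ just y
        graph⁻-just {x} {y} e with Fin.any? (λ x → ≡-dec Fin._≟_ (g i x) (just y))
        graph⁻-just refl | yes (x , p) = p

        just-graph⁻ : ∀ {x y} → g i x ≡ just y → graph⁻ y ≡ just x
        just-graph⁻ {x} {y} e with Fin.any? (λ x → ≡-dec Fin._≟_ (g i x) (just y))
        ... | yes (x′ , p) = cong just (Match.inj (g-partial i p e) refl)
        ... | no ¬p        = contradiction (x , e) ¬p

        P P⁻ : U → U
        P (inj₁ x) with g i x
        ... | just y  = inj₁ y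
        ... | nothing = inj₂ x
        -- The second copy is traversed backwards. A maximal chain of the partial injection runs up
        -- in the first copy, changes copies at its end, and runs down in the second, which closes
        -- it to a cycle.
        P (inj₂ y) with graph⁻ y
        ... | just x  = inj₂ x
        ... | nothing = inj₁ y
        P⁻ (inj₁ y) with graph⁻ y
        ... | just x  = inj₁ x
        ... | nothing = inj₂ y
        P⁻ (inj₂ x) with g i x
        ... | just y  = inj₂ y
        ... | nothing = inj₁ x

        P-P⁻ : ∀ u → P (P⁻ u) ≡ u
        P-P⁻ (inj₁ y) with graph⁻ y in e
        ... | just x rewrite graph⁻-just e = refl
        ... | nothing rewrite e = refl
        P-P⁻ (inj₂ x) with g i x in e
        ... | just y rewrite just-graph⁻ e = refl
        ... | nothing rewrite e = refl

        P⁻-P : ∀ u → P⁻ (P u) ≡ u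
        P⁻-P (inj₁ x) with g i x in e
        ... | just y rewrite just-graph⁻ e = refl
        ... | nothing rewrite e = refl
        P⁻-P (inj₂ y) with graph⁻ y in e
        ... | just x rewrite graph⁻-just e = refl
        ... | nothing rewrite e = refl

        D : U → Set
        D u = ∃ λ x → ∃ λ y → u ≡ inj₁ x × g i x ≡ just y

        D? : ∀ u → Dec (D u)
        D? (inj₁ x) with g i x in e
        ... | just y  = yes (x , y , refl , e)
        ... | nothing = no λ { (_ , y , refl , e′) → contradiction (trans (sym e) e′) λ () }
        D? (inj₂ x) = no λ { (_ , _ , () , _) }

        P-D : ∀ {x y} → g i x ≡ just y → P (inj₁ x) ≡ inj₁ y
        P-D e rewrite e = refl

        D-colour : ∀ {u v} → D u → D v → u ≢ v → cU (P u) (P v) ≡ cU u v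
        D-colour (x , _ , refl , p) (x′ , _ , refl , p′) u≢v rewrite P-D p | P-D p′ =
          Match.col (g-partial i p p′) (u≢v ∘ cong inj₁)

      -- The number of maps from `U` to the colours. Coding these maps as elements of `Fin M` makes
      -- pointwise equal maps equal without function extensionality.
      M : ℕ
      M = suc k ^ size

      abstract
        app : Fin M → U → Colour
        app χ u = finToFun χ (rank u)

        mk : (U → Colour) → Fin M
        mk f = funToFin (f ∘ unrank)

        app-mk : ∀ f u → app (mk f) u ≡ f u
        app-mk f u = trans (Fin.finToFun-funToFin (f ∘ unrank) (rank u)) (cong f (unrank-rank u))

        funToFin-cong : ∀ {p q} {f h : Fin p → Fin q} → (∀ x → f x ≡ h x) → funToFin f ≡ funToFin h
        funToFin-cong {zero} e = refl
        funToFin-cong {suc p} e = cong₂ combine (e zero) (funToFin-cong (e ∘ suc))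

        mk-app : ∀ {f} χ → (∀ u → f u ≡ app χ u) → mk f ≡ χ
        mk-app {f} χ e = trans
          (funToFin-cong λ x → trans (e (unrank x)) (cong (finToFun χ) (rank-unrank x)))
          (Fin.funToFin-finToFin {size} χ)

      -- The valuation construction of Hubička, Konečný and Nešetřil, with values in the cyclic group
      -- of colours: colour χ(y) + ξ(x) for the edge from (x , χ) to (y , ξ).
      V : Set
      V = U × Fin M

      cV : V → V → Colour
      cV (x , χ) (y , ξ) = app χ y ⊕ app ξ x

      -- Only the sum of the two values at a pair has to be the colour of the edge; the rank charges
      -- the whole colour to the later endpoint.
      valuation : U → U → Colour
      valuation u v with toℕ (rank v) <? toℕ (rank u)
      ... | yes _ = cU u v
      ... | no  _ = zero

      valuation-refl : ∀ u → valuation u u ≡ zero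
      valuation-refl u with toℕ (rank u) <? toℕ (rank u)
      ... | yes p = contradiction p (<-irrefl refl)
      ... | no  _ = refl

      valuation-sum : ∀ u v → u ≢ v → valuation u v ⊕ valuation v u ≡ cU u v
      valuation-sum u v u≢v with toℕ (rank v) <? toℕ (rank u) | toℕ (rank u) <? toℕ (rank v)
      ... | yes p | yes q = contradiction q (<-asym p)
      ... | yes p | no _  = ⊕-identityʳ _
      ... | no _  | yes q = trans (⊕-identityˡ _) (cU-sym v u)
      ... | no p  | no q  =
        contradiction (rank-injective (Fin.toℕ-injective (≤-antisym (≮⇒≥ p) (≮⇒≥ q)))) u≢v

      embed : U → V
      embed u = u , mk (valuation u)

      embed-colour : ∀ u v → u ≢ v → cV (embed u) (embed v) ≡ cU u v
      embed-colour u v u≢v = trans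
        (cong₂ _⊕_ (app-mk (valuation u) v) (app-mk (valuation v) u)) (valuation-sum u v u≢v)

      module Extension (i : Fin n) where
        open Perm i

        δ : U → U → Colour
        δ u v = valuation (P u) (P v) ⊕ ⊖ valuation u v

        -- The correction that makes θ agree with `P` on the embedded domain. There `ε u v` must be
        -- `δ u v`, while preservation of colours demands antisymmetry. The two demands are
        -- compatible when both points lie in `D` because the partial map preserves colours; with
        -- one point outside, antisymmetry is imposed by definition.
        ε : U → U → Colour
        ε u v with u ≟C v | D? u | D? v
        ... | yes _ | _     | _     = zero
        ... | no _  | yes _ | _     = δ u v
        ... | no _  | no _  | yes _ = ⊖ δ v u
        ... | no _  | no _  | no _  = zero

        ε-antisym : ∀ u v → ε u v ⊕ ε v u ≡ zero
        ε-antisym u v with u ≟C v | v ≟C u | D? u | D? v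
        ... | yes _ | yes _ | _     | _     = ⊕-identityʳ zero
        ... | yes p | no ¬p | _     | _     = contradiction (sym p) ¬p
        ... | no ¬p | yes p | _     | _     = contradiction (sym p) ¬p
        ... | no ¬p | no _  | yes d | yes d′ = ⊕-difference (valuation u v) (valuation v u) _ _
          (trans (valuation-sum u v ¬p) (trans (sym (D-colour d d′ ¬p))
            (sym (valuation-sum (P u) (P v) λ e →
              ¬p (trans (sym (P⁻-P u)) (trans (cong P⁻ e) (P⁻-P v)))))))
        ... | no _  | no _  | yes _ | no _  = ⊕-inverseʳ _
        ... | no _  | no _  | no _  | yes _ = ⊕-inverseˡ _
        ... | no _  | no _  | no _  | no _  = ⊕-identityʳ zero

        valuation-ε : ∀ u v → D u → valuation u v ⊕ ε u v ≡ valuation (P u) (P v)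
        valuation-ε u v d with u ≟C v | D? u | D? v
        ... | yes refl | _    | _ = trans (⊕-identityʳ _) (trans (valuation-refl u) (sym (valuation-refl (P u))))
        ... | no _  | yes _ | _   = ⊕-restore (valuation u v) _
        ... | no _  | no ¬d | _   = contradiction d ¬d

        θ θ⁻ : V → V
        θ  (x , χ) = P x , mk λ y → app χ (P⁻ y) ⊕ ε x (P⁻ y)
        θ⁻ (x , χ) = P⁻ x , mk λ y → app χ (P y) ⊕ ⊖ ε (P⁻ x) y

        θ-θ⁻ : ∀ v → θ (θ⁻ v) ≡ v
        θ-θ⁻ (x , χ) = cong₂ _,_ (P-P⁻ x) (mk-app χ λ y → trans
          (cong (_⊕ ε (P⁻ x) (P⁻ y)) (app-mk _ (P⁻ y)))
          (trans (⊕-undoˡ _ _) (cong (app χ) (P-P⁻ y))))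

        θ⁻-θ : ∀ v → θ⁻ (θ v) ≡ v
        θ⁻-θ (x , χ) = cong₂ _,_ (P⁻-P x) (mk-app χ λ y → trans
          (cong₂ (λ a b → a ⊕ ⊖ ε b y) (app-mk _ (P y)) (P⁻-P x))
          (trans (cong (λ z → (app χ z ⊕ ε x z) ⊕ ⊖ ε x y) (P⁻-P y)) (⊕-undoʳ _ _)))

        -- An edge receives `ε x y` from one endpoint and `ε y x` from the other, and these cancel.
        θ-colour : ∀ v w → cV (θ v) (θ w) ≡ cV v w
        θ-colour (x , χ) (y , ξ) = trans
          (cong₂ _⊕_ (trans (app-mk _ (P y)) (cong (λ z → app χ z ⊕ ε x z) (P⁻-P y)))
                     (trans (app-mk _ (P x)) (cong (λ z → app ξ z ⊕ ε y z) (P⁻-P x))))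
          (⊕-cancel (app χ y) (app ξ x) (ε x y) (ε y x) (ε-antisym x y))

        θ-embed : ∀ u → D u → θ (embed u) ≡ embed (P u)
        θ-embed u d = cong (P u ,_) (mk-app (mk (valuation (P u))) λ y → trans
          (cong (_⊕ ε u (P⁻ y)) (app-mk (valuation u) (P⁻ y)))
          (trans (valuation-ε u (P⁻ y) d)
            (trans (cong (valuation (P u)) (P-P⁻ y)) (sym (app-mk (valuation (P u)) y)))))

    abstract
      eppa : EPPA n N c g
      eppa = record
        { C = V
        ; finite = finU ×-finite finFinite M
        ; str = record
          { colour = cV ; symm = λ x y → ⊕-comm _ _
          ; π = Extension.θ ; π⁻ = Extension.θ⁻
          ; π-π⁻ = Extension.θ-θ⁻ ; π⁻-π = Extension.θ⁻-θ
          ; preserve = λ i x y _ → Extension.θ-colour i x y }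
        ; e = embed ∘ inj₁
        ; e-inj = inj₁-injective ∘ cong proj₁
        ; e-colour = λ x y x≢y → embed-colour (inj₁ x) (inj₁ y) (x≢y ∘ inj₁-injective)
        ; extends = λ i {x} {y} e → trans (Extension.θ-embed i (inj₁ x) (x , y , refl , e))
                                          (cong embed (Perm.P-D i e)) }

-- Amalgamation over an invariant subgraph

module Amalgams (k : ℕ) where
  open Structures k

  -- The result of decoding an arbitrary number: tables without laws, which are tested by `valid?`
  -- before any gluing.
  record Raw (n N : ℕ) : Set where
    field
      colour : Fin N → Fin N → Colour
      π π⁻   : Fin n → Fin N → Fin N

  module _ {n : ℕ} {C : Set} (S : Str n C) (finite : Finite C) {N : ℕ} (T : Raw n N)
           (κ : Fin N → Maybe C) where

    private
      module S = Str S
      module T = Raw T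
      open Finite finite using (_≟C_)

    Agree : Maybe C → Maybe C → Colour → Set
    Agree (just z) (just w) a = S.colour z w ≡ a
    Agree (just z) nothing  a = ⊤
    Agree nothing  _        a = ⊤

    Agree? : ∀ z w a → Dec (Agree z w a)
    Agree? (just z) (just w) a = S.colour z w Fin.≟ a
    Agree? (just z) nothing  a = yes tt
    Agree? nothing  _        a = yes tt

    record Valid : Set where
      constructor valid
      field
        symm     : ∀ x y → T.colour x y ≡ T.colour y x
        π-π⁻     : ∀ i x → T.π i (T.π⁻ i x) ≡ x
        π⁻-π     : ∀ i x → T.π⁻ i (T.π i x) ≡ x
        preserve : ∀ i x y → x ≢ y → T.colour (T.π i x) (T.π i y) ≡ T.colour x y
        κ-inj    : ∀ x y → κ x ≢ nothing → κ x ≡ κ y → x ≡ y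
        κ-colour : ∀ x y → x ≢ y → Agree (κ x) (κ y) (T.colour x y)
        κ-eqv    : ∀ i x → κ (T.π i x) ≡ Maybe.map (S.π i) (κ x)

    valid? : Dec Valid
    valid? with
      (Fin.all? λ x → Fin.all? λ y → T.colour x y Fin.≟ T.colour y x) ×-dec
      (Fin.all? λ i → Fin.all? λ x → T.π i (T.π⁻ i x) Fin.≟ x) ×-dec
      (Fin.all? λ i → Fin.all? λ x → T.π⁻ i (T.π i x) Fin.≟ x) ×-dec
      (Fin.all? λ i → Fin.all? λ x → Fin.all? λ y → ¬? (x Fin.≟ y) →-dec
        (T.colour (T.π i x) (T.π i y) Fin.≟ T.colour x y)) ×-dec
      (Fin.all? λ x → Fin.all? λ y → ¬? (≡-dec _≟C_ (κ x) nothing) →-dec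
        (≡-dec _≟C_ (κ x) (κ y) →-dec (x Fin.≟ y))) ×-dec
      (Fin.all? λ x → Fin.all? λ y → ¬? (x Fin.≟ y) →-dec Agree? (κ x) (κ y) (T.colour x y)) ×-dec
      (Fin.all? λ i → Fin.all? λ x → ≡-dec _≟C_ (κ (T.π i x)) (Maybe.map (S.π i) (κ x)))
    ... | yes (a , b , c , d , e , f , g) = yes (valid a b c d e f g)
    ... | no ¬p = no λ { (valid a b c d e f g) → ¬p (a , b , c , d , e , f , g) }

    record Copy {D : Set} (str : Str n D) (inc : C → D) : Set where
      field
        j        : Fin N → D
        j-inj    : ∀ {x y} → j x ≡ j y → x ≡ y
        j-colour : ∀ x y → x ≢ y → Str.colour str (j x) (j y) ≡ T.colour x y
        j-eqv    : ∀ i x → Str.π str i (j x) ≡ j (T.π i x)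
        j-κ      : ∀ {x z} → κ x ≡ just z → j x ≡ inc z

    -- It exists for every `T`, so a stage can be built before its task is known to make sense; the
    -- copy of `T` is promised for valid data. With invalid data the amalgam is `S` itself.
    record Amalgam : Set₁ where
      field
        D          : Set
        finD       : Finite D
        str        : Str n D
        inc        : C → D
        inc-inj    : ∀ {x y} → inc x ≡ inc y → x ≡ y
        inc-colour : ∀ x y → x ≢ y → Str.colour str (inc x) (inc y) ≡ S.colour x y
        inc-eqv    : ∀ i x → Str.π str i (inc x) ≡ inc (S.π i x)
        copy       : Valid → Copy str inc

    private module Glue (v : Valid) where
      open Valid v

      κ⁻ : C → Maybe (Fin N)
      κ⁻ z with Fin.any? (λ x → ≡-dec _≟C_ (κ x) (just z))
      ... | yes (x , _) = just x
      ... | no _        = nothing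

      κ⁻-just : ∀ {z x} → κ⁻ z ≡ just x → κ x ≡ just z
      κ⁻-just {z} e with Fin.any? (λ x → ≡-dec _≟C_ (κ x) (just z))
      κ⁻-just refl | yes (_ , p) = p

      just-κ⁻ : ∀ {z x} → κ x ≡ just z → κ⁻ z ≡ just x
      just-κ⁻ {z} {x} e with Fin.any? (λ x → ≡-dec _≟C_ (κ x) (just z))
      ... | yes (x′ , p) = cong just (κ-inj x′ x (λ q → contradiction (trans (sym p) q) λ ()) (trans p (sym e)))
      ... | no ¬p        = contradiction (x , e) ¬p

      κ⁻-eqv : ∀ i z → κ⁻ (S.π i z) ≡ Maybe.map (T.π i) (κ⁻ z)
      κ⁻-eqv i z with κ⁻ z in e
      ... | just x  = just-κ⁻ (trans (κ-eqv i x) (cong (Maybe.map (S.π i)) (κ⁻-just e)))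
      ... | nothing with κ⁻ (S.π i z) in e′
      ...   | nothing = refl
      ...   | just x  = contradiction (trans (sym e) (just-κ⁻ {x = T.π⁻ i x} lem)) λ ()
        where
        lem : κ (T.π⁻ i x) ≡ just z
        lem with κ (T.π⁻ i x) in q
        ... | just w = cong just (S.π-injective i (just-injective (trans (trans (cong (Maybe.map (S.π i)) (sym q))
                               (sym (κ-eqv i (T.π⁻ i x)))) (trans (cong κ (π-π⁻ i x)) (κ⁻-just e′)))))
        ... | nothing = contradiction (trans (trans (sym (cong (Maybe.map (S.π i)) q))
                               (sym (κ-eqv i (T.π⁻ i x)))) (trans (cong κ (π-π⁻ i x)) (κ⁻-just e′))) λ ()

      -- The points of T in the domain of κ survive in the second summand as ghosts, with irrelevant colours.
      cross : Maybe (Fin N) → Fin N → Colour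
      cross nothing  y = red
      cross (just x) y with x Fin.≟ y
      ... | yes _ = red
      ... | no _  = T.colour x y

      cross-π : ∀ i mx y → cross (Maybe.map (T.π i) mx) (T.π i y) ≡ cross mx y
      cross-π i nothing  y = refl
      cross-π i (just x) y with x Fin.≟ y | T.π i x Fin.≟ T.π i y
      ... | yes _    | yes _ = refl
      ... | yes refl | no ¬p = contradiction refl ¬p
      ... | no ¬p    | yes p = contradiction
              (trans (sym (π⁻-π i x)) (trans (cong (T.π⁻ i) p) (π⁻-π i y))) ¬p
      ... | no ¬p    | no _  = preserve i x y ¬p

      cross-≢ : ∀ {x y} → x ≢ y → cross (just x) y ≡ T.colour x y
      cross-≢ {x} {y} x≢y with x Fin.≟ y
      ... | yes p = contradiction p x≢y
      ... | no _  = refl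

      colourD : C ⊎ Fin N → C ⊎ Fin N → Colour
      colourD (inj₁ z) (inj₁ w) = S.colour z w
      colourD (inj₁ z) (inj₂ y) = cross (κ⁻ z) y
      colourD (inj₂ x) (inj₁ w) = cross (κ⁻ w) x
      colourD (inj₂ x) (inj₂ y) = T.colour x y

      strD : Str n (C ⊎ Fin N)
      strD = record
        { colour = colourD
        ; symm = λ { (inj₁ z) (inj₁ w) → S.symm z w ; (inj₁ _) (inj₂ _) → refl
                   ; (inj₂ _) (inj₁ _) → refl ; (inj₂ x) (inj₂ y) → symm x y }
        ; π = λ i → Sum.map (S.π i) (T.π i) ; π⁻ = λ i → Sum.map (S.π⁻ i) (T.π⁻ i)
        ; π-π⁻ = λ { i (inj₁ z) → cong inj₁ (S.π-π⁻ i z) ; i (inj₂ x) → cong inj₂ (π-π⁻ i x) }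
        ; π⁻-π = λ { i (inj₁ z) → cong inj₁ (S.π⁻-π i z) ; i (inj₂ x) → cong inj₂ (π⁻-π i x) }
        ; preserve = λ { i (inj₁ z) (inj₁ w) n → S.preserve i z w (n ∘ cong inj₁)
                       ; i (inj₁ z) (inj₂ y) n → trans (cong (λ m → cross m (T.π i y)) (κ⁻-eqv i z)) (cross-π i (κ⁻ z) y)
                       ; i (inj₂ y) (inj₁ z) n → trans (cong (λ m → cross m (T.π i y)) (κ⁻-eqv i z)) (cross-π i (κ⁻ z) y)
                       ; i (inj₂ x) (inj₂ y) n → preserve i x y (n ∘ cong inj₂) } }

      place : Maybe C → Fin N → C ⊎ Fin N
      place (just z) x = inj₁ z
      place nothing  x = inj₂ x

      place-inj : ∀ x y → place (κ x) x ≡ place (κ y) y → x ≡ y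
      place-inj x y e with κ x in p | κ y in q
      ... | just z  | just w  = κ-inj x y (λ r → contradiction (trans (sym p) r) λ ())
                                  (trans p (trans (cong just (inj₁-injective e)) (sym q)))
      ... | nothing | nothing = inj₂-injective e
      place-inj x y () | just _ | nothing
      place-inj x y () | nothing | just _

      place-colour : ∀ x y → x ≢ y → colourD (place (κ x) x) (place (κ y) y) ≡ T.colour x y
      place-colour x y x≢y with κ x in p | κ y in q | κ-colour x y x≢y
      ... | just z  | just w  | a = a
      ... | just z  | nothing | _ = trans (cong (λ m → cross m y) (just-κ⁻ p)) (cross-≢ x≢y)
      ... | nothing | just w  | _ = trans (cong (λ m → cross m x) (just-κ⁻ q))
                                      (trans (cross-≢ (x≢y ∘ sym)) (symm y x))
      ... | nothing | nothing | _ = refl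

      place-eqv : ∀ i x → Sum.map (S.π i) (T.π i) (place (κ x) x) ≡ place (κ (T.π i x)) (T.π i x)
      place-eqv i x with κ x | κ (T.π i x) | κ-eqv i x
      ... | just z  | .(just (S.π i z)) | refl = refl
      ... | nothing | .nothing          | refl = refl

    abstract
      amalgam : Amalgam
      amalgam with valid?
      ... | yes v = record
        { D = C ⊎ Fin N ; finD = finite ⊎-finite finFinite N ; str = Glue.strD v
        ; inc = inj₁ ; inc-inj = inj₁-injective ; inc-colour = λ _ _ _ → refl ; inc-eqv = λ _ _ → refl
        ; copy = λ _ → record
          { j = λ x → Glue.place v (κ x) x
          ; j-inj = Glue.place-inj v _ _ ; j-colour = Glue.place-colour v ; j-eqv = Glue.place-eqv v
          ; j-κ = λ {x} e → cong (λ m → Glue.place v m x) e } }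
      ... | no ¬v = record
        { D = C ; finD = finite ; str = S ; inc = id ; inc-inj = id
        ; inc-colour = λ _ _ _ → refl ; inc-eqv = λ _ _ → refl
        ; copy = λ v → contradiction v ¬v }

-- The automorphism group and generic tuples

module Automorphisms (k : ℕ) (c : Colouring (suc k) ℕ) (ext : Extension (Colouring.col c)) where
  open Structures k public

  cc : ℕ → ℕ → Colour
  cc = Colouring.col c

  cc-sym : ∀ u v → cc u v ≡ cc v u
  cc-sym = Colouring.sym c

  G : Set
  G = Aut c

  ⟦_⟧ ⟦_⟧⁻ : G → ℕ → ℕ
  ⟦ g ⟧  = Inverse.to (proj₁ g)
  ⟦ g ⟧⁻ = Inverse.from (proj₁ g)

  ⟦⟧-⟦⟧⁻ : ∀ g u → ⟦ g ⟧ (⟦ g ⟧⁻ u) ≡ u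
  ⟦⟧-⟦⟧⁻ g = Inverse.strictlyInverseˡ (proj₁ g)

  ⟦⟧⁻-⟦⟧ : ∀ g u → ⟦ g ⟧⁻ (⟦ g ⟧ u) ≡ u
  ⟦⟧⁻-⟦⟧ g = Inverse.strictlyInverseʳ (proj₁ g)

  ⟦⟧-injective : ∀ g {u v} → ⟦ g ⟧ u ≡ ⟦ g ⟧ v → u ≡ v
  ⟦⟧-injective g {u} {v} e = trans (sym (⟦⟧⁻-⟦⟧ g u)) (trans (cong ⟦ g ⟧⁻ e) (⟦⟧⁻-⟦⟧ g v))

  ⟦⟧-colour : ∀ g u v → u ≢ v → cc (⟦ g ⟧ u) (⟦ g ⟧ v) ≡ cc u v
  ⟦⟧-colour = proj₂

  ⟦⟧⁻-colour : ∀ g u v → u ≢ v → cc (⟦ g ⟧⁻ u) (⟦ g ⟧⁻ v) ≡ cc u v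
  ⟦⟧⁻-colour g u v u≢v = trans
    (sym (⟦⟧-colour g _ _ λ e → u≢v (trans (sym (⟦⟧-⟦⟧⁻ g u)) (trans (cong ⟦ g ⟧ e) (⟦⟧-⟦⟧⁻ g v)))))
    (cong₂ cc (⟦⟧-⟦⟧⁻ g u) (⟦⟧-⟦⟧⁻ g v))

  infixr 9 _∘G_
  _∘G_ : G → G → G
  h ∘G g = _·_ {c = c} g h

  inv : G → G
  inv g = ↔-sym (proj₁ g) , ⟦⟧⁻-colour g

  idG : G
  idG = ↔-id ℕ , λ _ _ _ → refl

  PI : List (ℕ × ℕ) → Set
  PI = IsPI cc cc

  flip-match : ∀ {x y u v} → Match cc cc x u y v → Match cc cc u x v y
  flip-match m = record { fun = sym ∘ Match.fun m ∘ sym ; inj = sym ∘ Match.inj m ∘ sym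
                        ; col = λ n → trans (cc-sym _ _) (trans (Match.col m (n ∘ sym)) (cc-sym _ _)) }

  abstract
    limit : (L : ℕ → List (ℕ × ℕ)) (pi : ∀ s → PI (L s))
      (mono : ∀ s {p} → p ∈ L s → p ∈ L (suc s))
      (dom : ∀ a → Σ ℕ λ s → Σ ℕ λ b → (a , b) ∈ L s)
      (ran : ∀ b → Σ ℕ λ s → Σ ℕ λ a → (a , b) ∈ L s) →
      Σ G λ g → ∀ {s a b} → (a , b) ∈ L s → ⟦ g ⟧ a ≡ b
    limit L pi mono dom ran = (Lim.iso , Lim.to-col) , Lim.to-∈
      where module Lim = Limit cc cc L pi mono dom ran

    fromPI : ∀ L → PI L → Σ G λ g → ∀ {a b} → (a , b) ∈ L → ⟦ g ⟧ a ≡ b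
    fromPI L pi = (proj₁ BF.result , proj₁ (proj₂ BF.result)) , proj₂ (proj₂ BF.result)
      where
      module BF = BackAndForth _≟_ _≟_ cc cc cc-sym cc-sym ext ext
                    id id (λ _ → refl) id id (λ _ → refl) L pi

  record Emb {n : ℕ} {C : Set} (S : Str n C) (ds : Fin n → G) (j : C → ℕ) : Set where
    private module S = Str S
    field
      inj    : ∀ {x y} → j x ≡ j y → x ≡ y
      colour : ∀ x y → x ≢ y → cc (j x) (j y) ≡ S.colour x y
      eqv    : ∀ i x → ⟦ ds i ⟧ (j x) ≡ j (S.π i x)

  -- The field `eqv` also compares undefined values, hence makes the domain of `ι` invariant under
  -- all the permutations.
  record PartialEmb {n : ℕ} {C : Set} (S : Str n C) (ds : Fin n → G) (ι : C → Maybe ℕ) : Set where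
    private module S = Str S
    field
      inj    : ∀ {x y u} → ι x ≡ just u → ι y ≡ just u → x ≡ y
      colour : ∀ {x y u v} → ι x ≡ just u → ι y ≡ just v → x ≢ y → cc u v ≡ S.colour x y
      eqv    : ∀ i x → ι (S.π i x) ≡ Maybe.map ⟦ ds i ⟧ (ι x)

  Extends : {C : Set} → (C → Maybe ℕ) → (C → ℕ) → Set
  Extends ι j = ∀ x {u} → ι x ≡ just u → j x ≡ u

  record Generic (n : ℕ) (ds : Fin n → G) : Set where
    field
      extension : ∀ N (S : Str n (Fin N)) ι → PartialEmb S ds ι → Σ (Fin N → ℕ) λ j → Emb S ds j × Extends ι j
      locally-finite : ∀ B → Σ ℕ λ N → Σ (Str n (Fin N)) λ S → Σ (Fin N → ℕ) λ j →
        Emb S ds j × (∀ u → u < B → Σ (Fin N) λ x → j x ≡ u)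

  transport : ∀ {n C} (F : Finite C) → Str n C → Str n (Fin (Finite.size F))
  transport F S = record
    { colour = λ x y → S.colour (unrank x) (unrank y)
    ; symm = λ x y → S.symm _ _
    ; π = λ i x → rank (S.π i (unrank x)) ; π⁻ = λ i x → rank (S.π⁻ i (unrank x))
    ; π-π⁻ = λ i x → trans (cong (rank ∘ S.π i) (unrank-rank _)) (trans (cong rank (S.π-π⁻ i _)) (rank-unrank x))
    ; π⁻-π = λ i x → trans (cong (rank ∘ S.π⁻ i) (unrank-rank _)) (trans (cong rank (S.π⁻-π i _)) (rank-unrank x))
    ; preserve = λ i x y x≢y → trans (cong₂ S.colour (unrank-rank _) (unrank-rank _))
        (S.preserve i _ _ λ e → x≢y (trans (sym (rank-unrank x)) (trans (cong rank e) (rank-unrank y)))) }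
    where
    module S = Str S
    open Finite F

  transport-emb : ∀ {n C} (F : Finite C) (S : Str n C) ds {j} → Emb S ds j →
    Emb (transport F S) ds (j ∘ Finite.unrank F)
  transport-emb F S ds {j} E = record
    { inj = λ {x} {y} e → trans (sym (rank-unrank x)) (trans (cong rank (E.inj e)) (rank-unrank y))
    ; colour = λ x y x≢y → E.colour _ _ λ e → x≢y (trans (sym (rank-unrank x)) (trans (cong rank e) (rank-unrank y)))
    ; eqv = λ i x → trans (E.eqv i _) (cong j (sym (unrank-rank _))) }
    where
    module E = Emb E
    open Finite F

  extension-finite : ∀ {n ds} → Generic n ds → ∀ {C} (F : Finite C) (S : Str n C) ι → PartialEmb S ds ι →
    Σ (C → ℕ) λ j → Emb S ds j × Extends ι j
  extension-finite {n} {ds} gen {C} F S ι P = j ∘ rank , record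
    { inj = rank-injective ∘ E.inj
    ; colour = λ x y x≢y → trans (E.colour _ _ (x≢y ∘ rank-injective)) (cong₂ S.colour (unrank-rank x) (unrank-rank y))
    ; eqv = λ i x → trans (E.eqv i _) (cong (λ z → j (rank (S.π i z))) (unrank-rank x)) }
    , λ x e → proj₂ (proj₂ r) (rank x) (trans (cong ι (unrank-rank x)) e)
    where
    module S = Str S
    module P = PartialEmb P
    open Finite F
    r = Generic.extension gen size (transport F S) (ι ∘ unrank) (record
      { inj = λ {x} {y} p q → trans (sym (rank-unrank x)) (trans (cong rank (P.inj p q)) (rank-unrank y))
      ; colour = λ {x} {y} p q x≢y → P.colour p q λ e → x≢y (trans (sym (rank-unrank x)) (trans (cong rank e) (rank-unrank y)))
      ; eqv = λ i x → trans (cong ι (unrank-rank _)) (P.eqv i (unrank x)) })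
    j = proj₁ r
    module E = Emb (proj₁ (proj₂ r))

  empty : Fin 0 → G
  empty ()

  -- Without automorphisms every finite set is invariant, and the extension property applied vertex
  -- by vertex is all that genericity asks.
  generic-empty : Generic 0 empty
  generic-empty = record { extension = extension ; locally-finite = locally-finite }
    where
    locally-finite : ∀ B → _
    locally-finite B = B , record { colour = λ x y → cc (toℕ x) (toℕ y) ; symm = λ x y → cc-sym _ _
        ; π = λ () ; π⁻ = λ () ; π-π⁻ = λ () ; π⁻-π = λ () ; preserve = λ () } , toℕ ,
      record { inj = Fin.toℕ-injective ; colour = λ _ _ _ → refl ; eqv = λ () } ,
      λ u u<B → fromℕ< u<B , Fin.toℕ-fromℕ< u<B

    module _ (N : ℕ) (S : Str 0 (Fin N)) (ι : Fin N → Maybe ℕ) (P : PartialEmb S empty ι) where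
      module S = Str S
      module P = PartialEmb P
      open Extend (Fin._≟_ {N}) _≟_ S.colour cc S.symm cc-sym ext

      pairs : (l : List (Fin N)) → List (Fin N × ℕ)
      pairs [] = []
      pairs (x ∷ l) with ι x
      ... | just u  = (x , u) ∷ pairs l
      ... | nothing = pairs l

      pairs-ι : ∀ l {x u} → (x , u) ∈ pairs l → ι x ≡ just u
      pairs-ι (y ∷ l) p with ι y in e
      pairs-ι (y ∷ l) (here refl) | just u = e
      pairs-ι (y ∷ l) (there p)   | just u = pairs-ι l p
      ... | nothing = pairs-ι l p

      ι-pairs : ∀ l {x u} → x ∈ l → ι x ≡ just u → (x , u) ∈ pairs l
      ι-pairs (y ∷ l) p e with ι y in q
      ι-pairs (y ∷ l) (here refl) e | just u with trans (sym q) e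
      ... | refl = here refl
      ι-pairs (y ∷ l) (there p) e | just u = there (ι-pairs l p e)
      ι-pairs (y ∷ l) (here refl) e | nothing = contradiction (trans (sym q) e) λ ()
      ι-pairs (y ∷ l) (there p) e | nothing = ι-pairs l p e

      pairs-pi : ∀ l → IsPI S.colour cc (pairs l)
      pairs-pi l p q = record
        { fun = λ { refl → just-injective (trans (sym (pairs-ι l p)) (pairs-ι l q)) }
        ; inj = λ { refl → P.inj (pairs-ι l p) (pairs-ι l q) }
        ; col = λ n → P.colour (pairs-ι l p) (pairs-ι l q) n }

      all : (l : List (Fin N)) (L : List (Fin N × ℕ)) → IsPI S.colour cc L →
        Σ (List (Fin N × ℕ)) λ L′ → IsPI S.colour cc L′ × (∀ {p} → p ∈ L → p ∈ L′) ×
        (∀ {x} → x ∈ l → ∃ λ u → (x , u) ∈ L′)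
      all [] L pi = L , pi , id , λ ()
      all (x ∷ l) L pi with forth L pi x
      ... | f with all l (Forth.list f) (Forth.isPI f)
      ...   | L′ , pi′ , ⊇ , dom = L′ , pi′ , ⊇ ∘ Forth.⊇ f ,
                λ { (here refl) → _ , ⊇ (Forth.image-∈ f) ; (there p) → dom p }

      open Finite (finFinite N) using (elements; ∈-elements)

      extension : Σ (Fin N → ℕ) λ j → Emb S empty j × Extends ι j
      extension with all elements (pairs elements) (pairs-pi elements)
      ... | L′ , pi′ , ⊇ , dom = (λ x → proj₁ (dom (∈-elements x))) , record
        { inj = Match.inj (pi′ (proj₂ (dom (∈-elements _))) (proj₂ (dom (∈-elements _))))
        ; colour = λ x y → Match.col (pi′ (proj₂ (dom (∈-elements x))) (proj₂ (dom (∈-elements y))))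
        ; eqv = λ () } ,
        λ x e → Match.fun (pi′ (proj₂ (dom (∈-elements x))) (⊇ (ι-pairs elements (∈-elements x) e))) refl

-- Prolonging a generic tuple by one automorphism

module GenericStep (k : ℕ) (c : Colouring (suc k) ℕ) (ext : Extension (Colouring.col c)) where
  open Automorphisms k c ext
  open Amalgams k

  cons : ∀ {n} → G → (Fin n → G) → Fin (suc n) → G
  cons g ds zero    = g
  cons g ds (suc i) = ds i

  toColour : ℕ → Colour
  toColour v with v <? suc k
  ... | yes p = fromℕ< p
  ... | no  _ = red

  toColour-toℕ : ∀ a → toColour (toℕ a) ≡ a
  toColour-toℕ a with toℕ a <? suc k
  ... | yes p = Fin.toℕ-injective (Fin.toℕ-fromℕ< p)
  ... | no ¬p = contradiction (Fin.toℕ<n a) ¬p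

  -- An out-of-range entry falls back on the argument `x`, because `Fin N` may be empty and offers
  -- no constant; tables of genuine structures never reach this case.
  clamp : ∀ {N} → Fin N → ℕ → Fin N
  clamp {N} x v with v <? N
  ... | yes p = fromℕ< p
  ... | no  _ = x

  clamp-toℕ : ∀ {N} (x y : Fin N) → clamp x (toℕ y) ≡ y
  clamp-toℕ {N} x y with toℕ y <? N
  ... | yes p = Fin.toℕ-injective (Fin.toℕ-fromℕ< p)
  ... | no ¬p = contradiction (Fin.toℕ<n y) ¬p

  toMaybe : ℕ → Maybe ℕ
  toMaybe zero    = nothing
  toMaybe (suc u) = just u

  fromMaybe : Maybe ℕ → ℕ
  fromMaybe nothing  = zero
  fromMaybe (just u) = suc u

  toMaybe-fromMaybe : ∀ u → toMaybe (fromMaybe u) ≡ u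
  toMaybe-fromMaybe nothing  = refl
  toMaybe-fromMaybe (just u) = refl

  module Codes (n N : ℕ) where

    raw : ℕ → Raw n N
    raw t = record
      { colour = λ x y → toColour (decode (decode t 1) (toℕ (combine x y)))
      ; π      = λ i x → clamp x (decode (decode t 2) (toℕ (combine i x)))
      ; π⁻     = λ i x → clamp x (decode (decode t 3) (toℕ (combine i x))) }

    partial : ℕ → Fin N → Maybe ℕ
    partial t x = toMaybe (decode (decode t 4) (toℕ x))

    record Represents (t : ℕ) (T : Str n (Fin N)) (ι : Fin N → Maybe ℕ) : Set where
      private
        module R = Raw (raw t)
        module T = Str T
      field
        colour≡ : ∀ x y → R.colour x y ≡ T.colour x y
        π≡      : ∀ i x → R.π i x ≡ T.π i x
        π⁻≡     : ∀ i x → R.π⁻ i x ≡ T.π⁻ i x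
        ι≡      : ∀ x → partial t x ≡ ι x

    module _ (T : Str n (Fin N)) (ι : Fin N → Maybe ℕ) where
      private module T = Str T

      abstract
        table : ∀ {p} → (Fin p → Fin N → ℕ) → ℕ
        table {p} f = encodeFin (p * N) (uncurry f ∘ remQuot N)

        table-at : ∀ {p} (f : Fin p → Fin N → ℕ) i x → decode (table f) (toℕ (combine i x)) ≡ f i x
        table-at f i x = trans (decode-encodeFin _ (uncurry f ∘ remQuot N) (combine i x)) (cong (uncurry f) (Fin.remQuot-combine i x))

      entries : ℕ → ℕ
      entries 0 = N
      entries 1 = table λ x y → toℕ (T.colour x y)
      entries 2 = table λ i x → toℕ (T.π i x)
      entries 3 = table λ i x → toℕ (T.π⁻ i x)
      entries _ = encodeFin N (fromMaybe ∘ ι)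

      abstract
        code : ℕ
        code = encode 5 entries

        code-at : ∀ i → i < 5 → decode code i ≡ entries i
        code-at = decode-encode 5 entries

      code-size : N ≡ decode code 0
      code-size = sym (code-at 0 (s≤s z≤n))

      code-represents : Represents code T ι
      code-represents = record
        { colour≡ = λ x y → trans (cong (λ e → toColour (decode e (toℕ (combine x y)))) (code-at 1 (s≤s (s≤s z≤n))))
            (trans (cong toColour (table-at (λ x y → toℕ (T.colour x y)) x y)) (toColour-toℕ _))
        ; π≡ = λ i x → trans (cong (λ e → clamp x (decode e (toℕ (combine i x)))) (code-at 2 (s≤s (s≤s (s≤s z≤n)))))
            (trans (cong (clamp x) (table-at (λ i x → toℕ (T.π i x)) i x)) (clamp-toℕ x _))
        ; π⁻≡ = λ i x → trans (cong (λ e → clamp x (decode e (toℕ (combine i x)))) (code-at 3 (s≤s (s≤s (s≤s (s≤s z≤n))))))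
            (trans (cong (clamp x) (table-at (λ i x → toℕ (T.π⁻ i x)) i x)) (clamp-toℕ x _))
        ; ι≡ = λ x → trans (cong (λ e → toMaybe (decode e (toℕ x))) (code-at 4 (s≤s (s≤s (s≤s (s≤s (s≤s z≤n)))))))
            (trans (cong toMaybe (decode-encodeFin N (fromMaybe ∘ ι) x)) (toMaybe-fromMaybe _)) }

  module _ {n : ℕ} {ds : Fin n → G} (gen : Generic n ds) where
    private module Gen = Generic gen

    -- A finite piece of the future f: on the set `J D` the product σ f acts as slot `zero` of
    -- `str`, so f sends `J z` to the σ-preimage of `J (π zero z)`. Since f is not built yet, `task`
    -- speaks of every tuple `fs` that acts on `J D` as prescribed.
    record Stage (σ : G) (t : ℕ) (L : List (ℕ × ℕ)) : Set₁ where
      field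
        D     : Set
        finD  : Finite D
        str   : Str (suc n) D
        J     : D → ℕ
        emb   : Emb (reduct str) ds J
        cover : ∀ u → u ≤ t → ∃ λ z → J z ≡ u
        ⊇     : ∀ {u v} → (u , v) ∈ L → ∃ λ z → J z ≡ u × ⟦ σ ⟧ v ≡ J (Str.π str zero z)
        task  : ∀ {N} → N ≡ decode t 0 → (T : Str (suc n) (Fin N)) (ι : Fin N → Maybe ℕ) →
                Codes.Represents (suc n) N t T ι → (fs : Fin (suc n) → G) →
                (∀ i z → ⟦ fs i ⟧ (J z) ≡ J (Str.π str i z)) → PartialEmb T fs ι →
                Σ (Fin N → ℕ) λ j → Emb T fs j × Extends ι j

      module str = Str str
      module emb = Emb emb

      next : List (ℕ × ℕ)
      next = map (λ z → J z , ⟦ σ ⟧⁻ (J (str.π zero z))) (Finite.elements finD)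

      ∈-next : ∀ z → (J z , ⟦ σ ⟧⁻ (J (str.π zero z))) ∈ next
      ∈-next z = ∈-map⁺ (λ z → J z , ⟦ σ ⟧⁻ (J (str.π zero z))) (Finite.∈-elements finD z)

      next-⊇ : ∀ {p} → p ∈ L → p ∈ next
      next-⊇ {u , v} p with ⊇ p
      ... | z , refl , e = subst (λ w → (J z , w) ∈ next) (trans (cong ⟦ σ ⟧⁻ (sym e)) (⟦⟧⁻-⟦⟧ σ v)) (∈-next z)

      next-pi : PI next
      next-pi p q with ∈-map⁻ (λ z → J z , ⟦ σ ⟧⁻ (J (str.π zero z))) p | ∈-map⁻ (λ z → J z , ⟦ σ ⟧⁻ (J (str.π zero z))) q
      ... | z , _ , refl | w , _ , refl = record
        { fun = λ e → cong (λ z → ⟦ σ ⟧⁻ (J (str.π zero z))) (emb.inj e)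
        ; inj = λ e → cong J (str.π-injective zero (emb.inj (⟦⟧-injective (inv σ) e)))
        ; col = λ n → trans (⟦⟧⁻-colour σ _ _ λ e → n (cong J (str.π-injective zero (emb.inj e))))
            (trans (emb.colour _ _ λ e → n (cong J (str.π-injective zero e)))
              (trans (str.preserve zero z w (n ∘ cong J)) (sym (emb.colour z w (n ∘ cong J))))) }

    module Build (σ : G) (t : ℕ) (L : List (ℕ × ℕ)) (pi : PI L) where
      open Lookup {ℕ} {ℕ} _≟_

      N₀ : ℕ
      N₀ = decode t 0
      module Code = Codes (suc n) N₀

      -- An invariant set containing all vertices below `B` supports the whole of σ f known so far,
      -- both arguments and values, and the values of the decoded partial embedding.
      B : ℕ
      B = suc t ⊔ (bound proj₁ L ⊔ (bound (⟦ σ ⟧ ∘ proj₂) L ⊔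
          bound (fromMaybe ∘ Code.partial t) (allFin N₀)))

      t<B : t < B
      t<B = m≤m⊔n (suc t) (bound proj₁ L ⊔ (bound (⟦ σ ⟧ ∘ proj₂) L ⊔
              bound (fromMaybe ∘ Code.partial t) (allFin N₀)))

      dom<B : ∀ {u v} → (u , v) ∈ L → u < B
      dom<B p = <-≤-trans (bound-∈ proj₁ p) (≤-trans (m≤m⊔n _ _) (m≤n⊔m (suc t) _))

      ran<B : ∀ {u v} → (u , v) ∈ L → ⟦ σ ⟧ v < B
      ran<B p = <-≤-trans (bound-∈ (⟦ σ ⟧ ∘ proj₂) p)
        (≤-trans (m≤m⊔n _ _) (≤-trans (m≤n⊔m (bound proj₁ L) _) (m≤n⊔m (suc t) _)))

      partial<B : ∀ {x u} → Code.partial t x ≡ just u → u < B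
      partial<B {x} {u} e = <-≤-trans (<-trans (n<1+n u) (subst (_< bound (fromMaybe ∘ Code.partial t) (allFin N₀)) (cong fromMaybe e)
        (bound-∈ (fromMaybe ∘ Code.partial t) (∈-allFin x))))
        (≤-trans (m≤n⊔m _ _) (≤-trans (m≤n⊔m (bound proj₁ L) _) (m≤n⊔m (suc t) _)))

      module Closed (N : ℕ) (S : Str n (Fin N)) (a : Fin N → ℕ) (a-emb : Emb S ds a)
                    (covered : ∀ u → u < B → ∃ λ x → a x ≡ u) where
        private
          module S = Str S
          module a = Emb a-emb
        module pre = Preimage _≟_ (finFinite N) a a.inj

        -- Slot `zero` is the part of σ f decided by `L`; the old automorphisms are already total on
        -- the invariant set.
        g : Fin (suc n) → Fin N → Maybe (Fin N)
        g zero x    = lookup L (a x) >>= (pre.preimage ∘ ⟦ σ ⟧)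
        g (suc i) x = just (S.π i x)

        g-zero : ∀ {x y} → g zero x ≡ just y → ∃ λ v → (a x , v) ∈ L × ⟦ σ ⟧ v ≡ a y
        g-zero {x} e with lookup L (a x) in q
        ... | just v = v , lookup-just L q , pre.preimage-just e

        zero-g : ∀ {x v y} → (a x , v) ∈ L → ⟦ σ ⟧ v ≡ a y → g zero x ≡ just y
        zero-g {x} {v} {y} p e
          rewrite lookup-∈ L (λ p q → Match.fun (pi p q) refl) p | e = pre.preimage-j y

        g-partial : ∀ i {x y x′ y′} → g i x ≡ just y → g i x′ ≡ just y′ → Match S.colour S.colour x x′ y y′
        g-partial (suc i) refl refl = record
          { fun = cong (S.π i) ; inj = S.π-injective i ; col = S.preserve i _ _ }
        g-partial zero {x} {y} {x′} {y′} e e′ with g-zero {x} e | g-zero {x′} e′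
        ... | v , p , q | v′ , p′ , q′ = record
          { fun = λ { refl → a.inj (trans (sym q) (trans (cong ⟦ σ ⟧ (Match.fun (pi p p′) refl)) q′)) }
          ; inj = λ { refl → x≡ (trans q (sym q′)) }
          ; col = λ n → trans (sym (a.colour y y′ λ { refl → n (x≡ (trans q (sym q′))) }))
              (trans (cong₂ cc (sym q) (sym q′)) (trans (⟦⟧-colour σ v v′ λ { refl → n (x≡ refl) })
                (trans (Match.col (pi p p′) (n ∘ a.inj)) (a.colour x x′ n)))) }
          where
          x≡ : ⟦ σ ⟧ v ≡ ⟦ σ ⟧ v′ → x ≡ x′
          x≡ r = a.inj (Match.inj (pi p p′) (⟦⟧-injective σ r))

        module Extended (P : EPPA (suc n) N S.colour g) where
          private
            module P = EPPA P
            module C = Str P.str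

          toC : Maybe ℕ → Maybe P.C
          toC nothing  = nothing
          toC (just u) = Maybe.map P.e (pre.preimage u)

          κ : Fin N₀ → Maybe P.C
          κ x = toC (Code.partial t x)

          toC-a : ∀ {w} → toC (just (a w)) ≡ just (P.e w)
          toC-a {w} rewrite pre.preimage-j w = refl

          module Amalgamated (A : Amalgam P.str P.finite (Code.raw t) κ) where
            private
              module A = Amalgam A
              module D = Str A.str

            emb₀ : Fin N → A.D
            emb₀ = A.inc ∘ P.e

            emb₀-eqv : ∀ i x → D.π (suc i) (emb₀ x) ≡ emb₀ (S.π i x)
            emb₀-eqv i x = trans (A.inc-eqv (suc i) (P.e x)) (cong A.inc (P.extends (suc i) refl))

            emb₀-colour : ∀ x y → x ≢ y → D.colour (emb₀ x) (emb₀ y) ≡ S.colour x y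
            emb₀-colour x y n = trans (A.inc-colour _ _ (n ∘ P.e-inj)) (P.e-colour x y n)

            module pre₀ = Preimage (Finite._≟C_ A.finD) (finFinite N) emb₀ (P.e-inj ∘ A.inc-inj)

            -- The amalgam has to be placed in the graph over the copy of `S` already there.
            -- Genericity of `ds` does this for the reduct, which forgets slot `zero`; the placement
            -- then defines f on the new points.
            start : A.D → Maybe ℕ
            start d = Maybe.map a (pre₀.preimage d)

            start-just : ∀ {d u} → start d ≡ just u → ∃ λ x → d ≡ emb₀ x × a x ≡ u
            start-just {d} e with pre₀.preimage d in q
            start-just refl | just x = x , pre₀.preimage-just q , refl

            start-partial : PartialEmb (reduct A.str) ds start
            start-partial = record
              { inj = λ {d} {d′} p q → inj (start-just {d} p) (start-just {d′} q)
              ; colour = λ {d} {d′} p q → colour (start-just {d} p) (start-just {d′} q)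
              ; eqv = eqv }
              where
              inj : ∀ {d d′ u} → (∃ λ x → d ≡ emb₀ x × a x ≡ u) → (∃ λ x → d′ ≡ emb₀ x × a x ≡ u) → d ≡ d′
              inj (x , p , q) (x′ , p′ , q′) = trans p (trans (cong emb₀ (a.inj (trans q (sym q′)))) (sym p′))
              colour : ∀ {d d′ u v} → (∃ λ x → d ≡ emb₀ x × a x ≡ u) → (∃ λ x → d′ ≡ emb₀ x × a x ≡ v) →
                d ≢ d′ → cc u v ≡ D.colour d d′
              colour (x , refl , refl) (x′ , refl , refl) n =
                trans (a.colour x x′ (n ∘ cong emb₀)) (sym (emb₀-colour x x′ (n ∘ cong emb₀)))
              eqv : ∀ i d → start (D.π (suc i) d) ≡ Maybe.map ⟦ ds i ⟧ (start d)
              eqv i d rewrite pre₀.preimage-equivariant (D.π (suc i)) (D.π⁻ (suc i)) (S.π i) (S.π⁻ i)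
                                (D.π⁻-π (suc i)) (S.π-π⁻ i) (emb₀-eqv i) d with pre₀.preimage d
              ... | nothing = refl
              ... | just x  = cong just (sym (a.eqv i x))

            module Placed (J : A.D → ℕ) (J-emb : Emb (reduct A.str) ds J) (J-start : Extends start J) where
              private module J = Emb J-emb

              J-emb₀ : ∀ x → J (emb₀ x) ≡ a x
              J-emb₀ x = J-start (emb₀ x) (cong (Maybe.map a) (pre₀.preimage-j x))

              task : ∀ {N} → N ≡ N₀ → (T : Str (suc n) (Fin N)) (ι : Fin N → Maybe ℕ) →
                Codes.Represents (suc n) N t T ι → (fs : Fin (suc n) → G) →
                (∀ i z → ⟦ fs i ⟧ (J z) ≡ J (D.π i z)) → PartialEmb T fs ι →
                Σ (Fin N → ℕ) λ j → Emb T fs j × Extends ι j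
              task refl T ι rep fs fs-J P = J ∘ Cp.j , record
                { inj = Cp.j-inj ∘ J.inj
                ; colour = λ x y n → trans (J.colour _ _ (n ∘ Cp.j-inj)) (trans (Cp.j-colour x y n) (R.colour≡ x y))
                ; eqv = λ i x → trans (fs-J i _) (cong J (trans (Cp.j-eqv i x) (cong Cp.j (R.π≡ i x)))) }
                , λ x e → ext-ι x e (ι-κ e)
                where
                module T = Str T
                module Pe = PartialEmb P
                module R = Code.Represents rep

                ι-κ : ∀ {x u} → ι x ≡ just u → ∃ λ w → u ≡ a w × κ x ≡ just (P.e w)
                ι-κ {x} {u} e with covered u (partial<B {x} (trans (R.ι≡ x) e))
                ... | w , refl = w , refl , trans (cong toC (trans (R.ι≡ x) e)) toC-a

                κ-just : ∀ {x z} → κ x ≡ just z → ∃ λ w → ι x ≡ just (a w) × z ≡ P.e w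
                κ-just {x} {z} e with ι x in q
                ... | nothing = contradiction (trans (sym e) (cong toC (trans (R.ι≡ x) q))) λ ()
                ... | just u with ι-κ q
                ...   | w , refl , r = w , refl , just-injective (trans (sym e) r)

                κ-inj : ∀ x y {z} → κ x ≡ just z → κ y ≡ just z → x ≡ y
                κ-inj x y p q with κ-just p | κ-just q
                ... | w , i , refl | w′ , i′ , e = Pe.inj i (trans i′ (cong (just ∘ a) (sym (P.e-inj e))))

                κ-colour : ∀ x y {z w} → x ≢ y → κ x ≡ just z → κ y ≡ just w → C.colour z w ≡ T.colour x y
                κ-colour x y n p q with κ-just p | κ-just q
                ... | w , i , refl | w′ , i′ , refl = trans (P.e-colour w w′ w≢) (trans (sym (a.colour w w′ w≢)) (Pe.colour i i′ n))
                  where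
                  w≢ : w ≢ w′
                  w≢ refl = n (Pe.inj i i′)

                -- The tuple `fs` is known to follow `D.π` on the image of `J`, which contains every
                -- value of `ι`. Injectivity of `J` and `A.inc` brings the equation back to `P.C`.
                κ-eqv : ∀ i x → κ (T.π i x) ≡ Maybe.map (C.π i) (κ x)
                κ-eqv i x with ι x in q
                ... | nothing rewrite R.ι≡ x | q | R.ι≡ (T.π i x) | Pe.eqv i x | q = refl
                ... | just u with ι-κ q | ι-κ (trans (Pe.eqv i x) (cong (Maybe.map ⟦ fs i ⟧) q))
                ...   | w , refl , r | w′ , e , r′ = trans r′ (trans (cong just (sym (A.inc-inj (J.inj (trans
                          (cong J (sym (A.inc-eqv i (P.e w)))) (trans (sym (fs-J i _)) (trans (cong ⟦ fs i ⟧ (J-emb₀ w))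
                          (trans e (sym (J-emb₀ w′))))))))))  (cong (Maybe.map (C.π i)) (sym r)))

                is-valid : Valid P.str P.finite (Code.raw t) κ
                is-valid = valid
                  (λ x y → trans (R.colour≡ x y) (trans (T.symm x y) (sym (R.colour≡ y x))))
                  (λ i x → trans (R.π≡ i _) (trans (cong (T.π i) (R.π⁻≡ i x)) (T.π-π⁻ i x)))
                  (λ i x → trans (R.π⁻≡ i _) (trans (cong (T.π⁻ i) (R.π≡ i x)) (T.π⁻-π i x)))
                  (λ i x y n → trans (R.colour≡ _ _) (trans (cong₂ T.colour (R.π≡ i x) (R.π≡ i y))
                    (trans (T.preserve i x y n) (sym (R.colour≡ x y)))))
                  inj
                  (λ x y n → agree x y n)
                  (λ i x → trans (cong κ (R.π≡ i x)) (κ-eqv i x))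
                  where
                  inj : ∀ x y → κ x ≢ nothing → κ x ≡ κ y → x ≡ y
                  inj x y n e with κ x in q
                  ... | nothing = contradiction refl n
                  ... | just z  = κ-inj x y q (sym e)
                  agree : ∀ x y → x ≢ y → Agree P.str P.finite (Code.raw t) κ (κ x) (κ y) (Raw.colour (Code.raw t) x y)
                  agree x y n with κ x in p | κ y in q
                  ... | nothing | _       = _
                  ... | just _  | nothing = _
                  ... | just z  | just w  = trans (κ-colour x y n p q) (sym (R.colour≡ x y))

                module Cp = Copy (A.copy is-valid)

                ext-ι : ∀ x {u} → ι x ≡ just u → (∃ λ w → u ≡ a w × κ x ≡ just (P.e w)) → J (Cp.j x) ≡ u
                ext-ι x e (w , refl , r) = trans (cong J (Cp.j-κ r)) (J-emb₀ w)

              stage : Stage σ t L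
              stage = record
                { D = A.D ; finD = A.finD ; str = A.str ; J = J ; emb = J-emb
                ; cover = λ u u≤t → cov (covered u (<-≤-trans (s≤s u≤t) t<B))
                ; ⊇ = λ p → sup p (covered _ (dom<B p)) (covered _ (ran<B p))
                ; task = task }
                where
                cov : ∀ {u} → (∃ λ x → a x ≡ u) → ∃ λ z → J z ≡ u
                cov (x , refl) = emb₀ x , J-emb₀ x
                sup : ∀ {u v} → (u , v) ∈ L → (∃ λ x → a x ≡ u) → (∃ λ x → a x ≡ ⟦ σ ⟧ v) →
                  ∃ λ z → J z ≡ u × ⟦ σ ⟧ v ≡ J (D.π zero z)
                sup p (x , refl) (y , e) = emb₀ x , J-emb₀ x , trans (sym e) (trans (sym (J-emb₀ y)) (cong J (sym
                  (trans (A.inc-eqv zero (P.e x)) (cong A.inc (P.extends zero (zero-g p (sym e))))))))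

      abstract
        result : Stage σ t L
        result = build (Gen.locally-finite B)
          where
          build : (Σ ℕ λ N → Σ (Str n (Fin N)) λ S → Σ (Fin N → ℕ) λ j →
            Emb S ds j × (∀ u → u < B → Σ (Fin N) λ x → j x ≡ u)) → Stage σ t L
          build (N , S , a , a-emb , covered) = place (extension-finite gen A.finD (reduct A.str) Am.start Am.start-partial)
            where
            module Cl = Closed N S a a-emb covered
            P : EPPA (suc n) N (Str.colour S) Cl.g
            P = eppa (suc n) N (Str.colour S) (Str.symm S) Cl.g (λ i {x} {y} {x′} {y′} → Cl.g-partial i {x} {y} {x′} {y′})
            module Ex = Cl.Extended P
            module A = Amalgam (amalgam (EPPA.str P) (EPPA.finite P) (Code.raw t) Ex.κ)
            module Am = Ex.Amalgamated (amalgam (EPPA.str P) (EPPA.finite P) (Code.raw t) Ex.κ)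
            place : (Σ (A.D → ℕ) λ J → Emb (reduct A.str) ds J × Extends Am.start J) → Stage σ t L
            place (J , E , e) = Am.Placed.stage J E e

    abstract
      stage : ∀ σ t L → PI L → Stage σ t L
      stage = Build.result

    module Run (σ : ℕ → G) (q : List (ℕ × ℕ)) (q-pi : PI q) where

      -- Stage `pair j t` serves the translate `σ j` and the code `t`. All pairs occur, so each
      -- product σ j f meets every coded task.
      stageAt : ∀ s L → PI L → Stage (σ (proj₁ (unpair s))) (proj₂ (unpair s)) L
      stageAt s = stage (σ (proj₁ (unpair s))) (proj₂ (unpair s))

      chain : ℕ → Σ (List (ℕ × ℕ)) PI
      chain zero    = q , q-pi
      chain (suc s) = Stage.next (stageAt s (proj₁ (chain s)) (proj₂ (chain s))) ,
                      Stage.next-pi (stageAt s (proj₁ (chain s)) (proj₂ (chain s)))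

      at : ∀ s → Stage (σ (proj₁ (unpair s))) (proj₂ (unpair s)) (proj₁ (chain s))
      at s = stageAt s (proj₁ (chain s)) (proj₂ (chain s))

      at-pair : ∀ j t → Σ ℕ λ s → unpair s ≡ (j , t)
      at-pair j t = pair j t , unpair-pair j t

      dom : ∀ u → Σ ℕ λ s → Σ ℕ λ v → (u , v) ∈ proj₁ (chain s)
      dom u with at-pair 0 u
      ... | s , e with Stage.cover (at s) u (≤-reflexive (sym (cong proj₂ e)))
      ...   | z , refl = suc s , _ , Stage.∈-next (at s) z

      -- Once `σ 0` applied to v lies in the finite set of a stage for `σ 0`, it is a value of slot
      -- `zero`, which permutes that set; so f takes the value v there.
      ran : ∀ v → Σ ℕ λ s → Σ ℕ λ u → (u , v) ∈ proj₁ (chain s)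
      ran v with at-pair 0 (⟦ σ 0 ⟧ v)
      ... | s , e with Stage.cover (at s) (⟦ σ 0 ⟧ v) (≤-reflexive (sym (cong proj₂ e)))
      ...   | z , p = suc s , Stage.J (at s) (S.π⁻ zero z) ,
                subst (λ w → (Stage.J (at s) (S.π⁻ zero z) , w) ∈ proj₁ (chain (suc s))) v≡ (Stage.∈-next (at s) (S.π⁻ zero z))
        where
        module S = Str (Stage.str (at s))
        σ≡ : σ (proj₁ (unpair s)) ≡ σ 0
        σ≡ = cong (σ ∘ proj₁) e
        v≡ : ⟦ σ (proj₁ (unpair s)) ⟧⁻ (Stage.J (at s) (S.π zero (S.π⁻ zero z))) ≡ v
        v≡ = trans (cong ⟦ σ (proj₁ (unpair s)) ⟧⁻ (trans (cong (Stage.J (at s)) (S.π-π⁻ zero z))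
               (trans p (cong (λ g → ⟦ g ⟧ v) (sym σ≡))))) (⟦⟧⁻-⟦⟧ (σ (proj₁ (unpair s))) v)

      lim : Σ G λ f → ∀ {s u v} → (u , v) ∈ proj₁ (chain s) → ⟦ f ⟧ u ≡ v
      lim = limit (proj₁ ∘ chain) (λ s → proj₂ (chain s)) (λ s → Stage.next-⊇ (at s)) dom ran

      f : G
      f = proj₁ lim

      module Result (j t : ℕ) where
        s = pair j t
        open Stage (at s)

        fs : Fin (suc n) → G
        fs = cons (σ j ∘G f) ds

        fs-J : ∀ i z → ⟦ fs i ⟧ (J z) ≡ J (str.π i z)
        fs-J (suc i) z = emb.eqv i z
        fs-J zero z = trans (cong ⟦ σ j ⟧ (proj₂ lim {suc s} (∈-next z)))
          (trans (cong (λ i → ⟦ σ j ⟧ (⟦ σ i ⟧⁻ (J (str.π zero z)))) (cong proj₁ (unpair-pair j t)))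
            (⟦⟧-⟦⟧⁻ (σ j) _))

        emb⁺ : Emb str fs J
        emb⁺ = record { inj = emb.inj ; colour = emb.colour ; eqv = fs-J }

        cover⁺ : ∀ u → u ≤ t → ∃ λ z → J z ≡ u
        cover⁺ u u≤t = cover u (subst (u ≤_) (sym (cong proj₂ (unpair-pair j t))) u≤t)

      module Extended (j N : ℕ) (T : Str (suc n) (Fin N)) (ι : Fin N → Maybe ℕ) where
        open Codes (suc n) N
        open Result j (code T ι)

        extension : PartialEmb T fs ι → Σ (Fin N → ℕ) λ l → Emb T fs l × Extends ι l
        extension = Stage.task (at s)
          (trans (code-size T ι) (cong (λ p → decode (proj₂ p) 0) (sym (unpair-pair j (code T ι))))) T ι
          (subst (λ t → Represents t T ι) (sym (cong proj₂ (unpair-pair j (code T ι)))) (code-represents T ι))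
          fs fs-J

      module LocallyFinite (j B : ℕ) where
        open Result j B
        open Stage (at s)
        open Finite finD

        locally-finite : Σ ℕ λ N → Σ (Str (suc n) (Fin N)) λ S → Σ (Fin N → ℕ) λ l →
          Emb S fs l × (∀ u → u < B → Σ (Fin N) λ x → l x ≡ u)
        locally-finite = size , transport finD str , J ∘ unrank , transport-emb finD str fs emb⁺ ,
          λ u u<B → rank (proj₁ (cover⁺ u (<⇒≤ u<B))) , trans (cong J (unrank-rank _)) (proj₂ (cover⁺ u (<⇒≤ u<B)))

      generic : ∀ j → Generic (suc n) (cons (σ j ∘G f) ds)
      generic j = record { extension = Extended.extension j ; locally-finite = LocallyFinite.locally-finite j }

    abstract
      generic-step : (σ : ℕ → G) (q : List (ℕ × ℕ)) → PI q →
        Σ G λ f → (∀ {u v} → (u , v) ∈ q → ⟦ f ⟧ u ≡ v) × (∀ j → Generic (suc n) (cons (σ j ∘G f) ds))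
      generic-step σ q q-pi = Run.f σ q q-pi , (λ p → proj₂ (Run.lim σ q q-pi) {0} p) , Run.generic σ q q-pi

-- Transitive actions: small elements cannot all move a point

module Actions (k : ℕ) (c : Colouring (suc k) ℕ) (ext : Extension (Colouring.col c)) where
  open Automorphisms k c ext
  open GenericStep k c ext

  record Action : Set where
    field
      act        : G → ℕ → ℕ
      act-cong   : ∀ g h → (∀ u → ⟦ g ⟧ u ≡ ⟦ h ⟧ u) → ∀ w → act g w ≡ act h w
      act-∘      : ∀ h g w → act (h ∘G g) w ≡ act h (act g w)
      transitive : ∀ w j → Σ G λ τ → act τ w ≡ j

    -- The identity law comes from transitivity: w is itself of the form `act τ w`, and composing
    -- with the identity does not change `τ`.
    act-id : ∀ w → act idG w ≡ w
    act-id w with transitive w w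
    ... | τ , e = trans (cong (act idG) (sym e)) (trans (sym (act-∘ idG τ w)) (trans (act-cong (idG ∘G τ) τ (λ _ → refl) w) e))

    act-inv : ∀ g w → act (inv g) (act g w) ≡ w
    act-inv g w = trans (sym (act-∘ (inv g) g w)) (trans (act-cong (inv g ∘G g) idG (⟦⟧⁻-⟦⟧ g) w) (act-id w))

    act-inv′ : ∀ g w → act g (act (inv g) w) ≡ w
    act-inv′ g w = trans (sym (act-∘ g (inv g) w)) (trans (act-cong (g ∘G inv g) idG (⟦⟧-⟦⟧⁻ g) w) (act-id w))

    act-injective : ∀ g {v w} → act g v ≡ act g w → v ≡ w
    act-injective g {v} {w} e = trans (sym (act-inv g v)) (trans (cong (act (inv g)) e) (act-inv g w))

  -- A finite piece of a conjugator f with f (ds i) = (bs i) f, saturated under all these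
  -- automorphisms and their inverses.
  record Closed {n : ℕ} (ds bs : Fin n → G) (L : List (ℕ × ℕ)) : Set where
    field
      isPI     : PI L
      forward  : ∀ i {u v} → (u , v) ∈ L → (⟦ ds i ⟧ u , ⟦ bs i ⟧ v) ∈ L
      backward : ∀ i {u v} → (u , v) ∈ L → (⟦ ds i ⟧⁻ u , ⟦ bs i ⟧⁻ v) ∈ L

  Closed-swap : ∀ {n} {ds bs : Fin n → G} {L} → Closed ds bs L → Closed bs ds (map swap L)
  Closed-swap {ds = ds} {bs} {L} cl = record { isPI = IsPI-swap (Closed.isPI cl) ; forward = fw ; backward = bw }
    where
    fw : ∀ i {u v} → (u , v) ∈ map swap L → (⟦ bs i ⟧ u , ⟦ ds i ⟧ v) ∈ map swap L
    fw i p with ∈-map⁻ swap p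
    ... | _ , q , refl = ∈-map⁺ swap (Closed.forward cl i q)
    bw : ∀ i {u v} → (u , v) ∈ map swap L → (⟦ bs i ⟧⁻ u , ⟦ ds i ⟧⁻ v) ∈ map swap L
    bw i p with ∈-map⁻ swap p
    ... | _ , q , refl = ∈-map⁺ swap (Closed.backward cl i q)

  Closed-[] : ∀ {ds bs} → Closed {0} ds bs []
  Closed-[] = record { isPI = λ () ; forward = λ () ; backward = λ () }

  module _ {n N : ℕ} {ds bs : Fin n → G} {S : Str n (Fin N)} {j j′ : Fin N → ℕ}
           (E : Emb S ds j) (E′ : Emb S bs j′) where
    private
      module S = Str S
      module E = Emb E
      module E′ = Emb E′

    pairs : List (ℕ × ℕ)
    pairs = map (λ x → j x , j′ x) (allFin N)

    ∈-pairs : ∀ x → (j x , j′ x) ∈ pairs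
    ∈-pairs x = ∈-map⁺ (λ x → j x , j′ x) (∈-allFin x)

    pairs⁻ : ∀ {u v} → (u , v) ∈ pairs → ∃ λ x → u ≡ j x × v ≡ j′ x
    pairs⁻ p with ∈-map⁻ (λ x → j x , j′ x) p
    ... | x , _ , refl = x , refl , refl

    eqv⁻ : ∀ {fs : Fin n → G} {l} → Emb S fs l → ∀ i x → ⟦ fs i ⟧⁻ (l x) ≡ l (S.π⁻ i x)
    eqv⁻ {fs} {l} F i x = trans (cong (⟦ fs i ⟧⁻ ∘ l) (sym (S.π-π⁻ i x)))
      (trans (cong ⟦ fs i ⟧⁻ (sym (Emb.eqv F i (S.π⁻ i x)))) (⟦⟧⁻-⟦⟧ (fs i) _))

    pairs-closed : Closed ds bs pairs
    pairs-closed = record { isPI = pi ; forward = fw ; backward = bw }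
      where
      pi : PI pairs
      pi p q with pairs⁻ p | pairs⁻ q
      ... | x , refl , refl | y , refl , refl = record
        { fun = cong j′ ∘ E.inj ; inj = cong j ∘ E′.inj
        ; col = λ n → trans (E′.colour x y (n ∘ cong j)) (sym (E.colour x y (n ∘ cong j))) }
      fw : ∀ i {u v} → (u , v) ∈ pairs → (⟦ ds i ⟧ u , ⟦ bs i ⟧ v) ∈ pairs
      fw i p with pairs⁻ p
      ... | x , refl , refl = subst (_∈ pairs) (sym (cong₂ _,_ (E.eqv i x) (E′.eqv i x))) (∈-pairs (S.π i x))
      bw : ∀ i {u v} → (u , v) ∈ pairs → (⟦ ds i ⟧⁻ u , ⟦ bs i ⟧⁻ v) ∈ pairs
      bw i p with pairs⁻ p
      ... | x , refl , refl = subst (_∈ pairs) (sym (cong₂ _,_ (eqv⁻ E i x) (eqv⁻ E′ i x))) (∈-pairs (S.π⁻ i x))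

  module _ {n N : ℕ} {ds bs : Fin n → G} (gen : Generic n bs) {S : Str n (Fin N)} {j : Fin N → ℕ} (E : Emb S ds j)
           {L : List (ℕ × ℕ)} (cl : Closed ds bs L)
           (covered : ∀ {u v} → (u , v) ∈ L → ∃ λ x → j x ≡ u) where
    private
      module S = Str S
      module E = Emb E
      module Cl = Closed cl
      open Lookup {ℕ} {ℕ} _≟_

      lookup-L : ∀ {u v} → (u , v) ∈ L → lookup L u ≡ just v
      lookup-L = lookup-∈ L λ p q → Match.fun (Cl.isPI p q) refl

      partial : PartialEmb S bs (λ x → lookup L (j x))
      partial = record
        { inj = λ p q → E.inj (Match.inj (Cl.isPI (lookup-just L p) (lookup-just L q)) refl)
        ; colour = λ {x} {y} p q n → trans (Match.col (Cl.isPI (lookup-just L p) (lookup-just L q)) (n ∘ E.inj)) (E.colour x y n)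
        ; eqv = λ i x → trans (cong (lookup L) (sym (E.eqv i x))) (eqv i (j x)) }
        where
        eqv : ∀ i u → lookup L (⟦ ds i ⟧ u) ≡ Maybe.map ⟦ bs i ⟧ (lookup L u)
        eqv i u with lookup L u in e
        ... | just v  = lookup-L (Cl.forward i (lookup-just L e))
        ... | nothing with lookup L (⟦ ds i ⟧ u) in e′
        ...   | nothing = refl
        ...   | just v  = contradiction (subst (λ a → (a , ⟦ bs i ⟧⁻ v) ∈ L) (⟦⟧⁻-⟦⟧ (ds i) u)
                            (Cl.backward i (lookup-just L e′))) (lookup-nothing L e)

    abstract
      -- Read through `j`, the relation `L` is a partial embedding of `S` for `bs`; saturation makes
      -- its domain invariant, so genericity of `bs` extends it to all of `S`.
      transfer : Σ (Fin N → ℕ) λ j′ → Emb S bs j′ × (∀ {u v} → (u , v) ∈ L → ∃ λ x → u ≡ j x × v ≡ j′ x)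
      transfer with Generic.extension gen N S _ partial
      ... | j′ , E′ , ext′ = j′ , E′ , λ p → sup p (covered p)
        where
        sup : ∀ {u v} → (u , v) ∈ L → (∃ λ x → j x ≡ u) → ∃ λ x → u ≡ j x × v ≡ j′ x
        sup p (x , refl) = x , refl , sym (ext′ x (lookup-L p))

  abstract
    cover-domain : ∀ {n} {ds bs : Fin n → G} → Generic n ds → Generic n bs → ∀ {L} → Closed ds bs L → ∀ B →
      Σ (List (ℕ × ℕ)) λ L′ → Closed ds bs L′ × (∀ {p} → p ∈ L → p ∈ L′) × (∀ u → u < B → ∃ λ v → (u , v) ∈ L′)
    cover-domain gd gb {L} cl B with Generic.locally-finite gd (B ⊔ bound proj₁ L)
    ... | N , S , j , E , cov with transfer gb E cl (λ p → cov _ (<-≤-trans (bound-∈ proj₁ p) (m≤n⊔m B _)))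
    ...   | j′ , E′ , sup = pairs E E′ , pairs-closed E E′ , (λ p → sub (sup p)) , λ u u<B → dm (cov u (<-≤-trans u<B (m≤m⊔n B _)))
      where
      sub : ∀ {u v} → (∃ λ x → u ≡ j x × v ≡ j′ x) → (u , v) ∈ pairs E E′
      sub (x , refl , refl) = ∈-pairs E E′ x
      dm : ∀ {u} → (∃ λ x → j x ≡ u) → ∃ λ v → (u , v) ∈ pairs E E′
      dm (x , refl) = j′ x , ∈-pairs E E′ x

    cover-both : ∀ {n} {ds bs : Fin n → G} → Generic n ds → Generic n bs → ∀ {L} → Closed ds bs L → ∀ B →
      Σ (List (ℕ × ℕ)) λ L′ → Closed ds bs L′ × (∀ {p} → p ∈ L → p ∈ L′) ×
        (∀ u → u < B → ∃ λ v → (u , v) ∈ L′) × (∀ v → v < B → ∃ λ u → (u , v) ∈ L′)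
    cover-both gd gb cl B with cover-domain gd gb cl B
    ... | L₁ , cl₁ , ⊇₁ , dom₁ with cover-domain gb gd (Closed-swap cl₁) B
    ...   | L₂ , cl₂ , ⊇₂ , dom₂ = map swap L₂ , Closed-swap cl₂ , L₁⊆ ∘ ⊇₁ ,
              (λ u u<B → _ , L₁⊆ (proj₂ (dom₁ u u<B))) , λ v v<B → _ , ∈-map⁺ swap (proj₂ (dom₂ v v<B))
      where
      L₁⊆ : ∀ {p} → p ∈ L₁ → p ∈ map swap L₂
      L₁⊆ p = ∈-map⁺ swap (⊇₂ (∈-map⁺ swap p))

  module SmallElements (𝒜 : Action) (w : ℕ) (e : ℕ → G) (e-fix : ∀ n u → u < n → ⟦ e n ⟧ u ≡ u)
                       (e-moves : ∀ n → Action.act 𝒜 (e n) w ≢ w) where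
    open Action 𝒜

    record State : Set where
      field
        n      : ℕ
        ds bs  : Fin n → G
        gen-d  : Generic n ds
        gen-b  : Generic n bs
        list   : List (ℕ × ℕ)
        closed : Closed ds bs list

    τ : ℕ → G
    τ j = proj₁ (transitive w j)

    τ-w : ∀ j → act (τ j) w ≡ j
    τ-w j = proj₂ (transitive w j)

    abstract
      -- Generic over ds after translation by every τ j, so that one translate fixes w.
      fixer : ∀ {n} {ds : Fin n → G} → Generic n ds → Σ G λ d → act d w ≡ w × Generic (suc n) (cons d ds)
      fixer gen with generic-step gen (inv ∘ τ) [] (λ ())
      ... | f , _ , gens = inv (τ j) ∘G f ,
            trans (act-∘ (inv (τ j)) f w) (trans (cong (act (inv (τ j))) (sym (τ-w j))) (act-inv (τ j) w)) , gens j
        where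
        j : ℕ
        j = act f w

      -- Conjugation by `τ j` turns an element moving w into one moving j. Choosing `B` beyond the
      -- preimages of the points `l x` keeps these fixed.
      mover : ∀ j {N} (l : Fin N → ℕ) → Σ G λ z → act z j ≢ j × (∀ x → ⟦ z ⟧ (l x) ≡ l x)
      mover j {N} l = τ j ∘G e B ∘G inv (τ j) , moves , fixes
        where
        B : ℕ
        B = bound (⟦ τ j ⟧⁻ ∘ l) (allFin N)
        moves : act (τ j ∘G e B ∘G inv (τ j)) j ≢ j
        moves q = e-moves B (act-injective (τ j) (trans (cong (act (τ j) ∘ act (e B)) (sym τ⁻j))
            (trans (sym (trans (act-∘ (τ j) (e B ∘G inv (τ j)) j) (cong (act (τ j)) (act-∘ (e B) (inv (τ j)) j))))
              (trans q (sym (τ-w j))))))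
          where
          τ⁻j : act (inv (τ j)) j ≡ w
          τ⁻j = trans (cong (act (inv (τ j))) (sym (τ-w j))) (act-inv (τ j) w)
        fixes : ∀ x → ⟦ τ j ⟧ (⟦ e B ⟧ (⟦ τ j ⟧⁻ (l x))) ≡ l x
        fixes x = trans (cong ⟦ τ j ⟧ (e-fix B _ (bound-∈ (⟦ τ j ⟧⁻ ∘ l) (∈-allFin x)))) (⟦⟧-⟦⟧⁻ (τ j) _)

      -- With z from `mover`, the elements f and z f agree on the finite set, as z fixes the images
      -- there; if f fixes j, then z f moves it. Genericity is therefore requested for the
      -- translates by the identity and by z at once.
      escaper : ∀ j {n N} {bs : Fin n → G} → Generic n bs → (S : Str (suc n) (Fin N)) {l : Fin N → ℕ} →
        Emb (reduct S) bs l → Σ G λ b → act b j ≢ j × Generic (suc n) (cons b bs) × Emb S (cons b bs) l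
      escaper j {n} {N} {bs} gen S {l} E = choose (mover j l)
        where
        module S = Str S
        module E = Emb E
        q : List (ℕ × ℕ)
        q = map (λ x → l x , l (S.π zero x)) (allFin N)
        q-pi : PI q
        q-pi p p′ with ∈-map⁻ (λ x → l x , l (S.π zero x)) p | ∈-map⁻ (λ x → l x , l (S.π zero x)) p′
        ... | x , _ , refl | y , _ , refl = record
          { fun = cong (l ∘ S.π zero) ∘ E.inj ; inj = cong l ∘ S.π-injective zero ∘ E.inj
          ; col = λ n → trans (E.colour _ _ (n ∘ cong l ∘ S.π-injective zero))
              (trans (S.preserve zero x y (n ∘ cong l)) (sym (E.colour x y (n ∘ cong l)))) }
        emb : ∀ b → (∀ x → ⟦ b ⟧ (l x) ≡ l (S.π zero x)) → Emb S (cons b bs) l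
        emb b b-q = record { inj = E.inj ; colour = E.colour ; eqv = λ { zero → b-q ; (suc i) → E.eqv i } }
        choose : (Σ G λ z → act z j ≢ j × (∀ x → ⟦ z ⟧ (l x) ≡ l x)) →
          Σ G λ b → act b j ≢ j × Generic (suc n) (cons b bs) × Emb S (cons b bs) l
        choose (z , z-moves , z-fixes) with generic-step gen (λ { zero → idG ; (suc _) → z }) q q-pi
        ... | f , f-q , gens = decide (act (idG ∘G f) j ≟ j)
          where
          f-l : ∀ x → ⟦ f ⟧ (l x) ≡ l (S.π zero x)
          f-l x = f-q (∈-map⁺ (λ x → l x , l (S.π zero x)) (∈-allFin x))
          decide : Dec (act (idG ∘G f) j ≡ j) →
            Σ G λ b → act b j ≢ j × Generic (suc n) (cons b bs) × Emb S (cons b bs) l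
          decide (no ¬p) = idG ∘G f , ¬p , gens 0 , emb (idG ∘G f) f-l
          decide (yes p) = z ∘G f ,
            (λ r → z-moves (trans (cong (act z) (sym (trans (act-cong f (idG ∘G f) (λ _ → refl) j) p))) (trans (sym (act-∘ z f j)) r))) ,
            gens 1 , emb (z ∘G f) (λ x → trans (cong ⟦ z ⟧ (f-l x)) (z-fixes (S.π zero x)))

    Contains : State → G → G → Set
    Contains st d b = ∃ λ i → State.ds st i ≡ d × State.bs st i ≡ b

    record Next (s : ℕ) (st : State) : Set where
      field
        state    : State
        d b      : G
        d-fixes  : act d w ≡ w
        b-moves  : act b s ≢ s
        contains : Contains state d b
        keeps    : ∀ {d b} → Contains st d b → Contains state d b
        ⊇        : ∀ {p} → p ∈ State.list st → p ∈ State.list state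
        dom      : ∃ λ v → (s , v) ∈ State.list state
        ran      : ∃ λ u → (u , s) ∈ State.list state

    module _ (s : ℕ) (st : State) where
      open State st
      private module Dependent {d : G} (d-fixes : act d w ≡ w) (gd : Generic (suc n) (cons d ds)) where

        extend : ∀ {b} → act b s ≢ s → Generic (suc n) (cons b bs) →
          ∀ {L} → Closed (cons d ds) (cons b bs) L → (∀ {p} → p ∈ list → p ∈ L) → Next s st
        extend {b} b-moves gb cl sub = build (cover-both gd gb cl (suc s))
          where
          build : (Σ (List (ℕ × ℕ)) λ L′ → Closed (cons d ds) (cons b bs) L′ × (∀ {p} → p ∈ _ → p ∈ L′) ×
            (∀ u → u < suc s → ∃ λ v → (u , v) ∈ L′) × (∀ v → v < suc s → ∃ λ u → (u , v) ∈ L′)) → Next s st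
          build (L′ , cl′ , ⊇ , dom , ran) = record
            { state = record { n = suc n ; ds = cons d ds ; bs = cons b bs
                             ; gen-d = gd ; gen-b = gb ; list = L′ ; closed = cl′ }
            ; d = d ; b = b ; d-fixes = d-fixes ; b-moves = b-moves
            ; contains = zero , refl , refl
            ; keeps = λ { (i , p , q) → suc i , p , q }
            ; ⊇ = λ p → ⊇ (sub p)
            ; dom = dom s (n<1+n s) ; ran = ran s (n<1+n s) }

        escape : ∀ {N} {S : Str (suc n) (Fin N)} {l : Fin N → ℕ} → Emb S (cons d ds) l →
          (∀ u → u < bound proj₁ list → ∃ λ x → l x ≡ u) → Next s st
        escape {N} {S} {l} E cov = middle (transfer gen-b restricted closed (λ p → cov _ (bound-∈ proj₁ p)))
          where
          restricted : Emb (reduct S) ds l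
          restricted = record { inj = Emb.inj E ; colour = Emb.colour E ; eqv = Emb.eqv E ∘ suc }
          middle : (Σ (Fin N → ℕ) λ l′ → Emb (reduct S) bs l′ ×
            (∀ {u v} → (u , v) ∈ list → ∃ λ x → u ≡ l x × v ≡ l′ x)) → Next s st
          middle (l′ , E′ , sup) = last (escaper s gen-b S E′)
            where
            last : (Σ G λ b → act b s ≢ s × Generic (suc n) (cons b bs) × Emb S (cons b bs) l′) → Next s st
            last (b , b-moves , gb , E″) = extend b-moves gb (pairs-closed E E″) (λ p → sub (sup p))
              where
              sub : ∀ {u v} → (∃ λ x → u ≡ l x × v ≡ l′ x) → (u , v) ∈ pairs E E″
              sub (x , refl , refl) = ∈-pairs E E″ x

      abstract
        -- The order of choices matters. First d is taken in the stabiliser of w; it determines a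
        -- finite invariant set with its permutations. The set is copied to the other side for the
        -- old tuple, and only then is b chosen to act on the copy as d acts on the original, while
        -- moving s.
        next : Next s st
        next = first (fixer gen-d)
          where
          first : (Σ G λ d → act d w ≡ w × Generic (suc n) (cons d ds)) → Next s st
          first (d , d-fixes , gd) = second (Generic.locally-finite gd (bound proj₁ list))
            where
            second : (Σ ℕ λ N → Σ (Str (suc n) (Fin N)) λ S → Σ (Fin N → ℕ) λ l →
              Emb S (cons d ds) l × (∀ u → u < bound proj₁ list → Σ (Fin N) λ x → l x ≡ u)) → Next s st
            second (N , S , l , E , cov) = Dependent.escape d-fixes gd E cov

    chain : ℕ → State
    chain zero    = record { n = 0 ; ds = empty ; bs = empty ; gen-d = generic-empty ; gen-b = generic-empty
                           ; list = [] ; closed = Closed-[] }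
    chain (suc s) = Next.state (next s (chain s))

    at : ∀ s → Next s (chain s)
    at s = next s (chain s)

    conjugator : Σ G λ f → ∀ {s u v} → (u , v) ∈ State.list (chain s) → ⟦ f ⟧ u ≡ v
    conjugator = limit (State.list ∘ chain) (λ s → Closed.isPI (State.closed (chain s))) (λ s → Next.⊇ (at s))
      (λ u → suc u , Next.dom (at u)) (λ v → suc v , Next.ran (at v))

    f : G
    f = proj₁ conjugator

    keeps* : ∀ {s t} → s ≤′ t → ∀ {d b} → Contains (chain s) d b → Contains (chain t) d b
    keeps* (≤′-reflexive refl) p = p
    keeps* (≤′-step {n = t} s≤t) p = Next.keeps (at t) (keeps* s≤t p)

    ⊇* : ∀ {s t} → s ≤′ t → ∀ {p} → p ∈ State.list (chain s) → p ∈ State.list (chain t)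
    ⊇* (≤′-reflexive refl) p = p
    ⊇* (≤′-step {n = t} s≤t) p = Next.⊇ (at t) (⊇* s≤t p)

    -- At a stage after both s and u the slot of this d and b is present and u is in the domain, so
    -- saturation of the list gives the equation.
    conjugates : ∀ s u → ⟦ f ⟧ (⟦ Next.d (at s) ⟧ u) ≡ ⟦ Next.b (at s) ⟧ (⟦ f ⟧ u)
    conjugates s u with keeps* {suc s} {suc s ⊔ suc u} (≤⇒≤′ (m≤m⊔n (suc s) (suc u))) (Next.contains (at s))
                      | ⊇* {suc u} {suc s ⊔ suc u} (≤⇒≤′ (m≤n⊔m (suc s) (suc u))) (proj₂ (Next.dom (at u)))
    ... | i , p , q | u∈ = trans (cong (λ d → ⟦ f ⟧ (⟦ d ⟧ u)) (sym p))
          (trans (proj₂ conjugator {suc s ⊔ suc u} (Closed.forward (State.closed (chain (suc s ⊔ suc u))) i u∈))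
            (cong₂ (λ b v → ⟦ b ⟧ v) q (sym (proj₂ conjugator {suc s ⊔ suc u} u∈))))

    absurd : ⊥
    absurd = Next.b-moves (at j) (trans (cong (act (Next.b (at j))) refl) (trans (sym (act-∘ (Next.b (at j)) f w))
      (trans (act-cong (Next.b (at j) ∘G f) (f ∘G Next.d (at j)) (λ u → sym (conjugates j u)) w) (trans (act-∘ f (Next.d (at j)) w) (cong (act f) (Next.d-fixes (at j)))))))
      where
      j : ℕ
      j = act f w

  no-small-moves : (𝒜 : Action) (w : ℕ) (e : ℕ → G) → (∀ n u → u < n → ⟦ e n ⟧ u ≡ u) →
    ¬ (∀ n → Action.act 𝒜 (e n) w ≢ w)
  no-small-moves 𝒜 w e e-fix e-moves = SmallElements.absurd 𝒜 w e e-fix e-moves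

-- An automorphism whose powers drive finite sets apart

∣a+N-b∣ : ∀ a b N → N ≤ ∣ (a +ℤ + N) -ℤ b ∣ + (∣ a ∣ + ∣ b ∣)
∣a+N-b∣ a b N = begin
  ∣ + N ∣                                 ≡⟨ cong ∣_∣ N≡ ⟩
  ∣ d +ℤ (-ℤ a +ℤ b) ∣                    ≤⟨ ℤ.∣i+j∣≤∣i∣+∣j∣ d (-ℤ a +ℤ b) ⟩
  ∣ d ∣ + ∣ -ℤ a +ℤ b ∣                   ≤⟨ +-monoʳ-≤ ∣ d ∣ (ℤ.∣i+j∣≤∣i∣+∣j∣ (-ℤ a) b) ⟩
  ∣ d ∣ + (∣ -ℤ a ∣ + ∣ b ∣)              ≡⟨ cong (λ z → ∣ d ∣ + (z + ∣ b ∣)) (ℤ.∣-i∣≡∣i∣ a) ⟩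
  ∣ d ∣ + (∣ a ∣ + ∣ b ∣) ∎
  where
  open ≤-Reasoning
  d : ℤ
  d = (a +ℤ + N) -ℤ b
  N≡ : + N ≡ d +ℤ (-ℤ a +ℤ b)
  N≡ = sym (trans (cong (d +ℤ_) (ℤ.+-comm (-ℤ a) b)) (trans (sym (ℤ.+-assoc d b (-ℤ a)))
    (trans (cong (_+ℤ -ℤ a) (trans (ℤ.+-assoc (a +ℤ + N) (-ℤ b) b)
      (trans (cong ((a +ℤ + N) +ℤ_) (ℤ.+-inverseˡ b)) (ℤ.+-identityʳ (a +ℤ + N)))))
    (trans (cong (_+ℤ -ℤ a) (ℤ.+-comm a (+ N))) (trans (ℤ.+-assoc (+ N) a (-ℤ a))
      (trans (cong (+ N +ℤ_) (ℤ.+-inverseʳ a)) (ℤ.+-identityʳ (+ N))))))))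

module Mix (k : ℕ) (c : Colouring (suc k) ℕ) (ext : Extension (Colouring.col c)) where
  open Automorphisms k c ext
  open GenericStep k c ext using (toColour; toColour-toℕ)

  module _ (n : ℕ) where

    -- The model: n fixed points together with countably many copies of ℤ (rows); the number of a row
    -- encodes finitely many colours between it and the points coming before it.
    private
      Y : Set
      Y = Fin n ⊎ (ℕ × ℤ)

      _≟Y_ : DecidableEquality Y
      _≟Y_ = ⊎-≡-dec Fin._≟_ (×-≡-dec _≟_ ℤ._≟_)

      codeℤ : ℤ → ℕ
      codeℤ (+ a)      = pair 0 a
      codeℤ (-[1+ a ]) = pair 1 a

      decodeℤ : ℕ × ℕ → ℤ
      decodeℤ (zero  , a) = + a
      decodeℤ (suc _ , a) = -[1+ a ]

      decodeℤ-codeℤ : ∀ a → decodeℤ (unpair (codeℤ a)) ≡ a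
      decodeℤ-codeℤ (+ a)      = cong decodeℤ (unpair-pair 0 a)
      decodeℤ-codeℤ (-[1+ a ]) = cong decodeℤ (unpair-pair 1 a)

      ∣a∣≤codeℤ : ∀ a → ∣ a ∣ ≤ codeℤ a
      ∣a∣≤codeℤ (+ a)      = +≤pair 0 a
      ∣a∣≤codeℤ (-[1+ a ]) = +≤pair 1 a

      key : Y → ℕ
      key (inj₁ u)       = pair 0 (toℕ u)
      key (inj₂ (i , a)) = pair (suc i) (codeℤ a)

      unkey : ℕ × ℕ → Y
      unkey (zero , u) with u <? n
      ... | yes u<n = inj₁ (fromℕ< u<n)
      ... | no  _   = inj₂ (0 , + 0)
      unkey (suc i , a) = inj₂ (i , decodeℤ (unpair a))

      unkey-key : ∀ y → unkey (unpair (key y)) ≡ y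
      unkey-key (inj₂ (i , a)) = trans (cong unkey (unpair-pair (suc i) (codeℤ a))) (cong (λ a → inj₂ (i , a)) (decodeℤ-codeℤ a))
      unkey-key (inj₁ u) = trans (cong unkey (unpair-pair 0 (toℕ u))) lem
        where
        lem : unkey (zero , toℕ u) ≡ inj₁ u
        lem with toℕ u <? n
        ... | yes p = cong inj₁ (Fin.toℕ-injective (Fin.toℕ-fromℕ< p))
        ... | no ¬p = contradiction (Fin.toℕ<n u) ¬p

      key-injective : ∀ {x y} → key x ≡ key y → x ≡ y
      key-injective {x} {y} e = trans (sym (unkey-key x)) (trans (cong (unkey ∘ unpair) e) (unkey-key y))

      ∣a∣≤key : ∀ i a → ∣ a ∣ ≤ key (inj₂ (i , a))
      ∣a∣≤key i a = ≤-trans (∣a∣≤codeℤ a) (≤-trans (m≤n+m (codeℤ a) (suc i)) (+≤pair (suc i) (codeℤ a)))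

      -- A row number i unpairs into a padding, a width and a table of colours. The padding only
      -- lifts i above the numbers of the rows mentioned in the table.
      width : ℕ → ℕ
      width i = proj₁ (unpair (proj₂ (unpair i)))

      look : ℕ → ℕ → Colour
      look i κ with κ <? width i
      ... | yes _ = toColour (decode (proj₂ (unpair (proj₂ (unpair i)))) κ)
      ... | no  _ = red

      look-far : ∀ i {κ} → width i ≤ κ → look i κ ≡ red
      look-far i {κ} le with κ <? width i
      ... | yes p = contradiction p (≤⇒≯ le)
      ... | no _  = refl

      -- The later row decides, and only the difference of positions enters, so that shifting all
      -- rows together is an automorphism. For a new point at position 0 the difference is the
      -- position of the other point.
      row : ℕ × ℤ → ℕ × ℤ → Colour
      row (i , a) (i′ , a′) with <-cmp i i′
      ... | tri< _ _ _ = look i′ (key (inj₂ (i , a -ℤ a′)))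
      ... | tri≈ _ _ _ = red
      ... | tri> _ _ _ = look i (key (inj₂ (i′ , a′ -ℤ a)))

      row-sym : ∀ p q → row p q ≡ row q p
      row-sym (i , a) (i′ , a′) with <-cmp i i′ | <-cmp i′ i
      ... | tri< _ _ _ | tri> _ _ _ = refl
      ... | tri≈ _ _ _ | tri≈ _ _ _ = refl
      ... | tri> _ _ _ | tri< _ _ _ = refl
      ... | tri< p _ _ | tri< q _ _ = contradiction q (<-asym p)
      ... | tri< _ p _ | tri≈ _ q _ = contradiction (sym q) p
      ... | tri≈ _ p _ | tri< _ q _ = contradiction (sym p) q
      ... | tri≈ _ p _ | tri> _ q _ = contradiction (sym p) q
      ... | tri> _ p _ | tri≈ _ q _ = contradiction (sym q) p
      ... | tri> _ _ p | tri> _ _ q = contradiction q (<-asym p)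

      cY : Y → Y → Colour
      cY (inj₁ u) (inj₁ v)       = cc (toℕ u) (toℕ v)
      cY (inj₁ u) (inj₂ (i , a)) = look i (key (inj₁ u))
      cY (inj₂ (i , a)) (inj₁ u) = look i (key (inj₁ u))
      cY (inj₂ p) (inj₂ q)       = row p q

      cY-sym : ∀ x y → cY x y ≡ cY y x
      cY-sym (inj₁ u) (inj₁ v) = cc-sym _ _
      cY-sym (inj₁ u) (inj₂ p) = refl
      cY-sym (inj₂ p) (inj₁ u) = refl
      cY-sym (inj₂ p) (inj₂ q) = row-sym p q

      rowNo : Y → ℕ
      rowNo (inj₁ _)       = 0
      rowNo (inj₂ (i , _)) = i

      module _ (l : List Y) (t : Y → Colour) where
        open Lookup {ℕ} {Colour} _≟_

        table : List (ℕ × Colour)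
        table = map (λ y → key y , t y) l

        table-functional : Functional table
        table-functional p q with ∈-map⁻ (λ y → key y , t y) p | ∈-map⁻ (λ y → key y , t y) q
        ... | y , _ , refl | y′ , _ , e with key-injective {y} {y′} (cong proj₁ e)
        ...   | refl = sym (cong proj₂ e)

        entry : ℕ → ℕ
        entry κ = maybe toℕ 0 (lookup table κ)

        new : ℕ
        new = pair (bound rowNo l) (pair (bound key l) (encode (bound key l) entry))

        new-width : width new ≡ bound key l
        new-width = trans (cong (proj₁ ∘ unpair ∘ proj₂) (unpair-pair _ _)) (cong proj₁ (unpair-pair _ _))

        new-look : ∀ {y} → y ∈ l → look new (key y) ≡ t y
        new-look {y} p with key y <? width new
        ... | no ¬p = contradiction (subst (key y <_) (sym new-width) (bound-∈ key p)) ¬p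
        ... | yes _ = trans (cong (λ q → toColour (decode (proj₂ (unpair (proj₂ q))) (key y))) (unpair-pair _ _))
          (trans (cong (λ q → toColour (decode (proj₂ q) (key y))) (unpair-pair _ _))
          (trans (cong toColour (trans (decode-encode _ entry (key y) (bound-∈ key p))
            (cong (maybe toℕ 0) (lookup-∈ table table-functional (∈-map⁺ (λ y → key y , t y) p))))) (toColour-toℕ (t y))))

        row<new : ∀ {y} → y ∈ l → rowNo y < new
        row<new p = <-≤-trans (bound-∈ rowNo p) (≤-trans (m≤m+n _ _) (+≤pair _ _))

        new-colour : ∀ {y} → y ∈ l → cY (inj₂ (new , + 0)) y ≡ t y
        new-colour {inj₁ u} p = new-look p
        new-colour {inj₂ (i , a)} p with <-cmp new i
        ... | tri< q _ _ = contradiction q (<-asym (row<new p))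
        ... | tri≈ _ q _ = contradiction (row<new p) (<-irrefl (sym q))
        ... | tri> _ _ _ = trans (cong (λ a → look new (key (inj₂ (i , a)))) (ℤ.+-identityʳ a)) (new-look p)

      extY : Extension cY
      extY l t = inj₂ (new l t , + 0) , (λ p → <-irrefl refl (row<new l t p)) , new-colour l t

      fixed : List (ℕ × Y)
      fixed = tabulate λ u → toℕ u , inj₁ u

      fixed-pi : IsPI cc cY fixed
      fixed-pi p q with ∈-tabulate⁻ p | ∈-tabulate⁻ q
      ... | u , refl | v , refl = record
        { fun = cong inj₁ ∘ Fin.toℕ-injective ; inj = cong toℕ ∘ inj₁-injective ; col = λ _ → refl }

      module BF = BackAndForth _≟_ _≟Y_ cc cY cc-sym cY-sym ext extY id id (λ _ → refl)
                    (unkey ∘ unpair) key unkey-key fixed fixed-pi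

      model : ℕ ↔ Y
      model = proj₁ BF.result

      to : ℕ → Y
      to = Inverse.to model

      from : Y → ℕ
      from = Inverse.from model

      to-from : ∀ y → to (from y) ≡ y
      to-from = Inverse.strictlyInverseˡ model

      from-to : ∀ u → from (to u) ≡ u
      from-to = Inverse.strictlyInverseʳ model

      to-injective : ∀ {u v} → to u ≡ to v → u ≡ v
      to-injective {u} {v} e = trans (sym (from-to u)) (trans (cong from e) (from-to v))

      to-colour : ∀ u v → u ≢ v → cY (to u) (to v) ≡ cc u v
      to-colour = proj₁ (proj₂ BF.result)

      from-colour : ∀ x y → x ≢ y → cc (from x) (from y) ≡ cY x y
      from-colour x y n = trans (sym (to-colour _ _ λ e → n (trans (sym (to-from x)) (trans (cong to e) (to-from y)))))
        (cong₂ cY (to-from x) (to-from y))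

      to-fixed : ∀ u → to (toℕ u) ≡ inj₁ u
      to-fixed u = proj₂ (proj₂ BF.result) (∈-tabulate⁺ {f = λ u → toℕ u , inj₁ u} u)

      shift : ℤ → Y → Y
      shift d (inj₁ u)       = inj₁ u
      shift d (inj₂ (i , a)) = inj₂ (i , a +ℤ d)

      -ℤ-shift : ∀ a b d → (a +ℤ d) -ℤ (b +ℤ d) ≡ a -ℤ b
      -ℤ-shift a b d = trans (cong (a +ℤ d +ℤ_) (trans (ℤ.neg-distrib-+ b d) (ℤ.+-comm (-ℤ b) (-ℤ d))))
        (trans (sym (ℤ.+-assoc (a +ℤ d) (-ℤ d) (-ℤ b))) (cong (_-ℤ b) (trans (ℤ.+-assoc a d (-ℤ d))
          (trans (cong (a +ℤ_) (ℤ.+-inverseʳ d)) (ℤ.+-identityʳ a)))))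

      shift-colour : ∀ d x y → cY (shift d x) (shift d y) ≡ cY x y
      shift-colour d (inj₁ _) (inj₁ _) = refl
      shift-colour d (inj₁ _) (inj₂ _) = refl
      shift-colour d (inj₂ _) (inj₁ _) = refl
      shift-colour d (inj₂ (i , a)) (inj₂ (i′ , a′)) with <-cmp i i′
      ... | tri< _ _ _ = cong (λ a → look i′ (key (inj₂ (i , a)))) (-ℤ-shift a a′ d)
      ... | tri≈ _ _ _ = refl
      ... | tri> _ _ _ = cong (λ a → look i (key (inj₂ (i′ , a)))) (-ℤ-shift a′ a d)

      shift-+ : ∀ d e x → shift d (shift e x) ≡ shift (e +ℤ d) x
      shift-+ d e (inj₁ _)       = refl
      shift-+ d e (inj₂ (i , a)) = cong (λ a → inj₂ (i , a)) (ℤ.+-assoc a e d)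

      shift-0 : ∀ x → shift (+ 0) x ≡ x
      shift-0 (inj₁ _)       = refl
      shift-0 (inj₂ (i , a)) = cong (λ a → inj₂ (i , a)) (ℤ.+-identityʳ a)

      shift-inverse : ∀ d e → e +ℤ d ≡ + 0 → ∀ x → shift d (shift e x) ≡ x
      shift-inverse d e p x = trans (shift-+ d e x) (trans (cong (λ d → shift d x) p) (shift-0 x))

    private module _ (d : ℤ) where
      move : ℤ → ℕ → ℕ
      move d = from ∘ shift d ∘ to

      move-inverse : ∀ d e → e +ℤ d ≡ + 0 → ∀ u → move d (move e u) ≡ u
      move-inverse d e p u = trans (cong (from ∘ shift d) (to-from _)) (trans (cong from (shift-inverse d e p (to u))) (from-to u))

      move-colour : ∀ u v → u ≢ v → cc (move d u) (move d v) ≡ cc u v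
      move-colour u v n = trans (from-colour _ _ λ e → n (to-injective (trans (sym (shift-inverse (-ℤ d) d (ℤ.+-inverseʳ d) (to u)))
          (trans (cong (shift (-ℤ d)) e) (shift-inverse (-ℤ d) d (ℤ.+-inverseʳ d) (to v))))))
        (trans (shift-colour d (to u) (to v)) (to-colour u v n))

    private
      point : ℕ × ℤ → Y
      point = inj₂

      -- A shift at least this long makes the difference of positions exceed both widths. Then the
      -- table that decides the colour has ended, leaving `red`, and points of one row cannot
      -- coincide.
      far : Y → Y → ℕ
      far (inj₂ (i , a)) (inj₂ (i′ , a′)) = suc ((width i + width i′) + (∣ a ∣ + ∣ a′ ∣))
      far _ _ = 0

      far-bound : ∀ W a b N → suc (W + (∣ a ∣ + ∣ b ∣)) ≤ N → W < ∣ (a +ℤ + N) -ℤ b ∣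
      far-bound W a b N le = +-cancelʳ-< (∣ a ∣ + ∣ b ∣) W _ (≤-trans le (∣a+N-b∣ a b N))

      ∣-∣-sym : ∀ a b → ∣ a -ℤ b ∣ ≡ ∣ b -ℤ a ∣
      ∣-∣-sym = ℤ.∣i-j∣≡∣j-i∣

      far-red : ∀ p q N → far (inj₂ p) (inj₂ q) ≤ N → row (proj₁ p , proj₂ p +ℤ + N) q ≡ red
      far-red (i , a) (i′ , a′) N le with <-cmp i i′
      ... | tri< _ _ _ = look-far i′ (<⇒≤ (<-≤-trans (≤-<-trans (m≤n+m (width i′) (width i)) (far-bound _ a a′ N le)) (∣a∣≤key i ((a +ℤ + N) -ℤ a′))))
      ... | tri≈ _ _ _ = refl
      ... | tri> _ _ _ = look-far i (<⇒≤ (<-≤-trans (≤-<-trans (m≤m+n (width i) (width i′))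
                           (subst (width i + width i′ <_) (∣-∣-sym (a +ℤ + N) a′) (far-bound _ a a′ N le))) (∣a∣≤key i′ (a′ -ℤ (a +ℤ + N)))))

      far-apart : ∀ p q N → far (inj₂ p) (inj₂ q) ≤ N → point (proj₁ p , proj₂ p +ℤ + N) ≢ point q
      far-apart (i , a) (i′ , _) N le refl =
        contradiction (far-bound _ a (a +ℤ + N) N le) (subst (λ z → ¬ (width i + width i < z)) (sym (cong ∣_∣ (ℤ.+-inverseʳ (a +ℤ + N)))) λ ())

    -- The field `power-generated` says that the elements `power N` lie in the submonoid generated
    -- by `t`, as an induction principle; it is applied to the property of fixing w.
    record MixingElement : Set₁ where
      field
        t     : G
        power : ℕ → G
        power-generated : (P : G → Set) → (∀ {g h} → (∀ u → ⟦ g ⟧ u ≡ ⟦ h ⟧ u) → P g → P h) →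
          P idG → (∀ {g h} → P g → P h → P (g ∘G h)) → P t → ∀ N → P (power N)
        power-fix : ∀ N u → u < n → ⟦ power N ⟧ u ≡ u
        t-fix : ∀ u → u < n → ⟦ t ⟧ u ≡ u
        mix   : ∀ B → Σ ℕ λ N → ∀ u v → n ≤ u → n ≤ v → u < B → v < B →
          ⟦ power N ⟧ u ≢ v × cc (⟦ power N ⟧ u) v ≡ red

    abstract
      mixing : MixingElement
      mixing = record
        { t = mk (+ 1) ; power = mk ∘ +_
        ; power-generated = generated
        ; power-fix = λ N u u<n → fix N u (fromℕ< u<n) (Fin.toℕ-fromℕ< u<n)
        ; t-fix = λ u u<n → fix 1 u (fromℕ< u<n) (Fin.toℕ-fromℕ< u<n)
        ; mix = λ B → mixB B , λ u v n≤u n≤v u<B v<B → apart B u v n≤u n≤v u<B v<B }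
        where
        mk : ℤ → G
        mk d = mk↔ₛ′ (move d d) (move d (-ℤ d)) (move-inverse d d (-ℤ d) (ℤ.+-inverseˡ d))
                 (move-inverse d (-ℤ d) d (ℤ.+-inverseʳ d)) , move-colour d

        generated : (P : G → Set) → (∀ {g h} → (∀ u → ⟦ g ⟧ u ≡ ⟦ h ⟧ u) → P g → P h) →
          P idG → (∀ {g h} → P g → P h → P (g ∘G h)) → P (mk (+ 1)) → ∀ N → P (mk (+ N))
        generated P resp Pid P∘ Pt zero = resp (λ u → sym (trans (cong from (shift-0 (to u))) (from-to u))) Pid
        generated P resp Pid P∘ Pt (suc N) = resp {mk (+ 1) ∘G mk (+ N)}
          (λ u → cong from (trans (cong (shift (+ 1)) (to-from _)) (trans (shift-+ (+ 1) (+ N) (to u))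
            (cong (λ d → shift d (to u)) (cong +_ (+-comm N 1))))))
          (P∘ Pt (generated P resp Pid P∘ Pt N))

        fix : ∀ N u (i : Fin n) → toℕ i ≡ u → from (shift (+ N) (to u)) ≡ u
        fix N .(toℕ i) i refl = trans (cong (from ∘ shift (+ N)) (to-fixed i)) (trans (cong from (sym (to-fixed i))) (from-to (toℕ i)))

        mixB : ℕ → ℕ
        mixB B = bound (λ u → bound (λ v → far (to u) (to v)) (upTo B)) (upTo B)

        far≤ : ∀ B u v → u < B → v < B → far (to u) (to v) ≤ mixB B
        far≤ B u v u<B v<B = <⇒≤ (<-trans (bound-∈ (λ v → far (to u) (to v)) (∈-upTo⁺ v<B))
          (bound-∈ (λ u → bound (λ v → far (to u) (to v)) (upTo B)) (∈-upTo⁺ u<B)))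

        moving : ∀ u → n ≤ u → ∃ λ p → to u ≡ point p
        moving u n≤u with to u in e
        ... | inj₂ p = p , refl
        ... | inj₁ i = contradiction (subst (_< n) (to-injective (trans (to-fixed i) (sym e))) (Fin.toℕ<n i)) (≤⇒≯ n≤u)

        apart : ∀ B u v → n ≤ u → n ≤ v → u < B → v < B →
          from (shift (+ mixB B) (to u)) ≢ v × cc (from (shift (+ mixB B) (to u))) v ≡ red
        apart B u v n≤u n≤v u<B v<B with moving u n≤u | moving v n≤v | far≤ B u v u<B v<B
        ... | p , e | q , e′ | le rewrite e = ne , trans (cong (cc _) (trans (sym (from-to v)) (cong from e′)))
              (trans (from-colour (point (proj₁ p , proj₂ p +ℤ + mixB B)) (point q) ne′) (far-red p q _ le′))
          where
          le′ : far (point p) (point q) ≤ mixB B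
          le′ = subst (λ y → far (point p) y ≤ mixB B) e′ le
          ne′ : point (proj₁ p , proj₂ p +ℤ + mixB B) ≢ point q
          ne′ = far-apart p q _ le′
          ne : from (point (proj₁ p , proj₂ p +ℤ + mixB B)) ≢ v
          ne r = ne′ (trans (sym (to-from (point (proj₁ p , proj₂ p +ℤ + mixB B)))) (trans (cong to r) e′))

-- Deciding whether a pointwise stabiliser fixes a point

module SmallIndex (k : ℕ) (c : Colouring (suc k) ℕ) (ext : Extension (Colouring.col c)) where
  open Automorphisms k c ext
  open Actions k c ext
  open Mix k c ext

  -- The automorphism that is the identity until the least i with P i is found, and r i from then on.
  module Delay (P : ℕ → Set) (P? : ∀ i → Dec (P i)) (r : ℕ → G)
               (r-fix : ∀ i u → u < i → ⟦ r i ⟧ u ≡ u) where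

    Least : ℕ → Set
    Least i = P i × (∀ j → j < i → ¬ P j)

    search : ∀ B → (∃ λ i → i ≤ B × Least i) ⊎ (∀ j → j ≤ B → ¬ P j)
    search zero with P? 0
    ... | yes p = inj₁ (0 , z≤n , p , λ _ ())
    ... | no ¬p = inj₂ λ { zero z≤n → ¬p }
    search (suc B) with search B
    ... | inj₁ (i , i≤B , l) = inj₁ (i , m≤n⇒m≤1+n i≤B , l)
    ... | inj₂ none with P? (suc B)
    ...   | yes p = inj₁ (suc B , ≤-refl , p , λ { j (s≤s j≤B) → none j j≤B })
    ...   | no ¬p = inj₂ λ j j≤ → not j (m≤n⇒m<n∨m≡n j≤)
      where
      not : ∀ j → j < suc B ⊎ j ≡ suc B → ¬ P j
      not j (inj₁ (s≤s j≤B)) = none j j≤B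
      not j (inj₂ refl)      = ¬p

    least-unique : ∀ {i j} → Least i → Least j → i ≡ j
    least-unique {i} {j} (p , l) (q , l′) = ≤-antisym (≮⇒≥ λ j<i → l j j<i q) (≮⇒≥ λ i<j → l′ i i<j p)

    -- Searching up to u is enough: if the least i is larger than u, then `r i` fixes u anyway. The
    -- evaluation `ev` is a parameter so that the inverse is built in the same way.
    apply : (G → ℕ → ℕ) → ℕ → ℕ
    apply ev u with search u
    ... | inj₁ (i , _) = ev (r i) u
    ... | inj₂ _       = u

    apply-least : (ev : G → ℕ → ℕ) → (∀ i u → u < i → ev (r i) u ≡ u) → ∀ {i} → Least i → ∀ u → apply ev u ≡ ev (r i) u
    apply-least ev fix {i} l u with search u
    ... | inj₁ (j , _ , l′) = cong (λ i → ev (r i) u) (least-unique l′ l)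
    ... | inj₂ none         = sym (fix i u (≰⇒> λ i≤u → none i i≤u (proj₁ l)))

    apply-none : (ev : G → ℕ → ℕ) → ∀ u → (∀ j → j ≤ u → ¬ P j) → apply ev u ≡ u
    apply-none ev u none with search u
    ... | inj₁ (i , i≤u , p , _) = contradiction p (none i i≤u)
    ... | inj₂ _ = refl

    r-fix⁻ : ∀ i u → u < i → ⟦ r i ⟧⁻ u ≡ u
    r-fix⁻ i u u<i = trans (cong ⟦ r i ⟧⁻ (sym (r-fix i u u<i))) (⟦⟧⁻-⟦⟧ (r i) u)

    to from : ℕ → ℕ
    to   = apply ⟦_⟧
    from = apply ⟦_⟧⁻

    to-from : ∀ u → to (from u) ≡ u
    to-from u with search u
    ... | inj₁ (i , _ , l) = trans (apply-least ⟦_⟧ r-fix l _) (⟦⟧-⟦⟧⁻ (r i) u)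
    ... | inj₂ none        = apply-none ⟦_⟧ u none

    from-to : ∀ u → from (to u) ≡ u
    from-to u with search u
    ... | inj₁ (i , _ , l) = trans (apply-least ⟦_⟧⁻ r-fix⁻ l _) (⟦⟧⁻-⟦⟧ (r i) u)
    ... | inj₂ none        = apply-none ⟦_⟧⁻ u none

    to-colour : ∀ u v → u ≢ v → cc (to u) (to v) ≡ cc u v
    to-colour u v u≢v with search (u ⊔ v)
    ... | inj₁ (i , _ , l) = trans (cong₂ cc (apply-least ⟦_⟧ r-fix l u) (apply-least ⟦_⟧ r-fix l v)) (⟦⟧-colour (r i) u v u≢v)
    ... | inj₂ none = cong₂ cc (apply-none ⟦_⟧ u λ j j≤ → none j (≤-trans j≤ (m≤m⊔n u v)))
                               (apply-none ⟦_⟧ v λ j j≤ → none j (≤-trans j≤ (m≤n⊔m u v)))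

    abstract
      delayed : G
      delayed = mk↔ₛ′ to from to-from from-to , to-colour

      delayed-least : ∀ {i} → Least i → ∀ u → ⟦ delayed ⟧ u ≡ ⟦ r i ⟧ u
      delayed-least = apply-least ⟦_⟧ r-fix

      delayed-fix : ∀ u → (∀ i → ⟦ r i ⟧ u ≡ u) → ⟦ delayed ⟧ u ≡ u
      delayed-fix u fix with search u
      ... | inj₁ (i , _) = fix i
      ... | inj₂ _       = refl

  match? : ∀ x x′ y y′ → Dec (Match cc cc x x′ y y′)
  match? x x′ y y′ = map′ (λ { (f , i , c) → record { fun = f ; inj = i ; col = c } })
    (λ m → Match.fun m , Match.inj m , Match.col m)
    (((x ≟ x′) →-dec (y ≟ y′)) ×-dec ((y ≟ y′) →-dec (x ≟ x′)) ×-dec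
      (¬? (x ≟ x′) →-dec (cc y y′ Fin.≟ cc x x′)))

  PI? : ∀ L → Dec (PI L)
  PI? L = map′ (λ a p q → All.lookup (All.lookup a p) q) (λ pi → All.tabulate λ p → All.tabulate λ q → pi p q)
    (all? (λ p → all? (λ q → match? (proj₁ p) (proj₁ q) (proj₂ p) (proj₂ q)) L) L)

  module Dense (n : ℕ) where
    open MixingElement (mixing n)

    len : ℕ → ℕ
    len i = proj₁ (unpair i)

    target : ℕ → ℕ → ℕ
    target i = decode (proj₂ (unpair i))

    window : ℕ → ℕ
    window i = (n ⊔ i) ⊔ (len i ⊔ bound (target i) (upTo (len i)))

    exponent : ℕ → ℕ
    exponent i = proj₁ (mix (window i))

    -- The index i codes a finite map x ↦ `target i x`. A power of `t` carries its graph away from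
    -- the points below `n ⊔ i`, which `r i` is to fix. Thus `r i` tends to the identity, while its
    -- conjugate by that power still realises the coded map.
    stay go : ℕ → List (ℕ × ℕ)
    stay i = map (λ x → x , x) (upTo (n ⊔ i))
    go i   = map (λ x → ⟦ power (exponent i) ⟧ x , ⟦ power (exponent i) ⟧ (target i x)) (upTo (len i))

    task : ∀ i → Dec (PI (stay i ++ go i)) → Σ G λ r → ∀ u → u < n ⊔ i → ⟦ r ⟧ u ≡ u
    task i (yes pi) = proj₁ (fromPI _ pi) , λ u u< → proj₂ (fromPI _ pi) (∈-++⁺ˡ (∈-map⁺ (λ x → x , x) (∈-upTo⁺ u<)))
    task i (no _)   = idG , λ _ _ → refl

    r : ℕ → G
    r i = proj₁ (task i (PI? (stay i ++ go i)))

    r-fix : ∀ i u → u < n ⊔ i → ⟦ r i ⟧ u ≡ u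
    r-fix i = proj₂ (task i (PI? (stay i ++ go i)))

    r-go : ∀ i → PI (stay i ++ go i) → ∀ x → x < len i →
      ⟦ r i ⟧ (⟦ power (exponent i) ⟧ x) ≡ ⟦ power (exponent i) ⟧ (target i x)
    r-go i pi x x< with PI? (stay i ++ go i)
    ... | yes pi′ = proj₂ (fromPI _ pi′) (∈-++⁺ʳ (stay i) (∈-map⁺ _ (∈-upTo⁺ x<)))
    ... | no ¬pi  = contradiction (λ {x} {y} {x′} {y′} → pi {x} {y} {x′} {y′}) ¬pi

    module Approximate (h : G) (h-fix : ∀ u → u < n → ⟦ h ⟧ u ≡ u) (B : ℕ) where
      i : ℕ
      i = pair B (encode B ⟦ h ⟧)

      T : G
      T = power (exponent i)

      len-i : len i ≡ B
      len-i = cong proj₁ (unpair-pair B (encode B ⟦ h ⟧))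

      target-i : ∀ x → x < len i → target i x ≡ ⟦ h ⟧ x
      target-i x x< = trans (cong (λ p → decode (proj₂ p) x) (unpair-pair B (encode B ⟦ h ⟧)))
        (decode-encode B ⟦ h ⟧ x (subst (x <_) len-i x<))

      mixed : ∀ u v → n ≤ u → n ≤ v → u < window i → v < window i → ⟦ T ⟧ u ≢ v × cc (⟦ T ⟧ u) v ≡ red
      mixed = proj₂ (mix (window i))

      small : ∀ {x} → x < n ⊔ i → x < window i
      small x< = <-≤-trans x< (m≤m⊔n (n ⊔ i) _)

      source : ∀ {x} → x < len i → x < window i
      source x< = <-≤-trans x< (≤-trans (m≤m⊔n (len i) _) (m≤n⊔m (n ⊔ i) _))

      image : ∀ {x} → x < len i → ⟦ h ⟧ x < window i
      image {x} x< = <-≤-trans (subst (_< bound (target i) (upTo (len i))) (target-i x x<) (bound-∈ (target i) (∈-upTo⁺ x<)))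
        (≤-trans (m≤n⊔m (len i) _) (m≤n⊔m (n ⊔ i) _))

      h-≥ : ∀ {x} → n ≤ x → n ≤ ⟦ h ⟧ x
      h-≥ {x} n≤x = ≮⇒≥ λ hx<n → <⇒≱ (subst (_< n) (⟦⟧-injective h (h-fix _ hx<n)) hx<n) n≤x

      -- Away from the fixed points T moves the graph of h so far that the points below n ⊔ i are red to it.
      stay-go : ∀ {x u} → x < n ⊔ i → u < len i → Match cc cc x (⟦ T ⟧ u) x (⟦ T ⟧ (⟦ h ⟧ u))
      stay-go {x} {u} x< u< with u <? n
      ... | yes u<n = record
        { fun = λ e → trans e (cong ⟦ T ⟧ (sym (h-fix u u<n)))
        ; inj = λ e → trans e (cong ⟦ T ⟧ (h-fix u u<n))
        ; col = λ _ → cong (λ v → cc x (⟦ T ⟧ v)) (h-fix u u<n) }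
      ... | no ¬u<n with x <? n
      ...   | yes x<n = record
        { fun = λ e → contradiction (⟦⟧-injective T (trans (power-fix _ x x<n) e)) (≢u x<n)
        ; inj = λ e → contradiction (⟦⟧-injective T (trans (power-fix _ x x<n) e)) (≢h x<n)
        ; col = λ _ → trans (T-col (⟦ h ⟧ u) (≢h x<n)) (trans (trans (cong (λ y → cc y (⟦ h ⟧ u)) (sym (h-fix x x<n)))
                        (⟦⟧-colour h x u (≢u x<n))) (sym (T-col u (≢u x<n)))) }
        where
        ≢u : x < n → x ≢ u
        ≢u x<n refl = ¬u<n x<n
        ≢h : x < n → x ≢ ⟦ h ⟧ u
        ≢h x<n refl = <⇒≱ x<n (h-≥ (≮⇒≥ ¬u<n))
        T-col : ∀ v → x ≢ v → cc x (⟦ T ⟧ v) ≡ cc x v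
        T-col v n = trans (cong (λ y → cc y (⟦ T ⟧ v)) (sym (power-fix _ x x<n))) (⟦⟧-colour T x v n)
      ...   | no ¬x<n = record
        { fun = λ e → contradiction (sym e) (proj₁ near)
        ; inj = λ e → contradiction (sym e) (proj₁ far)
        ; col = λ _ → trans (cc-sym _ _) (trans (proj₂ far) (trans (sym (proj₂ near)) (cc-sym _ _))) }
        where
        near = mixed u x (≮⇒≥ ¬u<n) (≮⇒≥ ¬x<n) (source u<) (small x<)
        far  = mixed (⟦ h ⟧ u) x (h-≥ (≮⇒≥ ¬u<n)) (≮⇒≥ ¬x<n) (image u<) (small x<)

      stay⁻ : ∀ {p} → p ∈ stay i → ∃ λ x → x < n ⊔ i × p ≡ (x , x)
      stay⁻ p∈ with ∈-map⁻ (λ x → x , x) p∈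
      ... | x , x∈ , e = x , ∈-upTo⁻ x∈ , e

      go⁻ : ∀ {p} → p ∈ go i → ∃ λ x → x < len i × p ≡ (⟦ T ⟧ x , ⟦ T ⟧ (⟦ h ⟧ x))
      go⁻ p∈ with ∈-map⁻ (λ x → ⟦ T ⟧ x , ⟦ T ⟧ (target i x)) p∈
      ... | x , x∈ , e = x , ∈-upTo⁻ x∈ , trans e (cong (λ y → ⟦ T ⟧ x , ⟦ T ⟧ y) (target-i x (∈-upTo⁻ x∈)))

      go-go : ∀ x y → Match cc cc (⟦ T ⟧ x) (⟦ T ⟧ y) (⟦ T ⟧ (⟦ h ⟧ x)) (⟦ T ⟧ (⟦ h ⟧ y))
      go-go x y = record
        { fun = λ e → cong (⟦ T ⟧ ∘ ⟦ h ⟧) (⟦⟧-injective T e)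
        ; inj = λ e → cong ⟦ T ⟧ (⟦⟧-injective (T ∘G h) e)
        ; col = λ n → trans (⟦⟧-colour (T ∘G h) x y (n ∘ cong ⟦ T ⟧)) (sym (⟦⟧-colour T x y (n ∘ cong ⟦ T ⟧))) }

      is-pi : PI (stay i ++ go i)
      is-pi p q with ∈-++⁻ (stay i) p | ∈-++⁻ (stay i) q
      ... | inj₁ p | inj₁ q with stay⁻ p | stay⁻ q
      ...   | x , _ , refl | y , _ , refl = record { fun = id ; inj = id ; col = λ _ → refl }
      is-pi p q | inj₁ p′ | inj₂ q′ with stay⁻ p′ | go⁻ q′
      ...   | x , x< , refl | u , u< , refl = stay-go x< u<
      is-pi p q | inj₂ p′ | inj₁ q′ with go⁻ p′ | stay⁻ q′
      ...   | u , u< , refl | x , x< , refl = flip-match (stay-go x< u<)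
      is-pi p q | inj₂ p′ | inj₂ q′ with go⁻ p′ | go⁻ q′
      ...   | u , _ , refl | v , _ , refl = go-go u v

      approximates : ∀ u → u < B → ⟦ inv T ∘G r i ∘G T ⟧ u ≡ ⟦ h ⟧ u
      approximates u u<B = trans (cong ⟦ T ⟧⁻ (trans (r-go i is-pi u u<len) (cong ⟦ T ⟧ (target-i u u<len)))) (⟦⟧⁻-⟦⟧ T _)
        where
        u<len : u < len i
        u<len = subst (u <_) (sym len-i) u<B

  module _ (𝒜 : Action) where
    open Action 𝒜

    FixedBelow : ℕ → G → Set
    FixedBelow n h = ∀ u → u < n → ⟦ h ⟧ u ≡ u

    module Tests (w n : ℕ) where
      open MixingElement (mixing n) using (t; power; power-generated; power-fix)
      open Dense n

      open Delay (λ i → act (r i) w ≢ w) (λ i → ¬? (act (r i) w ≟ w)) r (λ i u u<i → r-fix i u (<-≤-trans u<i (m≤n⊔m n i)))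

      Passed : Set
      Passed = act t w ≡ w × act delayed w ≡ w

      passed? : Dec Passed
      passed? = (act t w ≟ w) ×-dec (act delayed w ≟ w)

      delayed-below : FixedBelow n delayed
      delayed-below u u<n = delayed-fix u λ i → r-fix i u (<-≤-trans u<n (m≤m⊔n n i))

      -- If some `r i` moved w, then `delayed` would agree with the least such one and move w too. A
      -- single evaluation thus controls the whole sequence.
      passed-r : Passed → ∀ i → act (r i) w ≡ w
      passed-r (_ , d) i with search i
      ... | inj₁ (j , _ , l) = contradiction (trans (sym (act-cong delayed (r j) (delayed-least l) w)) d) (proj₁ l)
      ... | inj₂ none        = decidable-stable (act (r i) w ≟ w) (none i ≤-refl)

      passed-power : Passed → ∀ N → act (power N) w ≡ w
      passed-power (p , _) = power-generated (λ g → act g w ≡ w)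
        (λ {g} {h} e q → trans (sym (act-cong g h e w)) q) (act-id w)
        (λ {g} {h} p q → trans (act-∘ g h w) (trans (cong (act g) q) p)) p

      abstract
        -- The words approximating h are products of elements fixing w. If h moved w, the elements
        -- h⁻¹ · `word B` would move w as well, although they fix everything below B.
        passed⇒fixes : Passed → ∀ h → FixedBelow n h → act h w ≡ w
        passed⇒fixes passed h h-fix = decidable-stable (act h w ≟ w) λ moves →
          no-small-moves 𝒜 w (λ B → inv h ∘G word B)
            (λ B u u<B → trans (cong ⟦ h ⟧⁻ (Approximate.approximates h h-fix B u u<B)) (⟦⟧⁻-⟦⟧ h u))
            (λ B e → moves (trans (cong (act h) (sym (trans (sym (cong (act (inv h)) (word-fix B)))
              (trans (sym (act-∘ (inv h) (word B) w)) e)))) (act-inv′ h w)))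
          where
          word : ℕ → G
          word B = inv (power (exponent (Approximate.i h h-fix B))) ∘G r (Approximate.i h h-fix B) ∘G power (exponent (Approximate.i h h-fix B))
          word-fix : ∀ B → act (word B) w ≡ w
          word-fix B = trans (act-∘ (inv T) (r i ∘G T) w) (trans (cong (act (inv T)) (trans (act-∘ (r i) T w)
              (trans (cong (act (r i)) (passed-power passed _)) (passed-r passed i))))
            (trans (cong (act (inv T)) (sym (passed-power passed (exponent i)))) (act-inv T w)))
            where open Approximate h h-fix B using (i; T)

      witness : Dec (act t w ≡ w) → G
      witness (no _)  = t
      witness (yes _) = delayed

      e : G
      e = witness (act t w ≟ w)

    e-below : ∀ w n → FixedBelow n (Tests.e w n)
    e-below w n u u<n with Action.act 𝒜 (MixingElement.t (mixing n)) w ≟ w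
    ... | yes _ = Tests.delayed-below w n u u<n
    ... | no _  = MixingElement.t-fix (mixing n) u u<n

    e-moves : ∀ w n → ¬ Tests.Passed w n → act (Tests.e w n) w ≢ w
    e-moves w n ¬passed with act (MixingElement.t (mixing n)) w ≟ w
    ... | yes p = λ q → ¬passed (p , q)
    ... | no ¬p = ¬p

    abstract
      -- If the test failed for every n, the elements `Tests.e w n` would fix 0, ..., n - 1 and all
      -- move w.
      small-index : ∀ w → ¬ ¬ (∃ λ n → ∀ h → FixedBelow n h → act h w ≡ w)
      small-index w none = no-small-moves 𝒜 w (Tests.e w) (e-below w)
        λ n → e-moves w n λ passed → none (n , Tests.passed⇒fixes w n passed)

-- Finite supports and their intersections

module Supports (k : ℕ) (c : Colouring (suc k) ℕ) (ext : Extension (Colouring.col c)) where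
  open Automorphisms k c ext
  open Actions k c ext

  Fixes : List ℕ → G → Set
  Fixes A h = ∀ {u} → u ∈ A → ⟦ h ⟧ u ≡ u

  record Displacement (F : List ℕ) (N M : ℕ) : Set where
    field
      y     : G
      fixes : Fixes F y
      far   : ∀ a → a < N → a ∉ F → M ≤ ⟦ y ⟧ a
      reds  : ∀ a → a < N → a ∉ F → ∀ x → x < M → x ∉ F → cc (⟦ y ⟧ a) x ≡ red

  module _ (F : List ℕ) (M : ℕ) where
    private
      open Extend _≟_ _≟_ cc cc cc-sym cc-sym ext

      -- The field `ran` keeps the points below `M` and outside `F` out of the range, so the colours
      -- from the next image to them are still free to be made `red`.
      record Partial (b : ℕ) : Set where
        field
          L    : List (ℕ × ℕ)
          isPI : PI L
          stay : ∀ {u} → u ∈ F → (u , u) ∈ L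
          dom  : ∀ {x y} → (x , y) ∈ L → x ∈ F ⊎ x < b
          ran  : ∀ {x y} → (x , y) ∈ L → y ∈ F ⊎ M ≤ y
          go   : ∀ a → a < b → a ∉ F → ∃ λ y → (a , y) ∈ L × M ≤ y × (∀ x → x < M → x ∉ F → cc y x ≡ red)

      diagonal : ∀ {x y} → (x , y) ∈ map (λ u → u , u) F → x ∈ F × x ≡ y
      diagonal p with ∈-map⁻ (λ u → u , u) p
      ... | u , u∈ , refl = u∈ , refl

      partial : ∀ b → Partial b
      partial zero = record
        { L = map (λ u → u , u) F
        ; isPI = λ p q → record
          { fun = λ e → trans (sym (proj₂ (diagonal p))) (trans e (proj₂ (diagonal q)))
          ; inj = λ e → trans (proj₂ (diagonal p)) (trans e (sym (proj₂ (diagonal q))))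
          ; col = λ _ → sym (cong₂ cc (proj₂ (diagonal p)) (proj₂ (diagonal q))) }
        ; stay = ∈-map⁺ (λ u → u , u)
        ; dom = λ p → inj₁ (proj₁ (diagonal p))
        ; ran = λ p → inj₁ (subst (_∈ F) (proj₂ (diagonal p)) (proj₁ (diagonal p)))
        ; go = λ _ () }
      partial (suc b) with partial b | b ∈? F
      ... | P | yes b∈ = record { Partial P ; dom = λ p → weaken (P.dom p) ; go = λ a a< → go a (m≤n⇒m<n∨m≡n a<) }
        where
        module P = Partial P
        weaken : ∀ {x} → x ∈ F ⊎ x < b → x ∈ F ⊎ x < suc b
        weaken (inj₁ p) = inj₁ p
        weaken (inj₂ p) = inj₂ (m≤n⇒m≤1+n p)
        go : ∀ a → suc a < suc b ⊎ suc a ≡ suc b → a ∉ F →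
          ∃ λ y → (a , y) ∈ P.L × M ≤ y × (∀ x → x < M → x ∉ F → cc y x ≡ red)
        go a (inj₁ (s≤s p)) = P.go a p
        go a (inj₂ refl) a∉ = contradiction b∈ a∉
      ... | P | no b∉ = record
        { L = (b , E.image) ∷ P.L ; isPI = E.isPI ; stay = there ∘ P.stay
        ; dom = λ { (here refl) → inj₂ ≤-refl ; (there p) → weaken (P.dom p) }
        ; ran = λ { (here refl) → inj₂ M≤ ; (there p) → P.ran p }
        ; go = λ a a< → go a (m≤n⇒m<n∨m≡n a<) }
        where
        module P = Partial P
        not-dom : ∀ {x} → x ∈ F ⊎ x < b → x ≢ b
        not-dom (inj₁ p) refl = b∉ p
        not-dom (inj₂ p) refl = <-irrefl refl p
        module E = Fresh (extend-fresh P.L P.isPI b (λ p → not-dom (P.dom p) refl) (upTo M) (λ _ → red))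
        M≤ : M ≤ E.image
        M≤ = ≮⇒≥ λ <M → E.fresh (∈-upTo⁺ <M) refl
        weaken : ∀ {x} → x ∈ F ⊎ x < b → x ∈ F ⊎ x < suc b
        weaken (inj₁ p) = inj₁ p
        weaken (inj₂ p) = inj₂ (m≤n⇒m≤1+n p)
        not-ran : ∀ {x} → x < M → x ∉ F → x ∈ F ⊎ M ≤ x → ⊥
        not-ran x<M x∉ (inj₁ p) = x∉ p
        not-ran x<M x∉ (inj₂ p) = <⇒≱ x<M p
        go : ∀ a → suc a < suc b ⊎ suc a ≡ suc b → a ∉ F →
          ∃ λ y → (a , y) ∈ (b , E.image) ∷ P.L × M ≤ y × (∀ x → x < M → x ∉ F → cc y x ≡ red)
        go a (inj₁ (s≤s p)) a∉ with P.go a p a∉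
        ... | y , y∈ , rest = y , there y∈ , rest
        go a (inj₂ refl) a∉ = E.image , here refl , M≤ ,
          λ x x<M x∉ → E.colour (∈-upTo⁺ x<M) (λ p → not-ran x<M x∉ (P.ran p))

    abstract
      displace : ∀ N → Displacement F N M
      displace N = record
        { y = y
        ; fixes = λ u∈ → y-∈ (P.stay u∈)
        ; far = λ a a< a∉ → subst (M ≤_) (sym (y-∈ (proj₁ (proj₂ (P.go a a< a∉))))) (proj₁ (proj₂ (proj₂ (P.go a a< a∉))))
        ; reds = λ a a< a∉ x x<M x∉ → trans (cong (λ y → cc y x) (y-∈ (proj₁ (proj₂ (P.go a a< a∉)))))
            (proj₂ (proj₂ (proj₂ (P.go a a< a∉))) x x<M x∉) }
        where
        module P = Partial (partial N)
        y : G
        y = proj₁ (fromPI P.L P.isPI)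
        y-∈ : ∀ {a b} → (a , b) ∈ P.L → ⟦ y ⟧ a ≡ b
        y-∈ = proj₂ (fromPI P.L P.isPI)

  module _ (𝒜 : Action) where
    open Action 𝒜

    _Supports_ : List ℕ → ℕ → Set
    A Supports w = ∀ h → Fixes A h → act h w ≡ w

    conjugate-fixes : ∀ y g {w} → act (inv y ∘G g ∘G y) w ≡ w → act g (act y w) ≡ act y w
    conjugate-fixes y g {w} e = trans (sym (act-inv′ y _)) (cong (act y) (trans
      (trans (cong (act (inv y)) (sym (act-∘ g y w))) (sym (act-∘ (inv y) (g ∘G y) w))) e))

    supports-translate : ∀ {A w} → A Supports w → ∀ g → act g w ≡ w → map ⟦ g ⟧⁻ A Supports w
    supports-translate {A} {w} S g gw h h-fix = trans (sym (cong (act h) g⁻w)) (trans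
        (conjugate-fixes (inv g) h (S (inv (inv g) ∘G h ∘G inv g) λ {u} u∈ →
          trans (cong ⟦ g ⟧ (h-fix (∈-map⁺ ⟦ g ⟧⁻ u∈))) (⟦⟧-⟦⟧⁻ g u))) g⁻w)
      where
      g⁻w : act (inv g) w ≡ w
      g⁻w = trans (cong (act (inv g)) (sym gw)) (act-inv g w)

    module Intersection {A A′ : List ℕ} {w : ℕ} (S : A Supports w) (S′ : A′ Supports w)
                        (h : G) (h-fix : Fixes (filter (_∈? A′) A) h) where

      h-∩ : ∀ {a} → a ∈ A → a ∈ A′ → ⟦ h ⟧ a ≡ a
      h-∩ a∈ a∈′ = h-fix (∈-filter⁺ (_∈? A′) a∈ a∈′)

      N N₁ : ℕ
      N  = bound id A
      -- Beyond both A′ and its preimage under h, so that for a in A outside A′ neither `y₂ a` nor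
      -- its image under h falls into A′, where `reds` would say nothing.
      N₁ = bound id A′ ⊔ bound ⟦ h ⟧⁻ A′

      module Y₂ = Displacement (displace A′ N₁ N)
      y₂ : ℕ → ℕ
      y₂ = ⟦ Y₂.y ⟧

      N₂ : ℕ
      N₂ = bound y₂ A ⊔ bound (⟦ h ⟧ ∘ y₂) A

      module Y₁ = Displacement (displace A′ N₂ N)
      y₁ : ℕ → ℕ
      y₁ = ⟦ Y₁.y ⟧

      y₂∉ : ∀ {a} → a ∈ A → a ∉ A′ → y₂ a ∉ A′
      y₂∉ a∈ a∉ p = <⇒≱ (<-≤-trans (bound-∈ id p) (m≤m⊔n _ (bound ⟦ h ⟧⁻ A′))) (Y₂.far _ (bound-∈ id a∈) a∉)

      hy₂∉ : ∀ {a} → a ∈ A → a ∉ A′ → ⟦ h ⟧ (y₂ a) ∉ A′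
      hy₂∉ {a} a∈ a∉ p = <⇒≱ (<-≤-trans (subst (_< bound ⟦ h ⟧⁻ A′) (⟦⟧⁻-⟦⟧ h (y₂ a)) (bound-∈ ⟦ h ⟧⁻ p))
        (m≤n⊔m (bound id A′) _)) (Y₂.far _ (bound-∈ id a∈) a∉)

      y₂< : ∀ {a} → a ∈ A → y₂ a < N₂
      y₂< a∈ = <-≤-trans (bound-∈ y₂ a∈) (m≤m⊔n _ (bound (⟦ h ⟧ ∘ y₂) A))

      hy₂< : ∀ {a} → a ∈ A → ⟦ h ⟧ (y₂ a) < N₂
      hy₂< a∈ = <-≤-trans (bound-∈ (⟦ h ⟧ ∘ y₂) a∈) (m≤n⊔m (bound y₂ A) _)

      along-h : ∀ x y → Match cc cc x y (⟦ h ⟧ x) (⟦ h ⟧ y)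
      along-h x y = record { fun = cong ⟦ h ⟧ ; inj = ⟦⟧-injective h ; col = ⟦⟧-colour h x y }

      along-id : ∀ x y → Match cc cc x y x y
      along-id x y = record { fun = id ; inj = id ; col = λ _ → refl }

      -- If a is in A′, then `y₁ a` is a itself and is fixed by h; if b is in A′, then `y₂ b` is b,
      -- again fixed by h. Otherwise `y₁ a` is red to everything concerned.
      cross : ∀ {a b} → a ∈ A → b ∈ A → Match cc cc (y₁ a) (y₂ b) (y₁ a) (⟦ h ⟧ (y₂ b))
      cross {a} {b} a∈ b∈ with a ∈? A′ | b ∈? A′
      ... | yes a∈′ | _ = subst (λ x → Match cc cc x (y₂ b) x (⟦ h ⟧ (y₂ b))) (sym (Y₁.fixes a∈′))
              (subst (λ x → Match cc cc a (y₂ b) x (⟦ h ⟧ (y₂ b))) (h-∩ a∈ a∈′) (along-h a (y₂ b)))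
      ... | no _ | yes b∈′ = subst (λ x → Match cc cc (y₁ a) (y₂ b) (y₁ a) x)
              (trans (Y₂.fixes b∈′) (trans (sym (h-∩ b∈ b∈′)) (cong ⟦ h ⟧ (sym (Y₂.fixes b∈′))))) (along-id (y₁ a) (y₂ b))
      ... | no a∉ | no b∉ = record
        { fun = λ e → contradiction (subst (_< N₂) (sym e) (y₂< b∈)) (≤⇒≯ far)
        ; inj = λ e → contradiction (subst (_< N₂) (sym e) (hy₂< b∈)) (≤⇒≯ far)
        ; col = λ _ → trans (reds _ (hy₂< b∈) (hy₂∉ b∈ b∉)) (sym (reds _ (y₂< b∈) (y₂∉ b∈ b∉))) }
        where
        far : N₂ ≤ y₁ a
        far = Y₁.far a (bound-∈ id a∈) a∉
        reds : ∀ x → x < N₂ → x ∉ A′ → cc (y₁ a) x ≡ red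
        reds = Y₁.reds a (bound-∈ id a∈) a∉

      stay go : List (ℕ × ℕ)
      stay = map (λ a → y₁ a , y₁ a) A
      go   = map (λ a → y₂ a , ⟦ h ⟧ (y₂ a)) A

      is-pi : PI (stay ++ go)
      is-pi p q with ∈-++⁻ stay p | ∈-++⁻ stay q
      ... | inj₁ p′ | inj₁ q′ with ∈-map⁻ (λ a → y₁ a , y₁ a) p′ | ∈-map⁻ (λ a → y₁ a , y₁ a) q′
      ...   | a , a∈ , refl | b , b∈ , refl = along-id (y₁ a) (y₁ b)
      is-pi p q | inj₁ p′ | inj₂ q′ with ∈-map⁻ (λ a → y₁ a , y₁ a) p′ | ∈-map⁻ (λ a → y₂ a , ⟦ h ⟧ (y₂ a)) q′
      ...   | a , a∈ , refl | b , b∈ , refl = cross a∈ b∈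
      is-pi p q | inj₂ p′ | inj₁ q′ with ∈-map⁻ (λ a → y₂ a , ⟦ h ⟧ (y₂ a)) p′ | ∈-map⁻ (λ a → y₁ a , y₁ a) q′
      ...   | b , b∈ , refl | a , a∈ , refl = flip-match (cross a∈ b∈)
      is-pi p q | inj₂ p′ | inj₂ q′ with ∈-map⁻ (λ a → y₂ a , ⟦ h ⟧ (y₂ a)) p′ | ∈-map⁻ (λ a → y₂ a , ⟦ h ⟧ (y₂ a)) q′
      ...   | a , a∈ , refl | b , b∈ , refl = along-h (y₂ a) (y₂ b)

      -- h = g (g⁻¹h), where g fixes a copy of A over A′ and g⁻¹h fixes another one.
      g : G
      g = proj₁ (fromPI (stay ++ go) is-pi)

      g-stay : ∀ {a} → a ∈ A → ⟦ g ⟧ (y₁ a) ≡ y₁ a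
      g-stay a∈ = proj₂ (fromPI (stay ++ go) is-pi) (∈-++⁺ˡ (∈-map⁺ (λ a → y₁ a , y₁ a) a∈))

      g-go : ∀ {a} → a ∈ A → ⟦ g ⟧ (y₂ a) ≡ ⟦ h ⟧ (y₂ a)
      g-go a∈ = proj₂ (fromPI (stay ++ go) is-pi) (∈-++⁺ʳ stay (∈-map⁺ (λ a → y₂ a , ⟦ h ⟧ (y₂ a)) a∈))

      fixes-copy : ∀ y → Fixes A′ y → ∀ g → (∀ {a} → a ∈ A → ⟦ g ⟧ (⟦ y ⟧ a) ≡ ⟦ y ⟧ a) → act g w ≡ w
      fixes-copy y y-fix g e = trans (cong (act g) (sym (S′ y y-fix))) (trans
        (conjugate-fixes y g (S (inv y ∘G g ∘G y) λ a∈ → trans (cong ⟦ y ⟧⁻ (e a∈)) (⟦⟧⁻-⟦⟧ y _))) (S′ y y-fix))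

      result : act h w ≡ w
      result = trans (sym (act-inv′ g _)) (trans (cong (act g) (trans (sym (act-∘ (inv g) h w))
          (fixes-copy Y₂.y Y₂.fixes (inv g ∘G h) λ a∈ → trans (cong ⟦ g ⟧⁻ (sym (g-go a∈))) (⟦⟧⁻-⟦⟧ g _))))
        (fixes-copy Y₁.y Y₁.fixes g g-stay))

    supports-∩ : ∀ {A A′ w} → A Supports w → A′ Supports w → filter (_∈? A′) A Supports w
    supports-∩ S S′ h h-fix = Intersection.result S S′ h h-fix

    record MinimalSupport (w : ℕ) : Set where
      field
        A        : List ℕ
        supports : A Supports w
        minimal  : ∀ {A′} → A′ Supports w → length A ≤ length A′

      -- Were a missing from A′, filtering A by A′ would give a strictly shorter support.
      least : ∀ {A′ a} → A′ Supports w → a ∈ A → a ∈ A′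
      least {A′} {a} S′ a∈ with a ∈? A′
      ... | yes p = p
      ... | no ¬p = contradiction (minimal (supports-∩ supports S′))
                      (<⇒≱ (filter-notAll (_∈? A′) A (lose a∈ ¬p)))

      -- The preimage of A under g supports w too, hence contains A by `least`.
      invariant : ∀ g {a} → act g w ≡ w → a ∈ A → ⟦ g ⟧ a ∈ A
      invariant g gw a∈ with ∈-map⁻ ⟦ g ⟧⁻ (least (supports-translate supports g gw) a∈)
      ... | a′ , a′∈ , refl = subst (_∈ A) (sym (⟦⟧-⟦⟧⁻ g a′)) a′∈

    open SmallIndex k c ext using (small-index)

    abstract
      -- Descent on the length. Whether a shorter support exists is not decided, so minimality is
      -- reached under double negation.
      minimal-support : ∀ w → ¬ ¬ MinimalSupport w
      minimal-support w none = small-index 𝒜 w λ { (n , fixed) → descend (suc n) (upTo n) (s≤s (≤-reflexive (length-upTo n)))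
          (λ h h-fix → fixed h λ u u<n → h-fix (∈-upTo⁺ u<n)) }
        where
        descend : ∀ n A → length A < n → A Supports w → ⊥
        descend (suc n) A (s≤s len≤) S = none (record { A = A ; supports = S ; minimal = λ {A′} S′ →
          ≮⇒≥ λ shorter → descend n A′ (<-≤-trans shorter len≤) S′ })

-- Recovering the vertex permutation from an automorphism of the group

module Reconstruction (k : ℕ) (c : Colouring (suc k) ℕ) (ext : Extension (Colouring.col c)) where
  open Automorphisms k c ext
  open Actions k c ext
  open Mix k c ext
  open SmallIndex k c ext
  open Supports k c ext

  -- Each displacement starts beyond the images of A under all earlier ones. The purpose is that no
  -- quotient of two members with i < j sends a into A.
  spread : ∀ F A a → a ∉ F → Σ (ℕ → G) λ g → (∀ i → Fixes F (g i)) ×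
    (∀ {i j a′} → i < j → a′ ∈ A → ⟦ g i ⟧ a′ < ⟦ g j ⟧ a)
  spread F A a a∉ = D.y ∘ level , (λ i → D.fixes (level i)) ,
    λ {i} {j} i<j a′∈ → <-≤-trans (<-≤-trans (bound-∈ ⟦ D.y (level i) ⟧ a′∈) (≤-trans (m≤n⊔m (level i) _) (level-mono i<j)))
      (D.far (level j) a (n<1+n a) a∉)
    where
    module D (M : ℕ) = Displacement (displace F M (suc a))
    level : ℕ → ℕ
    level zero    = 0
    level (suc i) = level i ⊔ bound ⟦ D.y (level i) ⟧ A
    level-mono′ : ∀ {i j} → i ≤′ j → level i ≤ level j
    level-mono′ (≤′-reflexive refl) = ≤-refl
    level-mono′ (≤′-step p) = ≤-trans (level-mono′ p) (m≤m⊔n _ _)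
    level-mono : ∀ {i j} → i ≤ j → level i ≤ level j
    level-mono = level-mono′ ∘ ≤⇒≤′

  mover-of : ∀ F a → a ∉ F → Σ G λ y → Fixes F y × ⟦ y ⟧ a ≢ a
  mover-of F a a∉ = D.y , D.fixes , λ e → <⇒≱ (n<1+n a) (subst (suc a ≤_) e (D.far a (n<1+n a) a∉))
    where module D = Displacement (displace F (suc a) (suc a))

  record Automorphism : Set where
    field
      φ ψ    : G → G
      φ-cong : ∀ g h → (∀ u → ⟦ g ⟧ u ≡ ⟦ h ⟧ u) → ∀ u → ⟦ φ g ⟧ u ≡ ⟦ φ h ⟧ u
      ψ-cong : ∀ g h → (∀ u → ⟦ g ⟧ u ≡ ⟦ h ⟧ u) → ∀ u → ⟦ ψ g ⟧ u ≡ ⟦ ψ h ⟧ u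
      φ-∘    : ∀ h g u → ⟦ φ (h ∘G g) ⟧ u ≡ ⟦ φ h ⟧ (⟦ φ g ⟧ u)
      ψ-∘    : ∀ h g u → ⟦ ψ (h ∘G g) ⟧ u ≡ ⟦ ψ h ⟧ (⟦ ψ g ⟧ u)
      φψ     : ∀ g u → ⟦ φ (ψ g) ⟧ u ≡ ⟦ g ⟧ u
      ψφ     : ∀ g u → ⟦ ψ (φ g) ⟧ u ≡ ⟦ g ⟧ u

  reverse : Automorphism → Automorphism
  reverse Φ = record { φ = ψ ; ψ = φ ; φ-cong = ψ-cong ; ψ-cong = φ-cong ; φ-∘ = ψ-∘ ; ψ-∘ = φ-∘ ; φψ = ψφ ; ψφ = φψ }
    where open Automorphism Φ

  singleton-PI : ∀ {a b} → PI ((a , b) ∷ [])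
  singleton-PI (here refl) (here refl) = record { fun = λ _ → refl ; inj = λ _ → refl ; col = λ n → contradiction refl n }

  carry : ∀ a b → Σ G λ σ → ⟦ σ ⟧ a ≡ b
  carry a b = proj₁ (fromPI _ singleton-PI) , proj₂ (fromPI ((a , b) ∷ []) singleton-PI) (here refl)

  action : Automorphism → Action
  action Φ = record
    { act = λ g → ⟦ φ g ⟧ ; act-cong = φ-cong ; act-∘ = φ-∘
    ; transitive = λ w j → ψ (proj₁ (carry w j)) , trans (φψ _ w) (proj₂ (carry w j)) }
    where open Automorphism Φ

  module _ (Φ : Automorphism) where
    open Automorphism Φ
    private
      𝒜 = action Φ
      ℬ = action (reverse Φ)
    open Action 𝒜

    Stabilises : ℕ → ℕ → Set
    Stabilises v w = ∀ g → ⟦ g ⟧ v ≡ v → act g w ≡ w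

    module _ (v w : ℕ) (B : MinimalSupport ℬ v) (w∈ : w ∈ MinimalSupport.A B) (A : MinimalSupport 𝒜 w) where
      private
        module A = MinimalSupport A
        module B = MinimalSupport B

      -- As ψ undoes φ, the element `φ g` fixes v in the action through ψ, so it preserves the
      -- minimal support of v for that action.
      B-invariant : ∀ g → ⟦ g ⟧ v ≡ v → act g w ∈ B.A
      B-invariant g gv = B.invariant (φ g) (trans (ψφ g v) gv) w∈

      -- The stabiliser of v has only finitely many translates of w, hence of the support of w.
      support-≡ : ∀ {a} → a ∈ A.A → a ≡ v
      support-≡ {a} a∈ = decidable-stable (a ≟ v) λ a≢v → refute (spread (v ∷ []) A.A a (λ { (here e) → a≢v e }))
        where
        refute : (Σ (ℕ → G) λ g → (∀ i → Fixes (v ∷ []) (g i)) × (∀ {i j a′} → i < j → a′ ∈ A.A → ⟦ g i ⟧ a′ < ⟦ g j ⟧ a)) → ⊥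
        refute (g , g-fix , g-far) = collide (Fin.pigeonhole (n<1+n (length B.A)) (λ i → Any.index (gw∈ (toℕ i))))
          where
          gw∈ : ∀ i → act (g i) w ∈ B.A
          gw∈ i = B-invariant (g i) (g-fix i (here refl))
          same : ∀ i j → Any.index (gw∈ i) ≡ Any.index (gw∈ j) → act (g i) w ≡ act (g j) w
          same i j e = trans (lookup-index (gw∈ i)) (trans (cong (List.lookup B.A) e) (sym (lookup-index (gw∈ j))))
          h-fixes : ∀ i j → act (g i) w ≡ act (g j) w → act (inv (g i) ∘G g j) w ≡ w
          h-fixes i j e = trans (act-∘ (inv (g i)) (g j) w) (trans (cong (act (inv (g i))) (sym e)) (act-inv (g i) w))
          collide : (∃ λ i → ∃ λ j → toℕ i < toℕ j × Any.index (gw∈ (toℕ i)) ≡ Any.index (gw∈ (toℕ j))) → ⊥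
          collide (i , j , i<j , e) = <-irrefl (⟦⟧-⟦⟧⁻ (g (toℕ i)) (⟦ g (toℕ j) ⟧ a))
            (g-far i<j (A.invariant (inv (g (toℕ i)) ∘G g (toℕ j)) (h-fixes (toℕ i) (toℕ j) (same (toℕ i) (toℕ j) e)) a∈))

      stabilises : Stabilises v w
      stabilises g gv = A.supports g λ a∈ → subst (λ a → ⟦ g ⟧ a ≡ a) (sym (support-≡ a∈)) gv

    stabilised-point : ∀ v → ¬ ¬ ∃ (Stabilises v)
    stabilised-point v none = minimal-support ℬ v λ B → point B (MinimalSupport.A B) refl
      where
      point : (B : MinimalSupport ℬ v) → ∀ l → MinimalSupport.A B ≡ l → ⊥
      point B (w ∷ l) e = minimal-support 𝒜 w λ A → none (w , stabilises v w B (subst (w ∈_) (sym e) (here refl)) A)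
      -- With an empty support all of G would fix v in the action through ψ, which is transitive.
      point B [] e with mover-of [] v (λ ())
      ... | y , _ , moves = moves (trans (sym (ψφ y v)) (MinimalSupport.supports B (φ y)
              λ u∈ → contradiction (subst (_ ∈_) e u∈) λ ()))

    private module Test (w : ℕ) = Tests 𝒜 w 1

    -- For n = 1 the pointwise stabiliser of 0, ..., n - 1 is that of the vertex 0, so this is a
    -- decidable form of `Stabilises 0 w`.
    Stable : ℕ → Set
    Stable w = Test.Passed w

    zero-fixes : ∀ h → ⟦ h ⟧ 0 ≡ 0 → ∀ u → u < 1 → ⟦ h ⟧ u ≡ u
    zero-fixes h e zero _ = e
    zero-fixes h e (suc u) (s≤s ())

    stable⇒ : ∀ w → Stable w → Stabilises 0 w
    stable⇒ w p h h0 = Test.passed⇒fixes w p h (zero-fixes h h0)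

    ⇒stable : ∀ w → Stabilises 0 w → Stable w
    ⇒stable w s = s _ (MixingElement.t-fix (mixing 1) 0 (s≤s z≤n)) , s _ (Test.delayed-below w 0 (s≤s z≤n))

    -- Since the translates of w by the σ i differ, so do the ψ (σ i) 0, one of which then exceeds w.
    module Escape (w : ℕ) (stable : Stable w) where
      family = spread (upTo w) (w ∷ []) w (λ p → <-irrefl refl (∈-upTo⁻ p))

      σ : ℕ → G
      σ = proj₁ family

      distinct : ∀ {i j} → i < j → ⟦ ψ (σ i) ⟧ 0 ≢ ⟦ ψ (σ j) ⟧ 0
      distinct {i} {j} i<j e = <-irrefl (trans (cong ⟦ σ i ⟧ (sym fixed)) (⟦⟧-⟦⟧⁻ (σ i) _))
          (proj₂ (proj₂ family) i<j (here refl))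
        where
        h : G
        h = inv (σ i) ∘G σ j
        ψh : ⟦ ψ h ⟧ 0 ≡ 0
        ψh = trans (ψ-∘ (inv (σ i)) (σ j) 0) (trans (cong ⟦ ψ (inv (σ i)) ⟧ (sym e)) (Action.act-inv ℬ (σ i) 0))
        fixed : ⟦ h ⟧ w ≡ w
        fixed = trans (sym (φψ h w)) (stable⇒ w stable (ψ h) ψh)

      escape : ∃ λ i → w < ⟦ ψ (σ i) ⟧ 0
      -- The w + 2 vertices examined are distinct and cannot all be at most w.
      escape = decide (Fin.any? {n = suc (suc w)} (λ i → w <? ⟦ ψ (σ (toℕ i)) ⟧ 0))
        where
        decide : Dec (∃ λ (i : Fin (suc (suc w))) → w < ⟦ ψ (σ (toℕ i)) ⟧ 0) → ∃ λ i → w < ⟦ ψ (σ i) ⟧ 0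
        decide (yes (i , p)) = toℕ i , p
        decide (no none)     = collide (Fin.pigeonhole (n<1+n (suc w)) (λ i → fromℕ< (small i)))
          where
          small : ∀ i → ⟦ ψ (σ (toℕ i)) ⟧ 0 < suc w
          small i = s≤s (≮⇒≥ λ p → none (i , p))
          collide : (∃ λ i → ∃ λ j → toℕ i < toℕ j × fromℕ< (small i) ≡ fromℕ< (small j)) → _
          collide (i , j , i<j , e) = contradiction
            (trans (sym (Fin.toℕ-fromℕ< (small i))) (trans (cong toℕ e) (Fin.toℕ-fromℕ< (small j)))) (distinct i<j)

    escaping : ∀ w → Dec (Stable w) → Σ G λ r → (∀ u → u < w → ⟦ r ⟧ u ≡ u) × (Stable w → w < ⟦ ψ r ⟧ 0)
    escaping w (no ¬p) = idG , (λ _ _ → refl) , λ p → contradiction p ¬p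
    escaping w (yes p) = σ (proj₁ escape) , (λ u u<w → proj₁ (proj₂ family) (proj₁ escape) (∈-upTo⁺ u<w)) , λ _ → proj₂ escape
      where open Escape w p

    -- No unbounded search is needed for the point stabilised by the stabiliser of 0: if w is the
    -- least such point then the delayed element moves 0 beyond w.
    private module Wait = Delay Stable (λ w → Test.passed? w) (λ w → proj₁ (escaping w (Test.passed? w)))
                     (λ w → proj₁ (proj₂ (escaping w (Test.passed? w))))

    horizon : ℕ
    horizon = ⟦ ψ Wait.delayed ⟧ 0

    least<horizon : ∀ {w} → Wait.Least w → w < horizon
    least<horizon {w} l = subst (w <_) (sym (ψ-cong _ _ (Wait.delayed-least l) 0))
      (proj₂ (proj₂ (escaping w (Test.passed? w))) (proj₁ l))

    abstract
      base : ∃ (Stabilises 0)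
      base = choose (Wait.search horizon)
        where
        found : ∀ {w} → (∃ λ i → i ≤ w × Wait.Least i) ⊎ (∀ j → j ≤ w → ¬ Stable j) →
          (∀ j → j ≤ horizon → ¬ Stable j) → Stable w → ⊥
        found (inj₁ (i , _ , l)) none _ = none i (<⇒≤ (least<horizon l)) (proj₁ l)
        found (inj₂ none) _ s           = none _ ≤-refl s
        choose : (∃ λ i → i ≤ horizon × Wait.Least i) ⊎ (∀ j → j ≤ horizon → ¬ Stable j) → ∃ (Stabilises 0)
        choose (inj₁ (w , _ , l)) = w , stable⇒ w (proj₁ l)
        -- A stable point anywhere would give a least one, and that lies below the horizon; so an
        -- unsuccessful search contradicts existence under double negation.
        choose (inj₂ none) = ⊥-elim (stabilised-point 0 λ { (w , s) → found (Wait.search w) none (⇒stable w s) })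

    γ : ℕ → ℕ
    γ v = act (proj₁ (carry 0 v)) (proj₁ base)

    -- Both h σ and τ send 0 to the image of v under h, so they differ by an element of the
    -- stabiliser of 0, which fixes `w₀`. The choices made by `carry` therefore do no harm.
    γ-equivariant : ∀ h v → act h (γ v) ≡ γ (⟦ h ⟧ v)
    γ-equivariant h v = trans (sym (act-∘ h σ w₀)) (trans (sym (act-inv′ τ _)) (cong (act τ)
        (trans (sym (act-∘ (inv τ) (h ∘G σ) w₀)) (proj₂ base (inv τ ∘G h ∘G σ) fixes0))))
      where
      w₀ = proj₁ base
      σ = proj₁ (carry 0 v)
      τ = proj₁ (carry 0 (⟦ h ⟧ v))
      fixes0 : ⟦ inv τ ∘G h ∘G σ ⟧ 0 ≡ 0
      fixes0 = trans (cong (⟦ τ ⟧⁻ ∘ ⟦ h ⟧) (proj₂ (carry 0 v)))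
        (trans (cong ⟦ τ ⟧⁻ (sym (proj₂ (carry 0 (⟦ h ⟧ v))))) (⟦⟧⁻-⟦⟧ τ 0))

  -- By equivariance on both sides the composite is fixed by the stabiliser of v, and that
  -- stabiliser moves every vertex except v.
  γ-inverse : ∀ Φ v → γ (reverse Φ) (γ Φ v) ≡ v
  γ-inverse Φ v = decidable-stable (γ (reverse Φ) (γ Φ v) ≟ v) λ ≢v → refute (mover-of (v ∷ []) _ λ { (here e) → ≢v e })
    where
    open Automorphism Φ
    v′ = γ (reverse Φ) (γ Φ v)
    refute : (Σ G λ y → Fixes (v ∷ []) y × ⟦ y ⟧ v′ ≢ v′) → ⊥
    refute (y , y-fix , moves) = moves (trans (sym (ψφ y v′)) (trans (γ-equivariant (reverse Φ) (φ y) (γ Φ v))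
      (cong (γ (reverse Φ)) (trans (γ-equivariant Φ y v) (cong (γ Φ) (y-fix (here refl)))))))

  module _ (Φ : Automorphism) where
    open Automorphism Φ
    private
      Ψ = reverse Φ

    conjugator : ℕ ↔ ℕ
    conjugator = mk↔ₛ′ (γ Φ) (γ Ψ) (γ-inverse Ψ) (γ-inverse Φ)

    conjugates : ∀ h u → ⟦ φ h ⟧ u ≡ γ Φ (⟦ h ⟧ (γ Ψ u))
    conjugates h u = trans (cong ⟦ φ h ⟧ (sym (γ-inverse Ψ u))) (γ-equivariant Φ h (γ Ψ u))

  module Palette where
    end : Colour → ℕ
    end i = proj₁ (ext (0 ∷ []) (λ _ → i))

    end≢0 : ∀ i → end i ≢ 0
    end≢0 i e = proj₁ (proj₂ (ext (0 ∷ []) (λ _ → i))) (subst (_∈ 0 ∷ []) (sym e) (here refl))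

    end-colour : ∀ i → cc (end i) 0 ≡ i
    end-colour i = proj₂ (proj₂ (ext (0 ∷ []) (λ _ → i))) (here refl)

    -- Each colour i has a reference edge from `end i` to 0; the colour of its image under γ is the
    -- new colour.
    recolour : Automorphism → Colour → Colour
    recolour Φ i = cc (γ Φ (end i)) (γ Φ 0)

    -- Some h in G carries the reference edge to the edge from u to v. Then `φ h` carries the one
    -- γ-image to the other and preserves colours.
    γ-colour : ∀ Φ u v → u ≢ v → cc (γ Φ u) (γ Φ v) ≡ recolour Φ (cc u v)
    γ-colour Φ u v u≢v = trans (cong₂ cc (sym (h-γ (h-∈ (here refl)))) (sym (h-γ (h-∈ (there (here refl))))))
        (⟦⟧-colour (φ h) _ _ λ e → end≢0 i (trans (sym (γ-inverse Φ (end i))) (trans (cong (γ (reverse Φ)) e) (γ-inverse Φ 0))))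
      where
      open Automorphism Φ
      i = cc u v
      L : List (ℕ × ℕ)
      L = (end i , u) ∷ (0 , v) ∷ []
      pi : PI L
      pi (here refl) (here refl) = record { fun = λ _ → refl ; inj = λ _ → refl ; col = λ n → contradiction refl n }
      pi (here refl) (there (here refl)) = record
        { fun = λ e → contradiction e (end≢0 i) ; inj = λ e → contradiction e u≢v ; col = λ _ → sym (end-colour i) }
      pi (there (here refl)) (here refl) = record
        { fun = λ e → contradiction (sym e) (end≢0 i) ; inj = λ e → contradiction (sym e) u≢v
        ; col = λ _ → trans (cc-sym v u) (trans (sym (end-colour i)) (cc-sym _ _)) }
      pi (there (here refl)) (there (here refl)) = record { fun = λ _ → refl ; inj = λ _ → refl ; col = λ n → contradiction refl n }
      h : G
      h = proj₁ (fromPI L pi)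
      h-∈ : ∀ {a b} → (a , b) ∈ L → ⟦ h ⟧ a ≡ b
      h-∈ = proj₂ (fromPI L pi)
      h-γ : ∀ {a b} → ⟦ h ⟧ a ≡ b → ⟦ φ h ⟧ (γ Φ a) ≡ γ Φ b
      h-γ {a} e = trans (γ-equivariant Φ h a) (cong (γ Φ) e)

    recolour-inverse : ∀ Φ i → recolour (reverse Φ) (recolour Φ i) ≡ i
    recolour-inverse Φ i = trans (sym (γ-colour (reverse Φ) _ _ λ e → end≢0 i
        (trans (sym (γ-inverse Φ (end i))) (trans (cong (γ (reverse Φ)) e) (γ-inverse Φ 0)))))
      (trans (cong₂ cc (γ-inverse Φ (end i)) (γ-inverse Φ 0)) (end-colour i))

    conjugator-Aut* : ∀ Φ → IsAut* c (conjugator Φ)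
    conjugator-Aut* Φ = mk↔ₛ′ (recolour Φ) (recolour (reverse Φ)) (recolour-inverse (reverse Φ)) (recolour-inverse Φ) , γ-colour Φ

  fromGroupAut : GroupAut c → Automorphism
  fromGroupAut Φ = record
    { φ = φ ; ψ = φ-inv ; φ-cong = φ-cong ; ψ-cong = φ-inv-cong
    ; φ-∘ = λ h g → φ-hom g h
    ; ψ-∘ = λ h g u → trans (φ-inv-cong (h ∘G g) (φ (φ-inv h ∘G φ-inv g)) (λ u → sym (trans (φ-hom (φ-inv g) (φ-inv h) u)
        (trans (cong ⟦ φ (φ-inv h) ⟧ (φ-φ-inv g u)) (φ-φ-inv h _)))) u) (φ-inv-φ (φ-inv h ∘G φ-inv g) u)
    ; φψ = φ-φ-inv ; ψφ = φ-inv-φ }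
    where open GroupAut Φ

  -- If g and g′ differ at u, the vertex x = g⁻¹ (g′ u) is not u, and some y in G fixes u and moves
  -- x. At g′ u the conjugate of y by g′ is trivial, while the conjugate by g is not.
  faithful : (g g′ : Perm) → ((h : Perm) → IsAut c h → ∀ u → conj g h u ≡ conj g′ h u) →
    ∀ u → Inverse.to g u ≡ Inverse.to g′ u
  faithful g g′ same u = decidable-stable (to g u ≟ to g′ u) λ differ → refute differ (mover-of (u ∷ []) x λ { (here e) → differ (trans (cong (to g) (sym e)) (strictlyInverseˡ g _)) })
    where
    open Inverse
    x = from g (to g′ u)
    refute : to g u ≢ to g′ u → (Σ G λ y → Fixes (u ∷ []) y × ⟦ y ⟧ x ≢ x) → ⊥
    refute _ (y , y-fix , moves) = moves (trans (sym (strictlyInverseʳ g _)) (cong (from g) (trans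
      (same (proj₁ y) (proj₂ y) (to g′ u)) (trans (cong (to g′ ∘ ⟦ y ⟧) (strictlyInverseʳ g′ u)) (cong (to g′) (y-fix (here refl)))))))

-- The extension property of the graph, and the theorem

module _ {k : ℕ} (c : Colouring (suc k) ℕ) (universal : Universal c) (homogeneous : Homogeneous c) where

  -- Universality embeds the graph on 0, ..., N - 1 together with a new vertex, which is `zero` in
  -- `Fin (suc N)`. Homogeneity then moves the old vertices back to their places and takes the new
  -- one along.
  extension : Extension (edge c)
  extension l t = Inverse.to σ (f zero) , v∉ , v-colour
    where
    N : ℕ
    N = bound id l
    d : Colouring (suc k) (Fin (suc N))
    d = record { col = colour ; sym = colour-sym }
      where
      colour : Fin (suc N) → Fin (suc N) → Fin (suc k)
      colour zero    zero    = zero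
      colour zero    (suc j) = t (toℕ j)
      colour (suc i) zero    = t (toℕ i)
      colour (suc i) (suc j) = edge c (toℕ i) (toℕ j)
      colour-sym : ∀ i j → colour i j ≡ colour j i
      colour-sym zero    zero    = refl
      colour-sym zero    (suc j) = refl
      colour-sym (suc i) zero    = refl
      colour-sym (suc i) (suc j) = Colouring.sym c _ _
    embedding = universal (Fin (suc N)) (toℕ , Fin.toℕ-injective) d
    f : Fin (suc N) → ℕ
    f = proj₁ embedding
    f-inj : Injective _≡_ _≡_ f
    f-inj = proj₁ (proj₂ embedding)
    extended = homogeneous N (f ∘ suc) toℕ (Fin.suc-injective ∘ f-inj) Fin.toℕ-injective
      λ i j i≢j → proj₂ (proj₂ embedding) (suc i) (suc j) (i≢j ∘ Fin.suc-injective)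
    σ : Perm
    σ = proj₁ extended
    σ-f : ∀ {u} (u<N : u < N) → Inverse.to σ (f (suc (fromℕ< u<N))) ≡ u
    σ-f u<N = trans (proj₂ (proj₂ extended) (fromℕ< u<N)) (Fin.toℕ-fromℕ< u<N)
    v∉ : Inverse.to σ (f zero) ∉ l
    v∉ p with f-inj (trans (sym (Inverse.strictlyInverseʳ σ _)) (trans (cong (Inverse.from σ) (sym (σ-f (bound-∈ id p)))) (Inverse.strictlyInverseʳ σ _)))
    ... | ()
    v-colour : ∀ {u} → u ∈ l → edge c (Inverse.to σ (f zero)) u ≡ t u
    v-colour {u} p = trans (cong (edge c _) (sym (σ-f (bound-∈ id p))))
      (trans (proj₁ (proj₂ extended) _ _ λ e → contradiction (f-inj e) λ ())
      (trans (proj₂ (proj₂ embedding) zero (suc (fromℕ< (bound-∈ id p))) λ ()) (cong t (Fin.toℕ-fromℕ< (bound-∈ id p)))))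

conj-preserves : ∀ {m} (c : Colouring m ℕ) (g : Perm) → IsAut* c g → (h : Perm) → IsAut c h → PreservesCol c (conj g h)
conj-preserves c g (π , g-col) h h-col u v u≢v = begin
  edge c (to g (to h x)) (to g (to h y))   ≡⟨ g-col _ _ (x≢y ∘ injective) ⟩
  to π (edge c (to h x) (to h y))          ≡⟨ cong (to π) (h-col x y x≢y) ⟩
  to π (edge c x y)                        ≡⟨ g-col x y x≢y ⟨
  edge c (to g x) (to g y)                 ≡⟨ cong₂ (edge c) (strictlyInverseˡ g u) (strictlyInverseˡ g v) ⟩
  edge c u v ∎
  where
  open Inverse
  open ≡-Reasoning
  x = from g u
  y = from g v
  x≢y : x ≢ y
  x≢y e = u≢v (trans (sym (strictlyInverseˡ g u)) (trans (cong (to g) e) (strictlyInverseˡ g v)))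
  injective : to h x ≡ to h y → x ≡ y
  injective e = trans (sym (strictlyInverseʳ h x)) (trans (cong (from h) e) (strictlyInverseʳ h y))

theorem2 : (m : ℕ) → 2 ≤ m → (c : Colouring m ℕ) → Universal c → Homogeneous c →
    ((g : Perm) → IsAut* c g → (h : Perm) → IsAut c h →
    PreservesCol c (conj g h))
    × ((g g′ : Perm) → IsAut* c g → IsAut* c g′ →
    ((h : Perm) → IsAut c h → ∀ u → conj g h u ≡ conj g′ h u) →
    ∀ u → Inverse.to g u ≡ Inverse.to g′ u)
    × ((Φ : GroupAut c) → Σ Perm λ g → IsAut* c g ×
    ((h : Perm) (hA : IsAut c h) → ∀ u →
    Inverse.to (proj₁ (GroupAut.φ Φ (h , hA))) u ≡ conj g h u))
theorem2 (suc k) _ c universal homogeneous =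
  conj-preserves c ,
  (λ g g′ _ _ → faithful g g′) ,
  λ Φ → conjugator (fromGroupAut Φ) , Palette.conjugator-Aut* (fromGroupAut Φ) ,
        λ h h-aut → conjugates (fromGroupAut Φ) (h , h-aut)
  where open Reconstruction k c (extension c universal homogeneous)
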